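{- Let $G=(V,E)$ be a perfect graph with $|V|=n$, let $k\in\{2,\dots,n\}$ be an integer, and fix $\hat\epsilon$ with $0<\hat\epsilon\le\frac{1}{(k+1)\left((k-1)n(n-1)+2\right)}$. Then for any integer $\hat T\ge\frac{1}{\hat\epsilon}\ln\left(\frac{2n}{\hat\epsilon}\right)$, the following two statements are equivalent: (i) $G$ has no clique of size $k$. (ii) There exists a probability vector $p\in\Delta_{|\bar E|+1}$, $p=(p_0,p_{ij})$ with $ij\in\bar E$, such that the matrix $A_{G_p}=\sum_{ij\in\bar E}-p_{ij}Y_{ij}+p_0J+I$ satisfies $$\max_{i\in S}\frac{\psi_{2\hat T+1,A_{G_p}}(i)}{\psi_{2\hat T,A_{G_p}}(i)}<(1-\hat\epsilon)(p_0k+1),$$ where $S=\{i\in[n]:\psi_{2\hat T,A_{G_p}}(i)>0\}$.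
   Context: All graphs are finite and simple. A graph $G$ is perfect if $\chi(H)=\omega(H)$ for every induced subgraph $H$ of $G$, where $\chi$ is the chromatic number and $\omega$ the clique number. $\bar E$ denotes the set of nonedges of $G=(V,E)$ (unordered pairs of distinct nonadjacent vertices), and $V$ is identified with $[n]=\{1,\dots,n\}$. $\Delta_{|\bar E|+1}$ is the probability simplex in $\mathbb{R}^{|\bar E|+1}$, with coordinates indexed by the nonedges $ij\in\bar E$ together with one special index $0$. $J$ is the $n\times n$ all-ones matrix, $I$ the identity matrix, and $Y_{ij}$ the $n\times n$ symmetric matrix with ones in entries $(i,j)$ and $(j,i)$ and zeros elsewhere. Walk weights: for a symmetric $A\in\mathbb{R}^{n\times n}$ (a weighted adjacency matrix, with diagonal entries the weights of self-loops) and an integer $t\ge 1$, $\psi_{t,A}(i,j)=\sum_{(v_1,\dots,v_{t+1})\in[n]^{t+1}:\,v_1=i,\,v_{t+1}=j}\ \prod_{m=1}^{t}A_{v_m v_{m+1}}$, and $\psi_{t,A}(i)=\psi_{t,A}(i,i)$. -}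

module Defs where

open import Algebra.Bundles using (RawRing)
open import Data.Bool.Base using (if_then_else_)
open import Data.Fin.Base as Fin using (Fin; zero; suc; inject₁)
import Data.Fin.Properties as Fin
open import Data.Fin.Subset using (Subset; _∈_; ∣_∣)
open import Data.Integer.Base using (+_)
open import Data.List.Base as List using (List; []; _∷_; allFin; filter)
open import Data.Nat.Base as ℕ using (ℕ; zero; suc)
import Data.Nat.Properties as ℕ
open import Data.Product.Base using (_×_; _,_; ∃; ∃-syntax; proj₁; proj₂)
open import Data.Rational.Base as ℚ using (ℚ; 0ℚ; 1ℚ; ½)
import Data.Rational.Properties as ℚ
open import Data.Rational.Solver using (module +-*-Solver)
open import Data.Sum.Base using (_⊎_)
open import Data.Vec.Base as Vec using (Vec; []; _∷_; lookup; head; last)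
open import Data.Vec.Functional using (Vector)
open import Function.Base using (_∘_)
open import Function.Bundles using (_↣_; Injection)
open import Level using (0ℓ)
open import Relation.Binary.Core using (Rel)
open import Relation.Binary.Definitions using (Decidable; Symmetric; Irreflexive)
open import Relation.Binary.PropositionalEquality
  using (_≡_; _≢_; refl; sym; trans; cong; subst; subst₂)
open import Relation.Nullary using (¬_; does)
open import Relation.Nullary.Decidable using (¬?; _×-dec_; _⊎-dec_)

------------------------------------------------------------------------
-- Real numbers: Cauchy sequences of rationals, with equality _≈_ below

Cauchy : (ℕ → ℚ) → Set
Cauchy s = ∀ ε → 0ℚ ℚ.< ε →
  ∃[ N ] ∀ m n → N ℕ.≤ m → N ℕ.≤ n → ℚ.∣ s m ℚ.- s n ∣ ℚ.< ε

record ℝ : Set where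
  constructor mkℝ
  field
    seq    : ℕ → ℚ
    cauchy : Cauchy seq

open ℝ public

open +-*-Solver using (solve; _:+_; _:*_; _:-_; :-_; _:=_)

module CauchyClosure where

  a≡[a-b]+b : ∀ a b → a ≡ (a ℚ.- b) ℚ.+ b
  a≡[a-b]+b = solve 2 (λ a b → a := (a :- b) :+ b) refl

  [a+c]-[b+d] : ∀ a b c d → (a ℚ.+ c) ℚ.- (b ℚ.+ d) ≡ (a ℚ.- b) ℚ.+ (c ℚ.- d)
  [a+c]-[b+d] = solve 4 (λ a b c d → (a :+ c) :- (b :+ d) := (a :- b) :+ (c :- d)) refl

  -[a-b] : ∀ a b → ℚ.- (a ℚ.- b) ≡ (ℚ.- a) ℚ.- (ℚ.- b)
  -[a-b] = solve 2 (λ a b → :- (a :- b) := (:- a) :- (:- b)) refl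

  ac-bd : ∀ a b c d → a ℚ.* c ℚ.- b ℚ.* d ≡ (a ℚ.- b) ℚ.* c ℚ.+ (c ℚ.- d) ℚ.* b
  ac-bd = solve 4 (λ a b c d → a :* c :- b :* d := (a :- b) :* c :+ (c :- d) :* b) refl

  [i-j]ab : ∀ i j a b → (i ℚ.- j) ℚ.* (a ℚ.* b) ≡ (i ℚ.* a) ℚ.* b ℚ.- (j ℚ.* b) ℚ.* a
  [i-j]ab = solve 4 (λ i j a b → (i :- j) :* (a :* b) := (i :* a) :* b :- (j :* b) :* a) refl

  half-pos : ∀ ε → 0ℚ ℚ.< ε → 0ℚ ℚ.< ε ℚ.* ½
  half-pos ε ε>0 = subst (ℚ._< ε ℚ.* ½) (ℚ.*-zeroˡ ½) (ℚ.*-monoˡ-<-pos ½ ε>0)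

  halves : ∀ ε → ε ℚ.* ½ ℚ.+ ε ℚ.* ½ ≡ ε
  halves ε = trans (sym (ℚ.*-distribˡ-+ ε ½ ½)) (ℚ.*-identityʳ ε)

  *-pos : ∀ {p q} → 0ℚ ℚ.< p → 0ℚ ℚ.< q → 0ℚ ℚ.< p ℚ.* q
  *-pos {p} {q} p>0 q>0 =
    subst (ℚ._< p ℚ.* q) (ℚ.*-zeroˡ q)
      (ℚ.*-monoˡ-<-pos q {{ℚ.positive q>0}} p>0)

  recip : (q : ℚ) → 0ℚ ℚ.< q → ℚ
  recip q q>0 = (ℚ.1/ q) {{ℚ.pos⇒nonZero q {{ℚ.positive q>0}}}}

  recip-pos : ∀ q (q>0 : 0ℚ ℚ.< q) → 0ℚ ℚ.< recip q q>0
  recip-pos q q>0 =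
    ℚ.positive⁻¹ (recip q q>0) {{ℚ.1/pos⇒pos q {{ℚ.positive q>0}}}}

  recip-inverse : ∀ q (q>0 : 0ℚ ℚ.< q) → recip q q>0 ℚ.* q ≡ 1ℚ
  recip-inverse q q>0 = ℚ.*-inverseˡ q {{ℚ.pos⇒nonZero q {{ℚ.positive q>0}}}}

  *-mono-nonNeg : ∀ {p q r s} → 0ℚ ℚ.≤ r → 0ℚ ℚ.≤ q →
                  p ℚ.≤ q → r ℚ.≤ s → p ℚ.* r ℚ.≤ q ℚ.* s
  *-mono-nonNeg {p} {q} {r} {s} r≥0 q≥0 p≤q r≤s = ℚ.≤-trans
    (ℚ.*-monoʳ-≤-nonNeg r {{ℚ.nonNegative r≥0}} p≤q)
    (ℚ.*-monoˡ-≤-nonNeg q {{ℚ.nonNegative q≥0}} r≤s)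

  bounded : (x : ℝ) → ∃[ N ] ∃[ B ] 0ℚ ℚ.< B × ∀ n → N ℕ.≤ n → ℚ.∣ seq x n ∣ ℚ.≤ B
  bounded x = N , B , B>0 , bound
    where
    N = proj₁ (cauchy x 1ℚ (ℚ.positive⁻¹ 1ℚ))
    B = 1ℚ ℚ.+ ℚ.∣ seq x N ∣
    B>0 : 0ℚ ℚ.< B
    B>0 = ℚ.+-mono-<-≤ (ℚ.positive⁻¹ 1ℚ) (ℚ.0≤∣p∣ (seq x N))
    bound : ∀ n → N ℕ.≤ n → ℚ.∣ seq x n ∣ ℚ.≤ B
    bound n N≤n = begin
      ℚ.∣ a ∣                        ≡⟨ cong ℚ.∣_∣ (a≡[a-b]+b a b) ⟩
      ℚ.∣ (a ℚ.- b) ℚ.+ b ∣          ≤⟨ ℚ.∣p+q∣≤∣p∣+∣q∣ (a ℚ.- b) b ⟩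
      ℚ.∣ a ℚ.- b ∣ ℚ.+ ℚ.∣ b ∣      ≤⟨ ℚ.+-monoˡ-≤ ℚ.∣ b ∣ (ℚ.<⇒≤
                                          (proj₂ (cauchy x 1ℚ (ℚ.positive⁻¹ 1ℚ)) n N N≤n ℕ.≤-refl)) ⟩
      1ℚ ℚ.+ ℚ.∣ b ∣                 ∎
      where
      open ℚ.≤-Reasoning
      a = seq x n
      b = seq x N

  cauchy-const : ∀ q → Cauchy (λ _ → q)
  cauchy-const q ε ε>0 = 0 , λ _ _ _ _ →
    subst (ℚ._< ε) (sym (cong ℚ.∣_∣ (ℚ.+-inverseʳ q))) ε>0

  cauchy-+ : ∀ x y → Cauchy (λ n → seq x n ℚ.+ seq y n)
  cauchy-+ x y ε ε>0 = Nx ℕ.⊔ Ny , close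
    where
    open ℚ.≤-Reasoning
    δ>0 = half-pos ε ε>0
    Nx = proj₁ (cauchy x (ε ℚ.* ½) δ>0)
    Ny = proj₁ (cauchy y (ε ℚ.* ½) δ>0)
    close : ∀ m n → Nx ℕ.⊔ Ny ℕ.≤ m → Nx ℕ.⊔ Ny ℕ.≤ n →
            ℚ.∣ (seq x m ℚ.+ seq y m) ℚ.- (seq x n ℚ.+ seq y n) ∣ ℚ.< ε
    close m n N≤m N≤n = begin-strict
      ℚ.∣ (a ℚ.+ c) ℚ.- (b ℚ.+ d) ∣
        ≡⟨ cong ℚ.∣_∣ ([a+c]-[b+d] a b c d) ⟩
      ℚ.∣ (a ℚ.- b) ℚ.+ (c ℚ.- d) ∣
        ≤⟨ ℚ.∣p+q∣≤∣p∣+∣q∣ (a ℚ.- b) (c ℚ.- d) ⟩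
      ℚ.∣ a ℚ.- b ∣ ℚ.+ ℚ.∣ c ℚ.- d ∣
        <⟨ ℚ.+-mono-<
             (proj₂ (cauchy x (ε ℚ.* ½) δ>0) m n (ℕ.m⊔n≤o⇒m≤o Nx Ny N≤m) (ℕ.m⊔n≤o⇒m≤o Nx Ny N≤n))
             (proj₂ (cauchy y (ε ℚ.* ½) δ>0) m n (ℕ.m⊔n≤o⇒n≤o Nx Ny N≤m) (ℕ.m⊔n≤o⇒n≤o Nx Ny N≤n)) ⟩
      ε ℚ.* ½ ℚ.+ ε ℚ.* ½
        ≡⟨ halves ε ⟩
      ε ∎
      where
      a = seq x m
      b = seq x n
      c = seq y m
      d = seq y n

  cauchy-neg : ∀ x → Cauchy (λ n → ℚ.- seq x n)
  cauchy-neg x ε ε>0 = proj₁ (cauchy x ε ε>0) , λ m n N≤m N≤n →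
    subst (ℚ._< ε) (eq (seq x m) (seq x n)) (proj₂ (cauchy x ε ε>0) m n N≤m N≤n)
    where
    eq : ∀ a b → ℚ.∣ a ℚ.- b ∣ ≡ ℚ.∣ (ℚ.- a) ℚ.- (ℚ.- b) ∣
    eq a b = trans (sym (ℚ.∣-p∣≡∣p∣ (a ℚ.- b)))
      (cong ℚ.∣_∣ (-[a-b] a b))

  small : ∀ δ u v D (D>0 : 0ℚ ℚ.< D) →
          ℚ.∣ u ∣ ℚ.< δ ℚ.* recip D D>0 → ℚ.∣ v ∣ ℚ.≤ D →
          ℚ.∣ u ℚ.* v ∣ ℚ.< δ
  small δ u v D D>0 u< v≤ = begin-strict
    ℚ.∣ u ℚ.* v ∣                 ≡⟨ ℚ.∣p*q∣≡∣p∣*∣q∣ u v ⟩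
    ℚ.∣ u ∣ ℚ.* ℚ.∣ v ∣           ≤⟨ ℚ.*-monoˡ-≤-nonNeg ℚ.∣ u ∣ {{ℚ.∣-∣-nonNeg u}} v≤ ⟩
    ℚ.∣ u ∣ ℚ.* D                 <⟨ ℚ.*-monoˡ-<-pos D {{ℚ.positive D>0}} u< ⟩
    (δ ℚ.* recip D D>0) ℚ.* D     ≡⟨ ℚ.*-assoc δ (recip D D>0) D ⟩
    δ ℚ.* (recip D D>0 ℚ.* D)     ≡⟨ cong (λ w → δ ℚ.* w) (recip-inverse D D>0) ⟩
    δ ℚ.* 1ℚ                      ≡⟨ ℚ.*-identityʳ δ ⟩
    δ                             ∎
    where open ℚ.≤-Reasoning

  product-close : ∀ δ a b c d B C (B>0 : 0ℚ ℚ.< B) (C>0 : 0ℚ ℚ.< C) →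
    ℚ.∣ a ℚ.- b ∣ ℚ.< δ ℚ.* recip C C>0 → ℚ.∣ c ℚ.- d ∣ ℚ.< δ ℚ.* recip B B>0 →
    ℚ.∣ c ∣ ℚ.≤ C → ℚ.∣ b ∣ ℚ.≤ B →
    ℚ.∣ a ℚ.* c ℚ.- b ℚ.* d ∣ ℚ.< δ ℚ.+ δ
  product-close δ a b c d B C B>0 C>0 a-b< c-d< c≤C b≤B = begin-strict
    ℚ.∣ a ℚ.* c ℚ.- b ℚ.* d ∣
      ≡⟨ cong ℚ.∣_∣ (ac-bd a b c d) ⟩
    ℚ.∣ (a ℚ.- b) ℚ.* c ℚ.+ (c ℚ.- d) ℚ.* b ∣
      ≤⟨ ℚ.∣p+q∣≤∣p∣+∣q∣ ((a ℚ.- b) ℚ.* c) ((c ℚ.- d) ℚ.* b) ⟩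
    ℚ.∣ (a ℚ.- b) ℚ.* c ∣ ℚ.+ ℚ.∣ (c ℚ.- d) ℚ.* b ∣
      <⟨ ℚ.+-mono-< (small δ (a ℚ.- b) c C C>0 a-b< c≤C) (small δ (c ℚ.- d) b B B>0 c-d< b≤B) ⟩
    δ ℚ.+ δ ∎
    where open ℚ.≤-Reasoning

  cauchy-* : ∀ x y → Cauchy (λ n → seq x n ℚ.* seq y n)
  cauchy-* x y ε ε>0 = N , close
    where
    δ = ε ℚ.* ½
    δ>0 = half-pos ε ε>0
    Mx = proj₁ (bounded x)
    My = proj₁ (bounded y)
    B = proj₁ (proj₂ (bounded x))
    C = proj₁ (proj₂ (bounded y))
    B>0 = proj₁ (proj₂ (proj₂ (bounded x)))
    C>0 = proj₁ (proj₂ (proj₂ (bounded y)))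
    η>0 = *-pos δ>0 (recip-pos C C>0)
    θ>0 = *-pos δ>0 (recip-pos B B>0)
    Nx = proj₁ (cauchy x (δ ℚ.* recip C C>0) η>0)
    Ny = proj₁ (cauchy y (δ ℚ.* recip B B>0) θ>0)
    N = (Mx ℕ.⊔ My) ℕ.⊔ (Nx ℕ.⊔ Ny)

    Mx≤ : ∀ {i} → N ℕ.≤ i → Mx ℕ.≤ i
    Mx≤ = ℕ.m⊔n≤o⇒m≤o Mx My ∘ ℕ.m⊔n≤o⇒m≤o (Mx ℕ.⊔ My) (Nx ℕ.⊔ Ny)
    My≤ : ∀ {i} → N ℕ.≤ i → My ℕ.≤ i
    My≤ = ℕ.m⊔n≤o⇒n≤o Mx My ∘ ℕ.m⊔n≤o⇒m≤o (Mx ℕ.⊔ My) (Nx ℕ.⊔ Ny)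
    Nx≤ : ∀ {i} → N ℕ.≤ i → Nx ℕ.≤ i
    Nx≤ = ℕ.m⊔n≤o⇒m≤o Nx Ny ∘ ℕ.m⊔n≤o⇒n≤o (Mx ℕ.⊔ My) (Nx ℕ.⊔ Ny)
    Ny≤ : ∀ {i} → N ℕ.≤ i → Ny ℕ.≤ i
    Ny≤ = ℕ.m⊔n≤o⇒n≤o Nx Ny ∘ ℕ.m⊔n≤o⇒n≤o (Mx ℕ.⊔ My) (Nx ℕ.⊔ Ny)

    close : ∀ m n → N ℕ.≤ m → N ℕ.≤ n →
            ℚ.∣ seq x m ℚ.* seq y m ℚ.- seq x n ℚ.* seq y n ∣ ℚ.< ε
    close m n N≤m N≤n =
      subst (ℚ.∣ seq x m ℚ.* seq y m ℚ.- seq x n ℚ.* seq y n ∣ ℚ.<_) (halves ε)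
        (product-close δ (seq x m) (seq x n) (seq y m) (seq y n) B C B>0 C>0
          (proj₂ (cauchy x _ η>0) m n (Nx≤ N≤m) (Nx≤ N≤n))
          (proj₂ (cauchy y _ θ>0) m n (Ny≤ N≤m) (Ny≤ N≤n))
          (proj₂ (proj₂ (proj₂ (bounded y))) m (My≤ N≤m))
          (proj₂ (proj₂ (proj₂ (bounded x))) n (Mx≤ N≤n)))

open CauchyClosure

infix  4 _≈_ _≤_ _<_ _⟶_
infixl 6 _+_ _-_
infixl 7 _*_
infix  8 -_
infix  9 _⁻¹[_]

_≈_ : Rel ℝ 0ℓ
x ≈ y = ∀ ε → 0ℚ ℚ.< ε → ∃[ N ] ∀ n → N ℕ.≤ n → ℚ.∣ seq x n ℚ.- seq y n ∣ ℚ.< ε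

_≤_ : Rel ℝ 0ℓ
x ≤ y = ∀ ε → 0ℚ ℚ.< ε → ∃[ N ] ∀ n → N ℕ.≤ n → seq x n ℚ.≤ seq y n ℚ.+ ε

_<_ : Rel ℝ 0ℓ
x < y = ∃[ δ ] 0ℚ ℚ.< δ × ∃[ N ] ∀ n → N ℕ.≤ n → seq x n ℚ.+ δ ℚ.≤ seq y n

fromℚ : ℚ → ℝ
fromℚ q = mkℝ (λ _ → q) (cauchy-const q)

fromℕ : ℕ → ℝ
fromℕ n = fromℚ (+ n ℚ./ 1)

0ℝ 1ℝ : ℝ
0ℝ = fromℚ 0ℚ
1ℝ = fromℚ 1ℚ

_+_ _*_ : ℝ → ℝ → ℝ
x + y = mkℝ (λ n → seq x n ℚ.+ seq y n) (cauchy-+ x y)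
x * y = mkℝ (λ n → seq x n ℚ.* seq y n) (cauchy-* x y)

-_ : ℝ → ℝ
- x = mkℝ (λ n → ℚ.- seq x n) (cauchy-neg x)

_-_ : ℝ → ℝ → ℝ
x - y = x + (- y)

module Reciprocal (x : ℝ) (x>0 : 0ℝ < x) where
  δ = proj₁ x>0
  δ>0 = proj₁ (proj₂ x>0)
  N = proj₁ (proj₂ (proj₂ x>0))

  tail : ℕ → ℚ
  tail n = seq x (N ℕ.+ n)

  δ≤tail : ∀ n → δ ℚ.≤ tail n
  δ≤tail n = subst (ℚ._≤ tail n) (ℚ.+-identityˡ δ)
    (proj₂ (proj₂ (proj₂ x>0)) (N ℕ.+ n) (ℕ.m≤m+n N n))

  tail>0 : ∀ n → 0ℚ ℚ.< tail n
  tail>0 n = ℚ.<-≤-trans δ>0 (δ≤tail n)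

  inv : ℕ → ℚ
  inv n = recip (tail n) (tail>0 n)

  inv-cauchy : Cauchy inv
  inv-cauchy ε ε>0 = M , close
    where
    open ℚ.≤-Reasoning
    η = ε ℚ.* (δ ℚ.* δ)
    η>0 = *-pos ε>0 (*-pos δ>0 δ>0)
    M = proj₁ (cauchy x η η>0)
    close : ∀ m n → M ℕ.≤ m → M ℕ.≤ n → ℚ.∣ inv m ℚ.- inv n ∣ ℚ.< ε
    close m n M≤m M≤n =
      ℚ.*-cancelʳ-<-nonNeg (a ℚ.* b) {{ℚ.nonNegative (ℚ.<⇒≤ ab>0)}} (begin-strict
        ℚ.∣ inv m ℚ.- inv n ∣ ℚ.* (a ℚ.* b)
          ≡⟨ cong (ℚ.∣ inv m ℚ.- inv n ∣ ℚ.*_) (ℚ.0≤p⇒∣p∣≡p (ℚ.<⇒≤ ab>0)) ⟨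
        ℚ.∣ inv m ℚ.- inv n ∣ ℚ.* ℚ.∣ a ℚ.* b ∣
          ≡⟨ ℚ.∣p*q∣≡∣p∣*∣q∣ (inv m ℚ.- inv n) (a ℚ.* b) ⟨
        ℚ.∣ (inv m ℚ.- inv n) ℚ.* (a ℚ.* b) ∣
          ≡⟨ cong ℚ.∣_∣ clear ⟩
        ℚ.∣ b ℚ.- a ∣
          <⟨ proj₂ (cauchy x η η>0) (N ℕ.+ n) (N ℕ.+ m)
               (ℕ.≤-trans M≤n (ℕ.m≤n+m n N)) (ℕ.≤-trans M≤m (ℕ.m≤n+m m N)) ⟩
        ε ℚ.* (δ ℚ.* δ)
          ≤⟨ ℚ.*-monoˡ-≤-nonNeg ε {{ℚ.nonNegative (ℚ.<⇒≤ ε>0)}}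
               (*-mono-nonNeg (ℚ.<⇒≤ δ>0) (ℚ.<⇒≤ (tail>0 m)) (δ≤tail m) (δ≤tail n)) ⟩
        ε ℚ.* (a ℚ.* b) ∎)
      where
      a = tail m
      b = tail n
      ab>0 = *-pos (tail>0 m) (tail>0 n)
      clear : (inv m ℚ.- inv n) ℚ.* (a ℚ.* b) ≡ b ℚ.- a
      clear = begin-equality
        (inv m ℚ.- inv n) ℚ.* (a ℚ.* b)
          ≡⟨ [i-j]ab (inv m) (inv n) a b ⟩
        (inv m ℚ.* a) ℚ.* b ℚ.- (inv n ℚ.* b) ℚ.* a
          ≡⟨ cong (λ u → u ℚ.* b ℚ.- (inv n ℚ.* b) ℚ.* a) (recip-inverse a (tail>0 m)) ⟩
        1ℚ ℚ.* b ℚ.- (inv n ℚ.* b) ℚ.* a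
          ≡⟨ cong (λ u → 1ℚ ℚ.* b ℚ.- u ℚ.* a) (recip-inverse b (tail>0 n)) ⟩
        1ℚ ℚ.* b ℚ.- 1ℚ ℚ.* a
          ≡⟨ cong (λ u → u ℚ.- 1ℚ ℚ.* a) (ℚ.*-identityˡ b) ⟩
        b ℚ.- 1ℚ ℚ.* a
          ≡⟨ cong (λ u → b ℚ.- u) (ℚ.*-identityˡ a) ⟩
        b ℚ.- a ∎

-- The positivity witness supplies an index N from which every term is
-- positive; the reciprocal is taken termwise on the sequence shifted by N.
_⁻¹[_] : (x : ℝ) → 0ℝ < x → ℝ
x ⁻¹[ x>0 ] = mkℝ inv inv-cauchy
  where open Reciprocal x x>0

ℝ-rawRing : RawRing 0ℓ 0ℓ
ℝ-rawRing = record
  { Carrier = ℝ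
  ; _≈_     = _≈_
  ; _+_     = _+_
  ; _*_     = _*_
  ; -_      = -_
  ; 0#      = 0ℝ
  ; 1#      = 1ℝ
  }

open import Algebra.Definitions.RawSemiring (RawRing.rawSemiring ℝ-rawRing) public
  using (sum; product; _^_)

_⟶_ : (ℕ → ℝ) → ℝ → Set
s ⟶ y = ∀ ε → 0ℚ ℚ.< ε →
  ∃[ N ] ∀ n → N ℕ.≤ n → (y - fromℚ ε < s n) × (s n < y + fromℚ ε)

-- y = eˣ, as the limit of (1 + x/m)ᵐ over m ≥ 1.
IsExp : ℝ → ℝ → Set
IsExp x y = (λ m → (1ℝ + x * fromℚ (+ 1 ℚ./ suc m)) ^ suc m) ⟶ y

-- ℓ = ln x.
IsLn : ℝ → ℝ → Set
IsLn x ℓ = IsExp ℓ x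

------------------------------------------------------------------------
-- Finite simple graphs on the vertex set Fin n

record Graph (n : ℕ) : Set₁ where
  infix 4 _~_ _~?_
  field
    _~_      : Rel (Fin n) 0ℓ
    ~-sym    : Symmetric _~_
    ~-irrefl : Irreflexive _≡_ _~_
    _~?_     : Decidable _~_

module _ {n} (G : Graph n) where
  open Graph G

  IsClique : Subset n → Set
  IsClique U = ∀ {i j} → i ∈ U → j ∈ U → i ≢ j → i ~ j

  HasClique : ℕ → Set
  HasClique k = ∃[ U ] ∣ U ∣ ≡ k × IsClique U

  IsCliqueNumber : ℕ → Set
  IsCliqueNumber w = HasClique w × (∀ k → HasClique k → k ℕ.≤ w)

  Colorable : ℕ → Set
  Colorable c = ∃ λ (f : Fin n → Fin c) → ∀ {i j} → i ~ j → f i ≢ f j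

  IsChromaticNumber : ℕ → Set
  IsChromaticNumber c = Colorable c × (∀ d → Colorable d → c ℕ.≤ d)

  -- Induced subgraph on the image of an injection, its vertices relabelled.
  induced : ∀ {m} → Fin m ↣ Fin n → Graph m
  induced f = record
    { _~_      = λ i j → to i ~ to j
    ; ~-sym    = ~-sym
    ; ~-irrefl = λ { refl → ~-irrefl refl }
    ; _~?_     = λ i j → to i ~? to j
    }
    where open Injection f using (to)

  -- Each nonedge occurs once, as the pair (i , j) with i < j.
  nonEdges : List (Fin n × Fin n)
  nonEdges = filter (λ (i , j) → (i Fin.<? j) ×-dec ¬? (i ~? j))
                    (List.cartesianProduct (allFin n) (allFin n))

  #nonEdges : ℕ
  #nonEdges = List.length nonEdges

  nonEdge : Fin #nonEdges → Fin n × Fin n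
  nonEdge = List.lookup nonEdges

Perfect : ∀ {n} → Graph n → Set
Perfect {n} G = ∀ {m} (f : Fin m ↣ Fin n) →
  ∃[ w ] IsChromaticNumber (induced G f) w × IsCliqueNumber (induced G f) w

------------------------------------------------------------------------
-- Matrices and walk weights

Matrix : ℕ → Set
Matrix n = Fin n → Fin n → ℝ

J : ∀ {n} → Matrix n
J _ _ = 1ℝ

I : ∀ {n} → Matrix n
I a b = if does (a Fin.≟ b) then 1ℝ else 0ℝ

Y : ∀ {n} → Fin n × Fin n → Matrix n
Y (i , j) a b =
  if does (((a Fin.≟ i) ×-dec (b Fin.≟ j)) ⊎-dec ((a Fin.≟ j) ×-dec (b Fin.≟ i)))
  then 1ℝ else 0ℝ

-- Δ d is the probability simplex in ℝᵈ.
Δ : ∀ d → Vector ℝ d → Set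
Δ d p = (∀ e → 0ℝ ≤ p e) × sum p ≈ 1ℝ

-- Coordinate zero of p is p₀; coordinate suc e belongs to the e-th nonedge.
A[_,_] : ∀ {n} (G : Graph n) → Vector ℝ (suc (#nonEdges G)) → Matrix n
A[ G , p ] a b =
  sum (λ e → (- p (suc e)) * Y (nonEdge G e) a b) + p zero * J a b + I a b

tuples : ∀ n m → List (Vec (Fin n) m)
tuples n zero    = [] ∷ []
tuples n (suc m) = List.cartesianProductWith _∷_ (allFin n) (tuples n m)

walks : ∀ {n} t → Fin n → Fin n → List (Vec (Fin n) (suc t))
walks {n} t i j =
  filter (λ v → (head v Fin.≟ i) ×-dec (last v Fin.≟ j)) (tuples n (suc t))

weight : ∀ {n t} → Matrix n → Vec (Fin n) (suc t) → ℝ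
weight A v = product (λ m → A (lookup v (inject₁ m)) (lookup v (suc m)))

ψ : ∀ {n} → ℕ → Matrix n → Fin n → Fin n → ℝ
ψ t A i j = List.foldr _+_ 0ℝ (List.map (weight A) (walks t i j))

ψᵈ : ∀ {n} → ℕ → Matrix n → Fin n → ℝ
ψᵈ t A i = ψ t A i i

-- μ is the maximum of f i over the i satisfying S; f may use the evidence S i.
IsMaximum : ∀ {n} (S : Fin n → Set) → (∀ i → S i → ℝ) → ℝ → Set
IsMaximum S f μ =
  (∃[ i ] ∃ λ (s : S i) → f i s ≈ μ) × (∀ i (s : S i) → f i s ≤ μ)

{-# OPTIONS --safe #-}
module Submission where

-- For p in the simplex, A = A_{G,p} is positive semidefinite, because
-- 2 zᵢ zⱼ ≤ |z|² and the weights sum to 1.  The form of Aᵗ at A x - c x is then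
-- nonnegative, so the moments mₜ = ⟨x, Aᵗ x⟩ satisfy
-- mₜ₊₂ + c² mₜ ≥ 2 c mₜ₊₁; hence mₜ₊₁ ≥ c mₜ propagates to larger t and
-- mₜ₊₁ ≤ c mₜ to smaller t.  This replaces all spectral theory.
--
-- Taking x = eᵢ and c = 1 gives ψₜ(i) ≥ 1, so that S is all of [n].
--
-- (ii) ⇒ (i).  If U is a k-clique, then x = 1_U has m₁ = λ m₀ with λ = p₀ k + 1,
-- so mₜ ≥ λᵗ k, while (ii) gives ψₜ(i) ≤ ((1-ε) λ)ᵗ at t = 2T+1 for all i.
-- Semidefiniteness of Aᵗ bounds ⟨x, Aᵗ x⟩ by n ∑ xᵢ² ψₜ(i), so
-- 1 ≤ n (1-ε)ᵗ, which the choice of T excludes.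
--
-- (i) ⇒ (ii).  Perfectness gives a colouring with at most k-1 colours.  Put
-- weight p₀ on J and (k-1) p₀ on every monochromatic nonedge.  Cauchy-Schwarz
-- over the colour classes gives ⟨z, A z⟩ ≤ (1 + (k-1) p₀) |z|², which bounds all
-- the ratios, and the bound on ε leaves room below (1-ε)(p₀ k + 1).  These p are
-- rational, so the maximum can be computed.

open import Algebra.Bundles using (CommutativeRing; RawMonoid; RawRing)
import Algebra.Definitions.RawMonoid as RawMonoidOps
open import Algebra.Structures using (IsCommutativeRing)
open import Data.Bool.Base using (Bool; true; false; if_then_else_)
open import Data.Fin.Base as Fin using (Fin; zero; suc; inject₁)
import Data.Fin.Properties as Fin
open import Data.Fin.Subset using (Subset; ∣_∣; inside; outside; _∈_; _⊆_)
open import Data.Fin.Subset.Properties using (out⊆; s⊆s)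
open import Data.Integer.Base as ℤ using (ℤ; +_; -[1+_])
import Data.Integer.Properties as ℤ
open import Data.List.Base as List using (List; []; _∷_; allFin; filter)
import Data.List.Membership.Propositional.Properties as List
open import Data.List.Properties using (filter-notAll; filter-++; length-++; length-map; length-tabulate)
import Data.List.Relation.Unary.Any as Any
open import Data.Maybe.Base using (Maybe; map)
open import Data.Nat.Base as ℕ using (ℕ; zero; suc)
import Data.Nat.Properties as ℕ
open import Data.Product.Base as Product using (_×_; _,_; ∃; ∃-syntax; proj₁; proj₂)
open import Data.Rational.Base as ℚ using (ℚ; 0ℚ; 1ℚ; ½)
import Data.Rational.Properties as ℚ
import Data.Rational.Solver as ℚ-Solver
open import Data.Rational.Unnormalised.Base as ℚᵘ using (mkℚᵘ; *≡*)
import Data.Rational.Unnormalised.Properties as ℚᵘ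
open import Data.Sum.Base as Sum using (_⊎_; inj₁; inj₂; [_,_]′)
open import Data.Vec.Base using (Vec; []; _∷_; lookup; head; last)
open import Data.Vec.Functional as Vector using (Vector; replicate)
open import Data.Vec.Properties using (lookup⇒[]=)
import Defs as ℝ
open ℝ using
  ( ℝ; seq; fromℚ; fromℕ; 0ℝ; 1ℝ; _⁻¹[_]; IsLn
  ; Graph; IsClique; HasClique; Perfect; nonEdges; #nonEdges; nonEdge
  ; tuples; walks; A[_,_]; ψᵈ; Δ; IsMaximum
  )
open ℝ.CauchyClosure using (*-pos; recip; recip-inverse; bounded)
open import Function.Base using (_∘_; id)
open import Function.Bundles using (_⇔_; mk⇔)
open import Function.Construct.Identity using (↣-id)
open import Level using (0ℓ)
open import Relation.Binary.Consequences using (dec⇒weaklyDec)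
open import Relation.Binary.Core using (Rel)
open import Relation.Binary.Definitions using (tri<; tri≈; tri>)
open import Relation.Binary.PropositionalEquality.Core as ≡
  using (_≡_; _≢_; cong; subst; subst₂)
open import Relation.Binary.Structures using (IsPreorder)
open import Relation.Nullary using (Dec; does; yes; no; ¬_; contradiction)
open import Relation.Nullary.Decidable using (¬?; _×-dec_; _⊎-dec_; dec-true; dec-false)
open import Relation.Unary using (Pred; Decidable)

-- Ordered rings

-- The matrix has the shape of a dual solution for Lovász's theta number of the complement. The two
-- directions are the two ends of the sandwich inequality, the clique number below and the chromatic
-- number above, and perfection closes the gap between them. The obstacle is constructive: the order
-- on Cauchy reals is neither decidable nor total, so there is no case split on signs, no
-- eigenvector to pick, and no maximum of a finite family for the asking. Hence the algebra is done
-- in an abstract commutative ring with a preorder. Inequalities there are non-strict, and most are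
-- proved by exhibiting a visibly nonnegative difference and leaving a polynomial identity to the
-- solver. Inverses enter as elements with their defining equation, and a contradiction takes the
-- form `1# ≤ 0#`. For the same reason the decay estimate carries the factor n + 1 where n appears
-- in the moment bound: the extra 1 does the work of a strict inequality.

record OrderedCommutativeRing : Set₁ where
  infix 4 _≤_
  field
    commutativeRing : CommutativeRing 0ℓ 0ℓ
  open CommutativeRing commutativeRing public hiding (zero)
  field
    _≤_             : Rel Carrier 0ℓ
    ≤-isPreorder    : IsPreorder _≈_ _≤_
    +-mono-≤        : ∀ {x y u v} → x ≤ y → u ≤ v → x + u ≤ y + v
    *-nonNeg        : ∀ {x y} → 0# ≤ x → 0# ≤ y → 0# ≤ x * y
    square-nonNeg   : ∀ x → 0# ≤ x * x

-- Normalisation needs coefficients with decidable equality, which the reals do not offer; integers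
-- mapped into the ring serve instead.
module IntegerSolver (R : CommutativeRing 0ℓ 0ℓ) where
  open CommutativeRing R
  open import Algebra.Properties.Ring ring
  open import Algebra.Properties.Semiring.Mult.TCOptimised semiring
    using (1+×; ×-homo-+; ×1-homo-*) renaming (_×_ to _×′_)
  open import Algebra.Solver.Ring.AlmostCommutativeRing
    using (AlmostCommutativeRing; fromCommutativeRing; _-Raw-AlmostCommutative⟶_)
  open import Relation.Binary.Reasoning.Setoid setoid

  ⟦_⟧ᶻ : ℤ → Carrier
  ⟦ + n      ⟧ᶻ = n ×′ 1#
  ⟦ -[1+ n ] ⟧ᶻ = - (suc n ×′ 1#)

  private
    cancel-1# : ∀ x y → (1# + x) - (1# + y) ≈ x - y
    cancel-1# x y = begin
      (1# + x) - (1# + y)     ≈⟨ +-congˡ (-‿+-comm 1# y) ⟨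
      (1# + x) + (- 1# - y)   ≈⟨ +-congʳ (+-comm 1# x) ⟩
      (x + 1#) + (- 1# - y)   ≈⟨ +-assoc x 1# _ ⟩
      x + (1# + (- 1# - y))   ≈⟨ +-congˡ (+-assoc 1# _ _) ⟨
      x + ((1# - 1#) - y)     ≈⟨ +-congˡ (+-congʳ (-‿inverseʳ 1#)) ⟩
      x + (0# - y)            ≈⟨ +-congˡ (+-identityˡ _) ⟩
      x - y                   ∎

    ⊖-homo : ∀ m n → ⟦ m ℤ.⊖ n ⟧ᶻ ≈ m ×′ 1# - n ×′ 1#
    ⊖-homo m       zero    = sym (trans (+-congˡ -0#≈0#) (+-identityʳ _))
    ⊖-homo zero    (suc n) = sym (+-identityˡ _)
    ⊖-homo (suc m) (suc n) = begin
      ⟦ suc m ℤ.⊖ suc n ⟧ᶻ              ≡⟨ ≡.cong ⟦_⟧ᶻ (ℤ.[1+m]⊖[1+n]≡m⊖n m n) ⟩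
      ⟦ m ℤ.⊖ n ⟧ᶻ                      ≈⟨ ⊖-homo m n ⟩
      m ×′ 1# - n ×′ 1#                 ≈⟨ cancel-1# _ _ ⟨
      (1# + m ×′ 1#) - (1# + n ×′ 1#)   ≈⟨ +-cong (1+× m 1#) (-‿cong (1+× n 1#)) ⟨
      suc m ×′ 1# - suc n ×′ 1#         ∎

    -homo : ∀ i → ⟦ ℤ.- i ⟧ᶻ ≈ - ⟦ i ⟧ᶻ
    -homo (+ zero)  = sym -0#≈0#
    -homo (+ suc n) = refl
    -homo -[1+ n ]  = sym (-‿involutive _)

    +-homo : ∀ i j → ⟦ i ℤ.+ j ⟧ᶻ ≈ ⟦ i ⟧ᶻ + ⟦ j ⟧ᶻ
    +-homo (+ m)    (+ n)    = ×-homo-+ 1# m n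
    +-homo (+ m)    -[1+ n ] = ⊖-homo m (suc n)
    +-homo -[1+ m ] (+ n)    = trans (⊖-homo n (suc m)) (+-comm _ _)
    +-homo -[1+ m ] -[1+ n ] = begin
      - (suc (suc (m ℕ.+ n)) ×′ 1#)   ≡⟨ ≡.cong (λ l → - (suc l ×′ 1#)) (ℕ.+-suc m n) ⟨
      - ((suc m ℕ.+ suc n) ×′ 1#)     ≈⟨ -‿cong (×-homo-+ 1# (suc m) (suc n)) ⟩
      - (suc m ×′ 1# + suc n ×′ 1#)   ≈⟨ -‿+-comm _ _ ⟨
      - (suc m ×′ 1#) - suc n ×′ 1#   ∎

    *-homo-+ : ∀ m j → ⟦ + m ℤ.* j ⟧ᶻ ≈ m ×′ 1# * ⟦ j ⟧ᶻ
    *-homo-+ m (+ n)    = trans (reflexive (≡.cong ⟦_⟧ᶻ (≡.sym (ℤ.pos-* m n)))) (×1-homo-* m n)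
    *-homo-+ m -[1+ n ] = begin
      ⟦ + m ℤ.* -[1+ n ] ⟧ᶻ        ≡⟨ ≡.cong ⟦_⟧ᶻ (ℤ.neg-distribʳ-* (+ m) (+ suc n)) ⟨
      ⟦ ℤ.- (+ m ℤ.* + suc n) ⟧ᶻ   ≈⟨ -homo (+ m ℤ.* + suc n) ⟩
      - ⟦ + m ℤ.* + suc n ⟧ᶻ       ≈⟨ -‿cong (*-homo-+ m (+ suc n)) ⟩
      - (m ×′ 1# * suc n ×′ 1#)    ≈⟨ -‿distribʳ-* _ _ ⟩
      m ×′ 1# * - (suc n ×′ 1#)    ∎

    *-homo : ∀ i j → ⟦ i ℤ.* j ⟧ᶻ ≈ ⟦ i ⟧ᶻ * ⟦ j ⟧ᶻ
    *-homo (+ m)    j = *-homo-+ m j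
    *-homo -[1+ m ] j = begin
      ⟦ -[1+ m ] ℤ.* j ⟧ᶻ        ≡⟨ ≡.cong ⟦_⟧ᶻ (ℤ.neg-distribˡ-* (+ suc m) j) ⟨
      ⟦ ℤ.- (+ suc m ℤ.* j) ⟧ᶻ   ≈⟨ -homo (+ suc m ℤ.* j) ⟩
      - ⟦ + suc m ℤ.* j ⟧ᶻ       ≈⟨ -‿cong (*-homo-+ (suc m) j) ⟩
      - (suc m ×′ 1# * ⟦ j ⟧ᶻ)   ≈⟨ -‿distribˡ-* _ _ ⟩
      - (suc m ×′ 1#) * ⟦ j ⟧ᶻ   ∎

    almostCommutativeRing : AlmostCommutativeRing 0ℓ 0ℓ
    almostCommutativeRing = fromCommutativeRing R

    ℤ-homomorphism : ℤ.+-*-rawRing -Raw-AlmostCommutative⟶ almostCommutativeRing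
    ℤ-homomorphism = record
      { ⟦_⟧    = ⟦_⟧ᶻ
      ; +-homo = +-homo
      ; *-homo = *-homo
      ; -‿homo = -homo
      ; 0-homo = refl
      ; 1-homo = refl
      }

    equal? : ∀ i j → Maybe (⟦ i ⟧ᶻ ≈ ⟦ j ⟧ᶻ)
    equal? i j = map (λ i≡j → reflexive (≡.cong ⟦_⟧ᶻ i≡j)) (dec⇒weaklyDec ℤ._≟_ i j)

  open import Algebra.Solver.Ring ℤ.+-*-rawRing almostCommutativeRing ℤ-homomorphism equal? public
    using (solve; _:=_; _:+_; _:*_; _:-_; :-_; con)

module OrderedRingProperties (O : OrderedCommutativeRing) where
  open OrderedCommutativeRing O
  open IntegerSolver commutativeRing
  open import Algebra.Properties.Semiring.Exp semiring public using (_^_)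
  open import Algebra.Properties.Semiring.Mult semiring using () renaming (_×_ to _×′_)

  ι : ℕ → Carrier
  ι n = n ×′ 1#
  open import Relation.Binary.Structures using (IsPreorder)
  open import Relation.Binary.Bundles using (Preorder)
  open IsPreorder ≤-isPreorder public
    using () renaming (refl to ≤-refl; reflexive to ≤-reflexive; trans to ≤-trans)

  ≤-preorder : Preorder _ _ _
  ≤-preorder = record { isPreorder = ≤-isPreorder }

  module ≤-Reasoning where
    open import Relation.Binary.Reasoning.Preorder ≤-preorder public

  open ≤-Reasoning

  -- The form in which most inequalities are proved: `d` is assembled from sums and products of
  -- nonnegative terms, and the equation goes to the solver.
  ≤-offset : ∀ {x y d} → 0# ≤ d → x + d ≈ y → x ≤ y
  ≤-offset {x} {y} {d} 0≤d x+d≈y = begin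
    x        ≈⟨ +-identityʳ x ⟨
    x + 0#   ≲⟨ +-mono-≤ ≤-refl 0≤d ⟩
    x + d    ≈⟨ x+d≈y ⟩
    y        ∎

  0≤y-x : ∀ {x y} → x ≤ y → 0# ≤ y - x
  0≤y-x {x} {y} x≤y = begin
    0#      ≈⟨ -‿inverseʳ x ⟨
    x - x   ≲⟨ +-mono-≤ x≤y ≤-refl ⟩
    y - x   ∎

  +-nonNeg : ∀ {x y} → 0# ≤ x → 0# ≤ y → 0# ≤ x + y
  +-nonNeg 0≤x 0≤y = ≤-trans (≤-reflexive (sym (+-identityʳ 0#))) (+-mono-≤ 0≤x 0≤y)

  *-monoˡ-≤ : ∀ {c x y} → 0# ≤ c → x ≤ y → c * x ≤ c * y
  *-monoˡ-≤ {c} {x} {y} 0≤c x≤y = ≤-offset (*-nonNeg 0≤c (0≤y-x x≤y))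
    (solve 3 (λ c x y → c :* x :+ c :* (y :- x) := c :* y) refl c x y)

  *-monoʳ-≤ : ∀ {c x y} → 0# ≤ c → x ≤ y → x * c ≤ y * c
  *-monoʳ-≤ {c} {x} {y} 0≤c x≤y = begin
    x * c   ≈⟨ *-comm x c ⟩
    c * x   ≲⟨ *-monoˡ-≤ 0≤c x≤y ⟩
    c * y   ≈⟨ *-comm c y ⟩
    y * c   ∎

  *-mono-≤ : ∀ {w x y z} → 0# ≤ x → 0# ≤ y → w ≤ x → y ≤ z → w * y ≤ x * z
  *-mono-≤ 0≤x 0≤y w≤x y≤z = ≤-trans (*-monoʳ-≤ 0≤y w≤x) (*-monoˡ-≤ 0≤x y≤z)

  0≤1 : 0# ≤ 1#
  0≤1 = ≤-trans (square-nonNeg 1#) (≤-reflexive (*-identityʳ 1#))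

  ι-nonNeg : ∀ n → 0# ≤ ι n
  ι-nonNeg zero    = ≤-refl
  ι-nonNeg (suc n) = +-nonNeg 0≤1 (ι-nonNeg n)

  ^-nonNeg : ∀ {x} n → 0# ≤ x → 0# ≤ x ^ n
  ^-nonNeg zero    0≤x = 0≤1
  ^-nonNeg (suc n) 0≤x = *-nonNeg 0≤x (^-nonNeg n 0≤x)

  ^-mono-≤ : ∀ {x y} n → 0# ≤ x → x ≤ y → x ^ n ≤ y ^ n
  ^-mono-≤ zero    0≤x x≤y = ≤-refl
  ^-mono-≤ (suc n) 0≤x x≤y =
    *-mono-≤ (≤-trans 0≤x x≤y) (^-nonNeg n 0≤x) x≤y (^-mono-≤ n 0≤x x≤y)

  1≤x⇒1≤x^n : ∀ {x} n → 1# ≤ x → 1# ≤ x ^ n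
  1≤x⇒1≤x^n zero    1≤x = ≤-refl
  1≤x⇒1≤x^n (suc n) 1≤x = ≤-trans (≤-reflexive (sym (*-identityʳ 1#)))
    (*-mono-≤ (≤-trans 0≤1 1≤x) 0≤1 1≤x (1≤x⇒1≤x^n n 1≤x))

  x≤1⇒x^n≤1 : ∀ {x} n → 0# ≤ x → x ≤ 1# → x ^ n ≤ 1#
  x≤1⇒x^n≤1 zero    0≤x x≤1 = ≤-refl
  x≤1⇒x^n≤1 (suc n) 0≤x x≤1 =
    ≤-trans (*-mono-≤ 0≤1 (^-nonNeg n 0≤x) x≤1 (x≤1⇒x^n≤1 n 0≤x x≤1))
            (≤-reflexive (*-identityʳ 1#))

  -- The ring has no division, so the inverse is passed as an element together with its equation.
  *-cancelˡ-≤ : ∀ {c c⁻¹ x y} → 0# ≤ c⁻¹ → c⁻¹ * c ≈ 1# → c * x ≤ c * y → x ≤ y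
  *-cancelˡ-≤ {c} {c⁻¹} {x} {y} 0≤c⁻¹ c⁻¹c≈1 cx≤cy = begin
    x               ≈⟨ insert x ⟩
    c⁻¹ * (c * x)   ≲⟨ *-monoˡ-≤ 0≤c⁻¹ cx≤cy ⟩
    c⁻¹ * (c * y)   ≈⟨ insert y ⟨
    y               ∎
    where
    insert : ∀ z → z ≈ c⁻¹ * (c * z)
    insert z = trans (sym (*-identityˡ z)) (trans (*-congʳ (sym c⁻¹c≈1)) (*-assoc c⁻¹ c z))

-- Quadratic forms and moments

module LinearAlgebra (O : OrderedCommutativeRing) where
  open OrderedCommutativeRing O
  open IntegerSolver commutativeRing
  open OrderedRingProperties O
  open import Algebra.Properties.Semiring.Sum semiring public
    using (sum; sum-cong-≋; ∑-distrib-+; ∑-comm; *-distribˡ-sum; *-distribʳ-sum;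
           sum-replicate; sum-replicate-zero)
  open import Algebra.Properties.Semiring.Mult semiring using (×-assoc-*; ×-congʳ) renaming (_×_ to _×′_)
  open ≤-Reasoning

  Matrix : ℕ → Set
  Matrix n = Fin n → Fin n → Carrier

  infix 4 _≋_
  _≋_ : ∀ {n} → Vector Carrier n → Vector Carrier n → Set
  x ≋ y = ∀ i → x i ≈ y i

  sum-mono-≤ : ∀ {n} {x y : Vector Carrier n} → (∀ i → x i ≤ y i) → sum x ≤ sum y
  sum-mono-≤ {zero}  x≤y = ≤-refl
  sum-mono-≤ {suc n} x≤y = +-mono-≤ (x≤y zero) (sum-mono-≤ (x≤y ∘ suc))

  sum-zero : ∀ {n} {x : Vector Carrier n} → (∀ i → x i ≈ 0#) → sum x ≈ 0#
  sum-zero {n} x≈0 = trans (sum-cong-≋ x≈0) (sum-replicate-zero n)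

  sum-nonNeg : ∀ {n} {x : Vector Carrier n} → (∀ i → 0# ≤ x i) → 0# ≤ sum x
  sum-nonNeg {n} 0≤x = ≤-trans (≤-reflexive (sym (sum-replicate-zero n))) (sum-mono-≤ 0≤x)

  term≤sum : ∀ {n} {x : Vector Carrier n} → (∀ i → 0# ≤ x i) → ∀ i → x i ≤ sum x
  term≤sum 0≤x zero    = ≤-offset (sum-nonNeg (0≤x ∘ suc)) refl
  term≤sum 0≤x (suc i) = ≤-trans (term≤sum (0≤x ∘ suc) i) (≤-offset (0≤x zero) (+-comm _ _))

  two-terms≤sum : ∀ {n} {x : Vector Carrier n} → (∀ i → 0# ≤ x i) →
                  ∀ i j → i ≡.≢ j → x i + x j ≤ sum x
  two-terms≤sum 0≤x zero    zero    i≢j with () ← i≢j ≡.refl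
  two-terms≤sum 0≤x zero    (suc j) i≢j = +-mono-≤ ≤-refl (term≤sum (0≤x ∘ suc) j)
  two-terms≤sum 0≤x (suc i) zero    i≢j =
    ≤-trans (≤-reflexive (+-comm _ _)) (+-mono-≤ ≤-refl (term≤sum (0≤x ∘ suc) i))
  two-terms≤sum 0≤x (suc i) (suc j) i≢j =
    ≤-trans (two-terms≤sum (0≤x ∘ suc) i j (i≢j ∘ ≡.cong suc)) (≤-offset (0≤x zero) (+-comm _ _))

  -- Summed over all pairs, the hypothesis would give twice the conclusion;
  -- the induction avoids dividing by two.
  sum-pairs≤ : ∀ {n} (M : Matrix n) → (∀ i j → M i j + M j i ≤ M i i + M j j) →
               sum (λ i → sum (M i)) ≤ ι n * sum (λ i → M i i)
  sum-pairs≤ {zero}  M h = ≤-reflexive (sym (zeroˡ 0#))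
  sum-pairs≤ {suc n} M h = begin
    (m + sum r) + sum (λ i → M (suc i) zero + sum (M (suc i) ∘ suc))
      ≈⟨ +-congˡ (∑-distrib-+ c (λ i → sum (M (suc i) ∘ suc))) ⟩
    (m + sum r) + (sum c + S)
      ≈⟨ solve 4 (λ m r c S → (m :+ r) :+ (c :+ S) := (m :+ (r :+ c)) :+ S) refl m (sum r) (sum c) S ⟩
    (m + (sum r + sum c)) + S
      ≈⟨ +-congʳ (+-congˡ (∑-distrib-+ r c)) ⟨
    (m + sum (λ i → r i + c i)) + S
      -- The first row and the first column are paired entry by entry through `h`; the remaining
      -- square falls to the induction hypothesis.
      ≲⟨ +-mono-≤ (+-mono-≤ ≤-refl (sum-mono-≤ (λ i → h zero (suc i)))) (sum-pairs≤ (λ i j → M (suc i) (suc j)) (λ i j → h (suc i) (suc j))) ⟩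
    (m + sum (λ i → m + d i)) + ι n * sum d
      ≈⟨ +-congʳ (+-congˡ (trans (∑-distrib-+ (replicate n m) d) (+-congʳ (trans (sum-replicate n) n×m≈ιn*m)))) ⟩
    (m + (ι n * m + sum d)) + ι n * sum d
      ≈⟨ solve 3 (λ m N d → (m :+ (N :* m :+ d)) :+ N :* d := (con (+ 1) :+ N) :* (m :+ d)) refl m (ι n) (sum d) ⟩
    (1# + ι n) * (m + sum d) ∎
    where
    m = M zero zero
    r = λ j → M zero (suc j)
    c = λ i → M (suc i) zero
    d = λ i → M (suc i) (suc i)
    S = sum (λ i → sum (λ j → M (suc i) (suc j)))
    n×m≈ιn*m : n ×′ m ≈ ι n * m
    n×m≈ιn*m = sym (trans (×-assoc-* n 1# m) (×-congʳ n (*-identityˡ m)))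

  infix 7.2 _∙_
  infixr 7.5 _·_

  _∙_ : ∀ {n} → Vector Carrier n → Vector Carrier n → Carrier
  x ∙ y = sum (λ i → x i * y i)

  _·_ : ∀ {n} → Matrix n → Vector Carrier n → Vector Carrier n
  (A · x) i = A i ∙ x

  power : ∀ {n} → Matrix n → ℕ → Vector Carrier n → Vector Carrier n
  power A zero    x = x
  power A (suc t) x = A · power A t x

  lin : ∀ {n} → Carrier → Vector Carrier n → Carrier → Vector Carrier n → Vector Carrier n
  lin a x b y i = a * x i + b * y i

  𝟙 : ∀ {n} → Matrix n
  𝟙 a b = if does (a Fin.≟ b) then 1# else 0#

  unit : ∀ {n} → Fin n → Vector Carrier n
  unit j i = 𝟙 i j

  ∙-cong : ∀ {n} {x y u v : Vector Carrier n} → x ≋ y → u ≋ v → x ∙ u ≈ y ∙ v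
  ∙-cong x≋y u≋v = sum-cong-≋ (λ i → *-cong (x≋y i) (u≋v i))

  ∙-comm : ∀ {n} (x y : Vector Carrier n) → x ∙ y ≈ y ∙ x
  ∙-comm x y = sum-cong-≋ (λ i → *-comm (x i) (y i))

  ∙-square-nonNeg : ∀ {n} (x : Vector Carrier n) → 0# ≤ x ∙ x
  ∙-square-nonNeg x = sum-nonNeg (λ i → square-nonNeg (x i))

  lin-∙ : ∀ {n} a (x : Vector Carrier n) b y w → lin a x b y ∙ w ≈ a * (x ∙ w) + b * (y ∙ w)
  lin-∙ a x b y w = begin-equality
    sum (λ i → (a * x i + b * y i) * w i)
      ≈⟨ sum-cong-≋ (λ i → solve 5 (λ a x b y w → (a :* x :+ b :* y) :* w := a :* (x :* w) :+ b :* (y :* w)) refl a (x i) b (y i) (w i)) ⟩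
    sum (λ i → a * (x i * w i) + b * (y i * w i))
      ≈⟨ ∑-distrib-+ (λ i → a * (x i * w i)) (λ i → b * (y i * w i)) ⟩
    sum (λ i → a * (x i * w i)) + sum (λ i → b * (y i * w i))
      ≈⟨ +-cong (*-distribˡ-sum a (λ i → x i * w i)) (*-distribˡ-sum b (λ i → y i * w i)) ⟨
    a * (x ∙ w) + b * (y ∙ w) ∎

  ∙-lin : ∀ {n} a (x : Vector Carrier n) b y w → w ∙ lin a x b y ≈ a * (w ∙ x) + b * (w ∙ y)
  ∙-lin a x b y w = trans (∙-comm w _) (trans (lin-∙ a x b y w) (+-cong (*-congˡ (∙-comm x w)) (*-congˡ (∙-comm y w))))

  ·-cong : ∀ {n} (A : Matrix n) {x y} → x ≋ y → A · x ≋ A · y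
  ·-cong A x≋y i = ∙-cong (λ _ → refl) x≋y

  power-cong : ∀ {n} (A : Matrix n) t {x y} → x ≋ y → power A t x ≋ power A t y
  power-cong A zero    x≋y = x≋y
  power-cong A (suc t) x≋y = ·-cong A (power-cong A t x≋y)

  power-lin : ∀ {n} (A : Matrix n) t a x b y → power A t (lin a x b y) ≋ lin a (power A t x) b (power A t y)
  power-lin A zero    a x b y i = refl
  power-lin A (suc t) a x b y i = trans (·-cong A (power-lin A t a x b y) i) (∙-lin a _ b _ (A i))

  power-· : ∀ {n} (A : Matrix n) t x → power A t (A · x) ≋ A · power A t x
  power-· A zero    x i = refl
  power-· A (suc t) x   = ·-cong A (power-· A t x)

  unit-∙ : ∀ {n} j (w : Vector Carrier n) → unit j ∙ w ≈ w j
  unit-∙ {suc n} zero w = trans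
    (+-cong (*-identityˡ _) (sum-zero (λ i → zeroˡ (w (suc i))))) (+-identityʳ _)
  unit-∙ {suc n} (suc j) w = trans (+-cong (zeroˡ _) (unit-∙ j (w ∘ suc))) (+-identityˡ _)

  𝟙-sym : ∀ {n} (i j : Fin n) → 𝟙 i j ≡.≡ 𝟙 j i
  𝟙-sym zero    zero    = ≡.refl
  𝟙-sym zero    (suc j) = ≡.refl
  𝟙-sym (suc i) zero    = ≡.refl
  𝟙-sym (suc i) (suc j) = 𝟙-sym i j

  𝟙-diagonal : ∀ {n} (i : Fin n) → 𝟙 i i ≡.≡ 1#
  𝟙-diagonal zero    = ≡.refl
  𝟙-diagonal (suc i) = 𝟙-diagonal i

  𝟙-∙ : ∀ {n} i (w : Vector Carrier n) → 𝟙 i ∙ w ≈ w i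
  𝟙-∙ i w = trans (sum-cong-≋ (λ j → *-congʳ (reflexive (𝟙-sym i j)))) (unit-∙ i w)

  ·-unit : ∀ {n} (A : Matrix n) i j → (A · unit j) i ≈ A i j
  ·-unit A i j = trans (∙-comm (A i) (unit j)) (unit-∙ j (A i))

  -- Column `j` is the image of the `j`-th unit vector, which avoids matrix products: iterating
  -- `_·_` is enough.
  matrixPower : ∀ {n} → Matrix n → ℕ → Matrix n
  matrixPower A t i j = power A t (unit j) i

  -- Exchange of the two sums. It serves both as associativity, with `a` a row, and for linear
  -- combinations of matrices, with `a` the coefficients.
  ∑-∑-distribˡ : ∀ {m n} (a : Vector Carrier m) (M : Fin m → Fin n → Carrier) (x : Vector Carrier n) →
                 sum (λ j → a ∙ (λ k → M k j) * x j) ≈ a ∙ (λ k → M k ∙ x)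
  ∑-∑-distribˡ a M x = trans
    (sum-cong-≋ (λ j → trans (*-distribʳ-sum (x j) (λ k → a k * M k j)) (sum-cong-≋ (λ k → *-assoc (a k) (M k j) (x j)))))
    (trans (∑-comm (λ j k → a k * (M k j * x j)))
           (sum-cong-≋ (λ k → sym (*-distribˡ-sum (a k) (λ j → M k j * x j)))))

  matrixPower-· : ∀ {n} (A : Matrix n) t x → matrixPower A t · x ≋ power A t x
  matrixPower-· A zero    x i = 𝟙-∙ i x
  matrixPower-· A (suc t) x i = trans (∑-∑-distribˡ (A i) (matrixPower A t) x) (·-cong A (matrixPower-· A t x) i)

  PSD : ∀ {n} → Matrix n → Set
  PSD A = ∀ z → 0# ≤ z ∙ A · z

  Sym : ∀ {n} → Matrix n → Set
  Sym A = ∀ i j → A i j ≈ A j i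

  -- Testing semidefiniteness on `x i` times the `i`-th unit vector minus `x j` times the `j`-th
  -- gives exactly the pairwise hypothesis of `sum-pairs≤`.
  PSD⇒≤diagonal : ∀ {n} (M : Matrix n) → PSD M → ∀ x →
    x ∙ M · x ≤ ι n * sum (λ i → x i * (M i i * x i))
  PSD⇒≤diagonal {n} M psd x = begin
    x ∙ M · x                                     ≈⟨ sum-cong-≋ (λ i → *-distribˡ-sum (x i) (λ j → M i j * x j)) ⟩
    sum (λ i → sum (λ j → x i * (M i j * x j)))   ≲⟨ sum-pairs≤ (λ i j → x i * (M i j * x j)) pair ⟩
    ι n * sum (λ i → x i * (M i i * x i))         ∎
    where
    pair : ∀ i j → x i * (M i j * x j) + x j * (M j i * x i) ≤ x i * (M i i * x i) + x j * (M j j * x j)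
    pair i j = ≤-offset (psd z) (trans (+-congˡ expand)
      (solve 6 (λ a b p q r s → a :* (q :* b) :+ b :* (r :* a) :+ (a :* (a :* p :+ :- b :* q) :+ :- b :* (a :* r :+ :- b :* s))
        := a :* (p :* a) :+ b :* (s :* b)) refl (x i) (x j) (M i i) (M i j) (M j i) (M j j)))
      where
      z = lin (x i) (unit i) (- x j) (unit j)
      row : ∀ k → (M · z) k ≈ x i * M k i + - x j * M k j
      row k = trans (∙-lin (x i) (unit i) (- x j) (unit j) (M k)) (+-cong (*-congˡ (·-unit M k i)) (*-congˡ (·-unit M k j)))
      expand : z ∙ M · z ≈ x i * (x i * M i i + - x j * M i j) + - x j * (x i * M j i + - x j * M j j)
      expand = trans (lin-∙ (x i) (unit i) (- x j) (unit j) (M · z))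
        (+-cong (*-congˡ (trans (unit-∙ i (M · z)) (row i))) (*-congˡ (trans (unit-∙ j (M · z)) (row j))))

  module SymmetricPowers {n} (A : Matrix n) (A-sym : Sym A) where

    ∙-· : ∀ x y → x ∙ A · y ≈ A · x ∙ y
    ∙-· x y = sym (trans (sum-cong-≋ (λ j → *-congʳ (trans (∙-cong (A-sym j) (λ _ → refl)) (∙-comm _ x))))
      (∑-∑-distribˡ x A y))

    -- Symmetry moves `s` of the factors to the other side. With equal halves, even moments become
    -- squared norms and odd ones values of the form of `A`.
    power-∙ : ∀ s t x y → x ∙ power A (s ℕ.+ t) y ≈ power A s x ∙ power A t y
    power-∙ zero    t x y = refl
    power-∙ (suc s) t x y = trans (∙-· x _) (trans (power-∙ s t (A · x) y) (∙-cong (power-· A s x) (λ _ → refl)))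

    moment : ℕ → Vector Carrier n → Carrier
    moment t x = x ∙ power A t x

    -- For y the image of the `i`-th unit vector under `Aᵗ`, the two entries are ⟨y, A y⟩ and ⟨y,
    -- y⟩, so their ratio is a Rayleigh quotient of `A`.
    matrixPower-ratio : ∀ {c} → (∀ z → z ∙ A · z ≤ c * (z ∙ z)) → ∀ t i →
      matrixPower A (suc (t ℕ.+ t)) i i ≤ c * matrixPower A (t ℕ.+ t) i i
    matrixPower-ratio {c} h t i = begin
      matrixPower A (suc (t ℕ.+ t)) i i               ≈⟨ unit-∙ i _ ⟨
      moment (suc (t ℕ.+ t)) (unit i)                 ≡⟨ ≡.cong (λ s → moment s (unit i)) (ℕ.+-suc t t) ⟨
      moment (t ℕ.+ suc t) (unit i)                   ≈⟨ power-∙ t (suc t) (unit i) (unit i) ⟩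
      power A t (unit i) ∙ A · power A t (unit i)     ≲⟨ h (power A t (unit i)) ⟩
      c * (power A t (unit i) ∙ power A t (unit i))   ≈⟨ *-congˡ (power-∙ t t (unit i) (unit i)) ⟨
      c * moment (t ℕ.+ t) (unit i)                   ≈⟨ *-congˡ (unit-∙ i _) ⟩
      c * matrixPower A (t ℕ.+ t) i i                 ∎

    module _ (psd : PSD A) where

      -- Induction in steps of two: taking one factor off each end leaves a moment of `A · x`. The
      -- base cases are the squared norm and the form of `A` itself.
      moment-nonNeg : ∀ t x → 0# ≤ moment t x
      moment-nonNeg zero          x = ∙-square-nonNeg x
      moment-nonNeg (suc zero)    x = psd x
      moment-nonNeg (suc (suc t)) x = begin
        0#                          ≲⟨ moment-nonNeg t (A · x) ⟩
        A · x ∙ power A t (A · x)   ≈⟨ ∙-cong (λ _ → refl) (power-· A t x) ⟩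
        A · x ∙ A · power A t x     ≈⟨ ∙-· x _ ⟨
        x ∙ A · A · power A t x     ∎

      -- Log-convexity of the moments, written as a family of inequalities indexed by `c`; choosing
      -- the optimal `c` would require a division.
      moment-convex : ∀ c t x →
        c * moment (suc t) x + c * moment (suc t) x ≤ moment (suc (suc t)) x + c * c * moment t x
      moment-convex c t x = ≤-offset (moment-nonNeg t z) (trans (+-congˡ expand)
        (solve 4 (λ c m₀ m₁ m₂ → (c :* m₁ :+ c :* m₁) :+
                   (con (+ 1) :* (con (+ 1) :* m₂ :+ :- c :* m₁) :+ :- c :* (con (+ 1) :* m₁ :+ :- c :* m₀))
                   := m₂ :+ c :* c :* m₀)
          refl c (moment t x) (moment (suc t) x) (moment (suc (suc t)) x)))
        where
        z = lin 1# (A · x) (- c) x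
        Aᵗ = power A t
        expand : moment t z ≈
          1# * (1# * moment (suc (suc t)) x + - c * moment (suc t) x) +
          - c * (1# * moment (suc t) x + - c * moment t x)
        expand = trans (∙-cong (λ _ → refl) (power-lin A t 1# (A · x) (- c) x))
          (trans (lin-∙ 1# (A · x) (- c) x _)
            (+-cong
              (*-congˡ (trans (∙-lin 1# (Aᵗ (A · x)) (- c) (Aᵗ x) (A · x))
                (+-cong (*-congˡ (trans (∙-cong (λ _ → refl) (power-· A t x)) (sym (∙-· x _))))
                        (*-congˡ (sym (∙-· x _))))))
              (*-congˡ (trans (∙-lin 1# (Aᵗ (A · x)) (- c) (Aᵗ x) x)
                (+-congʳ (*-congˡ (∙-cong (λ _ → refl) (power-· A t x))))))))

      module _ (x : Vector Carrier n) where
        private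
          m : ℕ → Carrier
          m t = moment t x

        -- Convexity reads m₂ - c m₁ ≥ c (m₁ - c m₀), and the right side is nonnegative by
        -- hypothesis.
        moment-ratio-mono : ∀ {c} → 0# ≤ c → ∀ t → c * m t ≤ m (suc t) → c * m (suc t) ≤ m (suc (suc t))
        moment-ratio-mono {c} 0≤c t h = ≤-offset
          (+-nonNeg (0≤y-x (moment-convex c t x)) (*-nonNeg 0≤c (0≤y-x h)))
          (solve 4 (λ c m₀ m₁ m₂ → c :* m₁ :+ ((m₂ :+ c :* c :* m₀ :- (c :* m₁ :+ c :* m₁)) :+ c :* (m₁ :- c :* m₀)) := m₂)
            refl c (m t) (m (suc t)) (m (suc (suc t))))

        moment-growth : ∀ {c} → 0# ≤ c → c * m 0 ≤ m 1 → ∀ t → c * m t ≤ m (suc t)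
        moment-growth 0≤c h zero    = h
        moment-growth 0≤c h (suc t) = moment-ratio-mono 0≤c t (moment-growth 0≤c h t)

        moment-lower : ∀ {c} → 0# ≤ c → c * m 0 ≤ m 1 → ∀ t → c ^ t * m 0 ≤ m t
        moment-lower 0≤c h zero    = ≤-reflexive (*-identityˡ _)
        moment-lower {c} 0≤c h (suc t) = begin
          c * c ^ t * m 0     ≈⟨ *-assoc c (c ^ t) (m 0) ⟩
          c * (c ^ t * m 0)   ≲⟨ *-monoˡ-≤ 0≤c (moment-lower 0≤c h t) ⟩
          c * m t             ≲⟨ moment-growth 0≤c h t ⟩
          m (suc t)           ∎

        -- The ratios increase with `t`, so a bound on the last one bounds all earlier ones, and
        -- their product telescopes down to the zeroth moment.
        moment-upper : ∀ {c c⁻¹} → 0# ≤ c → 0# ≤ c⁻¹ → c⁻¹ * c ≈ 1# →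
          ∀ t → m (suc t) ≤ c * m t → m (suc t) ≤ c ^ suc t * m 0
        moment-upper {c} 0≤c 0≤c⁻¹ c⁻¹c≈1 zero    h = ≤-trans h (≤-reflexive (*-congʳ (sym (*-identityʳ c))))
        moment-upper {c} 0≤c 0≤c⁻¹ c⁻¹c≈1 (suc t) h = begin
          m (suc (suc t))         ≲⟨ h ⟩
          c * m (suc t)           ≲⟨ *-monoˡ-≤ 0≤c (moment-upper 0≤c 0≤c⁻¹ c⁻¹c≈1 t (*-cancelˡ-≤ 0≤c⁻¹ c⁻¹c≈1 (≤-offset d e))) ⟩
          c * (c ^ suc t * m 0)   ≈⟨ *-assoc c _ _ ⟨
          c ^ suc (suc t) * m 0   ∎
          where
          -- Adding m₂ ≤ c m₁ to the convexity inequality leaves c m₁ ≤ c² m₀, from which one factor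
          -- c is cancelled.
          d = +-nonNeg (0≤y-x (moment-convex c t x)) (0≤y-x h)
          e = solve 4 (λ c m₀ m₁ m₂ → c :* m₁ :+ ((m₂ :+ c :* c :* m₀ :- (c :* m₁ :+ c :* m₁)) :+ (c :* m₁ :- m₂)) := c :* (c :* m₀))
            refl c (m t) (m (suc t)) (m (suc (suc t)))

      matrixPower-PSD : ∀ t → PSD (matrixPower A t)
      matrixPower-PSD t z = ≤-trans (moment-nonNeg t z) (≤-reflexive (sym (∙-cong (λ _ → refl) (matrixPower-· A t z))))

      -- The bridge from single vertices, where the ratio hypothesis gives information, to the
      -- indicator vector of a clique.
      moment≤diagonal : ∀ t {b} → (∀ i → matrixPower A t i i ≤ b) → ∀ x → moment t x ≤ ι n * (b * (x ∙ x))
      moment≤diagonal t {b} h x = begin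
        x ∙ power A t x                       ≈⟨ ∙-cong (λ _ → refl) (matrixPower-· A t x) ⟨
        x ∙ matrixPower A t · x               ≲⟨ PSD⇒≤diagonal (matrixPower A t) (matrixPower-PSD t) x ⟩
        ι n * sum (λ i → x i * (P i * x i))   ≲⟨ *-monoˡ-≤ (ι-nonNeg n) (≤-trans (sum-mono-≤ entry) (≤-reflexive (sym (*-distribˡ-sum b (λ i → x i * x i))))) ⟩
        ι n * (b * (x ∙ x))                   ∎
        where
        P = λ i → matrixPower A t i i
        entry : ∀ i → x i * (P i * x i) ≤ b * (x i * x i)
        entry i = ≤-trans (≤-reflexive (solve 2 (λ x p → x :* (p :* x) := p :* (x :* x)) refl (x i) (P i)))
          (*-monoʳ-≤ (square-nonNeg (x i)) (h i))

-- Walks and weighted graphs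

module Sums (O : OrderedCommutativeRing) where
  open OrderedCommutativeRing O
  open OrderedRingProperties O
  open LinearAlgebra O
  open import Relation.Binary.Reasoning.Setoid setoid

  listSum : ∀ {X : Set} → (X → Carrier) → List X → Carrier
  listSum f xs = List.foldr _+_ 0# (List.map f xs)

  when : Bool → Carrier → Carrier
  when b x = if b then x else 0#

  *-when : ∀ b x y → x * when b y ≈ when b (x * y)
  *-when false x y = zeroʳ x
  *-when true  x y = refl

  module _ {X : Set} where

    listSum-cong : ∀ {f g : X → Carrier} → (∀ x → f x ≈ g x) → ∀ xs → listSum f xs ≈ listSum g xs
    listSum-cong f≈g []       = refl
    listSum-cong f≈g (x ∷ xs) = +-cong (f≈g x) (listSum-cong f≈g xs)

    listSum-++ : ∀ (f : X → Carrier) xs ys → listSum f (xs List.++ ys) ≈ listSum f xs + listSum f ys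
    listSum-++ f []       ys = sym (+-identityˡ _)
    listSum-++ f (x ∷ xs) ys = trans (+-congˡ (listSum-++ f xs ys)) (sym (+-assoc _ _ _))

    listSum-filter : ∀ {P : Pred X 0ℓ} (P? : Decidable P) (f : X → Carrier) xs →
                     listSum f (filter P? xs) ≈ listSum (λ x → when (does (P? x)) (f x)) xs
    listSum-filter P? f []       = refl
    listSum-filter P? f (x ∷ xs) with does (P? x)
    ... | true  = +-congˡ (listSum-filter P? f xs)
    ... | false = trans (listSum-filter P? f xs) (sym (+-identityˡ _))

    listSum-lookup : ∀ (f : X → Carrier) xs → sum (λ e → f (List.lookup xs e)) ≈ listSum f xs
    listSum-lookup f []       = refl
    listSum-lookup f (x ∷ xs) = +-congˡ (listSum-lookup f xs)

    *-distribˡ-listSum : ∀ c (f : X → Carrier) xs → c * listSum f xs ≈ listSum (λ x → c * f x) xs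
    *-distribˡ-listSum c f []       = zeroʳ c
    *-distribˡ-listSum c f (x ∷ xs) = trans (distribˡ c _ _) (+-congˡ (*-distribˡ-listSum c f xs))

    listSum-sum-comm : ∀ {n} (f : Fin n → X → Carrier) xs →
      sum (λ i → listSum (f i) xs) ≈ listSum (λ x → sum (λ i → f i x)) xs
    listSum-sum-comm {n} f []       = sum-replicate-zero n
    listSum-sum-comm     f (x ∷ xs) = trans (∑-distrib-+ (λ i → f i x) (λ i → listSum (f i) xs)) (+-congˡ (listSum-sum-comm f xs))

  listSum-map : ∀ {X Y : Set} (f : Y → Carrier) (h : X → Y) xs →
                listSum f (List.map h xs) ≈ listSum (f ∘ h) xs
  listSum-map f h []       = refl
  listSum-map f h (x ∷ xs) = +-congˡ (listSum-map f h xs)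

  listSum-cartesianProductWith : ∀ {X Y Z : Set} (f : Z → Carrier) (c : X → Y → Z) xs ys →
    listSum f (List.cartesianProductWith c xs ys) ≈ listSum (λ x → listSum (λ y → f (c x y)) ys) xs
  listSum-cartesianProductWith f c []       ys = refl
  listSum-cartesianProductWith f c (x ∷ xs) ys =
    trans (listSum-++ f (List.map (c x) ys) _)
          (+-cong (listSum-map f (c x) ys) (listSum-cartesianProductWith f c xs ys))

  listSum-tabulate : ∀ {X : Set} (f : X → Carrier) {n} (g : Fin n → X) →
                     listSum f (List.tabulate g) ≈ sum (f ∘ g)
  listSum-tabulate f {zero}  g = refl
  listSum-tabulate f {suc n} g = +-congˡ (listSum-tabulate f (g ∘ suc))

  sum-𝟙 : ∀ {n} i (f : Fin n → Carrier) → sum (λ j → when (does (j Fin.≟ i)) (f j)) ≈ f i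
  sum-𝟙 i f = trans (sum-cong-≋ (λ j → step (does (j Fin.≟ i)) (f j))) (unit-∙ i f)
    where
    step : ∀ b x → when b x ≈ when b 1# * x
    step false x = sym (zeroˡ x)
    step true  x = sym (*-identityˡ x)

module Walks (O : OrderedCommutativeRing) where
  open OrderedCommutativeRing O
  open LinearAlgebra O
  open Sums O
  open import Algebra.Definitions.RawMonoid *-rawMonoid using () renaming (sum to product)
  open import Relation.Binary.Reasoning.Setoid setoid

  weight : ∀ {n t} → Matrix n → Vec (Fin n) (suc t) → Carrier
  weight A v = product (λ m → A (lookup v (inject₁ m)) (lookup v (suc m)))

  ψ : ∀ {n} → ℕ → Matrix n → Fin n → Fin n → Carrier
  ψ t A i j = listSum (weight A) (walks t i j)

  private
    when-∧ : ∀ {P Q : Set} (P? : Dec P) (Q? : Dec Q) x →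
             when (does (P? ×-dec Q?)) x ≈ when (does P?) (when (does Q?) x)
    when-∧ (yes _) Q? x = refl
    when-∧ (no _)  Q? x = refl

    tuples-suc : ∀ {n} m (f : Vec (Fin n) (suc m) → Carrier) →
                 listSum f (tuples n (suc m)) ≈ sum (λ v → listSum (λ u → f (v ∷ u)) (tuples n m))
    tuples-suc {n} m f = trans (listSum-cartesianProductWith f _∷_ (allFin n) (tuples n m))
                               (listSum-tabulate (λ v → listSum (λ u → f (v ∷ u)) (tuples n m)) id)

    -- Summing over the head collapses the condition on it. What remains is a sum over free tuples,
    -- which suits an induction on `t`.
    ψ-unfold : ∀ {n} t A (i j : Fin n) →
               ψ t A i j ≈ listSum (λ u → when (does (last (i ∷ u) Fin.≟ j)) (weight A (i ∷ u))) (tuples n t)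
    ψ-unfold {n} t A i j = begin
      ψ t A i j
        ≈⟨ listSum-filter (λ v → (head v Fin.≟ i) ×-dec (last v Fin.≟ j)) (weight A) (tuples n (suc t)) ⟩
      listSum (λ v → when (does ((head v Fin.≟ i) ×-dec (last v Fin.≟ j))) (weight A v)) (tuples n (suc t))
        ≈⟨ listSum-cong (λ v → when-∧ (head v Fin.≟ i) (last v Fin.≟ j) (weight A v)) (tuples n (suc t)) ⟩
      listSum (λ v → when (does (head v Fin.≟ i)) (when (does (last v Fin.≟ j)) (weight A v))) (tuples n (suc t))
        ≈⟨ tuples-suc t (λ v → when (does (head v Fin.≟ i)) (when (does (last v Fin.≟ j)) (weight A v))) ⟩
      sum (λ v → listSum (λ u → when (does (v Fin.≟ i)) (F v u)) (tuples n t))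
        ≈⟨ listSum-sum-comm (λ v u → when (does (v Fin.≟ i)) (F v u)) (tuples n t) ⟩
      listSum (λ u → sum (λ v → when (does (v Fin.≟ i)) (F v u))) (tuples n t)
        ≈⟨ listSum-cong (λ u → sum-𝟙 i (λ v → F v u)) (tuples n t) ⟩
      listSum (F i) (tuples n t) ∎
      where
      F : Fin n → Vec (Fin n) t → Carrier
      F v u = when (does (last (v ∷ u) Fin.≟ j)) (weight A (v ∷ u))

  -- Splitting off the first edge of a walk reproduces the recursion of `power`. From here on, walk
  -- weights are moments at unit vectors.
  ψ≈matrixPower : ∀ {n} t (A : Matrix n) i j → ψ t A i j ≈ matrixPower A t i j
  ψ≈matrixPower zero    A i j = trans (ψ-unfold zero A i j) (+-identityʳ _)
  ψ≈matrixPower {n} (suc t) A i j = begin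
    ψ (suc t) A i j
      ≈⟨ ψ-unfold (suc t) A i j ⟩
    listSum (λ u → when (does (last (i ∷ u) Fin.≟ j)) (weight A (i ∷ u))) (tuples n (suc t))
      ≈⟨ tuples-suc t (λ u → when (does (last (i ∷ u) Fin.≟ j)) (weight A (i ∷ u))) ⟩
    sum (λ v → listSum (λ u → when (does (last (i ∷ v ∷ u) Fin.≟ j)) (weight A (i ∷ v ∷ u))) (tuples n t))
      ≈⟨ sum-cong-≋ (λ v → listSum-cong (λ u → *-when (does (last (v ∷ u) Fin.≟ j)) (A i v) (weight A (v ∷ u))) (tuples n t)) ⟨
    sum (λ v → listSum (λ u → A i v * when (does (last (v ∷ u) Fin.≟ j)) (weight A (v ∷ u))) (tuples n t))
      ≈⟨ sum-cong-≋ (λ v → *-distribˡ-listSum (A i v) (λ u → when (does (last (v ∷ u) Fin.≟ j)) (weight A (v ∷ u))) (tuples n t)) ⟨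
    sum (λ v → A i v * listSum (λ u → when (does (last (v ∷ u) Fin.≟ j)) (weight A (v ∷ u))) (tuples n t))
      ≈⟨ sum-cong-≋ (λ v → *-congˡ (ψ-unfold t A v j)) ⟨
    sum (λ v → A i v * ψ t A v j)
      ≈⟨ sum-cong-≋ (λ v → *-congˡ (ψ≈matrixPower t A v j)) ⟩
    matrixPower A (suc t) i j ∎

module WeightedGraph (O : OrderedCommutativeRing) {n} (G : Graph n)
  (p : Vector (OrderedCommutativeRing.Carrier O) (suc (#nonEdges G))) where
  open OrderedCommutativeRing O
  open OrderedRingProperties O
  open IntegerSolver commutativeRing
  open LinearAlgebra O
  open Sums O
  open Graph G
  open ≤-Reasoning

  p₀ : Carrier
  p₀ = p zero

  pₑ : Vector Carrier (#nonEdges G)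
  pₑ e = p (suc e)

  Y : Fin n × Fin n → Matrix n
  Y (i , j) a b =
    if does (((a Fin.≟ i) ×-dec (b Fin.≟ j)) ⊎-dec ((a Fin.≟ j) ×-dec (b Fin.≟ i)))
    then 1# else 0#

  A : Matrix n
  A a b = sum (λ e → (- pₑ e) * Y (nonEdge G e) a b) + p₀ * 1# + 𝟙 a b

  source target : Fin (#nonEdges G) → Fin n
  source e = proj₁ (nonEdge G e)
  target e = proj₂ (nonEdge G e)

  nonEdge-spec : ∀ e → source e Fin.< target e × ¬ (source e ~ target e)
  nonEdge-spec e = proj₂ (List.∈-filter⁻ (λ (i , j) → (i Fin.<? j) ×-dec ¬? (i ~? j))
    {xs = List.cartesianProduct (allFin n) (allFin n)} (List.∈-lookup e))

  source≢target : ∀ e → source e ≢ target e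
  source≢target e = Fin.<⇒≢ (proj₁ (nonEdge-spec e))

  -- A sum of two rank-one matrices. Distinctness enters because the disjunction in `Y` counts an
  -- entry once, whereas for `i` equal to `j` the sum would count it twice.
  Y-entry : ∀ i j → i ≢ j → ∀ a b → Y (i , j) a b ≈ unit i a * unit j b + unit j a * unit i b
  Y-entry i j i≢j a b with a Fin.≟ i | b Fin.≟ j | a Fin.≟ j | b Fin.≟ i
  ... | yes a≡i | _     | yes a≡j | _     = contradiction (≡.trans (≡.sym a≡i) a≡j) i≢j
  ... | yes _   | yes _ | no _    | b≟i   = sym (trans (+-cong (*-identityˡ 1#) (zeroˡ _)) (+-identityʳ 1#))
  ... | yes _   | no _  | no _    | b≟i   = sym (trans (+-cong (*-identityˡ 0#) (zeroˡ _)) (+-identityʳ 0#))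
  ... | no _    | b≟j   | yes _   | yes _ = sym (trans (+-cong (zeroˡ _) (*-identityˡ 1#)) (+-identityˡ 1#))
  ... | no _    | b≟j   | yes _   | no _  = sym (trans (+-cong (zeroˡ _) (*-identityˡ 0#)) (+-identityˡ 0#))
  ... | no _    | b≟j   | no _    | b≟i   = sym (trans (+-cong (zeroˡ _) (zeroˡ _)) (+-identityˡ 0#))

  Yₑ : Fin (#nonEdges G) → Matrix n
  Yₑ e = Y (nonEdge G e)

  Yₑ-entry : ∀ e a b → Yₑ e a b ≈ unit (source e) a * unit (target e) b + unit (target e) a * unit (source e) b
  Yₑ-entry e = Y-entry (source e) (target e) (source≢target e)

  quad-Y : ∀ e z → z ∙ Yₑ e · z ≈ z (source e) * z (target e) + z (target e) * z (source e)
  quad-Y e z = begin-equality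
    z ∙ Yₑ e · z                              ≈⟨ ∙-cong (λ _ → refl) row ⟩
    z ∙ lin (z t) (unit s) (z s) (unit t)     ≈⟨ ∙-lin (z t) (unit s) (z s) (unit t) z ⟩
    z t * (z ∙ unit s) + z s * (z ∙ unit t)   ≈⟨ +-cong (*-congˡ (trans (∙-comm z _) (unit-∙ s z))) (*-congˡ (trans (∙-comm z _) (unit-∙ t z))) ⟩
    z t * z s + z s * z t                     ≈⟨ +-comm _ _ ⟩
    z s * z t + z t * z s                     ∎
    where
    s = source e
    t = target e
    row : Yₑ e · z ≋ lin (z t) (unit s) (z s) (unit t)
    row a = begin-equality
      Yₑ e a ∙ z                                          ≈⟨ ∙-cong (Yₑ-entry e a) (λ _ → refl) ⟩
      lin (unit s a) (unit t) (unit t a) (unit s) ∙ z     ≈⟨ lin-∙ (unit s a) (unit t) (unit t a) (unit s) z ⟩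
      unit s a * (unit t ∙ z) + unit t a * (unit s ∙ z)   ≈⟨ +-cong (*-congˡ (unit-∙ t z)) (*-congˡ (unit-∙ s z)) ⟩
      unit s a * z t + unit t a * z s                     ≈⟨ +-cong (*-comm _ _) (*-comm _ _) ⟩
      z t * unit s a + z s * unit t a                     ∎

  quad-+ : ∀ (M N : Matrix n) z → z ∙ (λ a b → M a b + N a b) · z ≈ z ∙ M · z + z ∙ N · z
  quad-+ M N z = begin-equality
    z ∙ (λ a b → M a b + N a b) · z                 ≈⟨ ∙-cong (λ _ → refl) (λ a → trans (sum-cong-≋ (λ b → distribʳ (z b) (M a b) (N a b))) (∑-distrib-+ (λ b → M a b * z b) (λ b → N a b * z b))) ⟩
    z ∙ (λ a → (M · z) a + (N · z) a)               ≈⟨ sum-cong-≋ (λ a → distribˡ (z a) _ _) ⟩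
    sum (λ a → z a * (M · z) a + z a * (N · z) a)   ≈⟨ ∑-distrib-+ (λ a → z a * (M · z) a) (λ a → z a * (N · z) a) ⟩
    z ∙ M · z + z ∙ N · z                           ∎

  quad-∑ : ∀ {m} (c : Vector Carrier m) (M : Fin m → Matrix n) z →
           z ∙ (λ a b → c ∙ (λ e → M e a b)) · z ≈ c ∙ (λ e → z ∙ M e · z)
  quad-∑ c M z = begin-equality
    z ∙ (λ a b → c ∙ (λ e → M e a b)) · z   ≈⟨ ∙-cong (λ _ → refl) (λ a → ∑-∑-distribˡ c (λ e → M e a) z) ⟩
    z ∙ (λ a → c ∙ (λ e → (M e · z) a))     ≈⟨ ∙-comm z _ ⟩
    (λ a → c ∙ (λ e → (M e · z) a)) ∙ z     ≈⟨ ∑-∑-distribˡ c (λ e → M e · z) z ⟩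
    c ∙ (λ e → M e · z ∙ z)                 ≈⟨ ∙-cong (λ _ → refl) (λ e → ∙-comm (M e · z) z) ⟩
    c ∙ (λ e → z ∙ M e · z)                 ∎

  quad-J : ∀ c (z : Vector Carrier n) → z ∙ (λ _ _ → c * 1#) · z ≈ c * (sum z * sum z)
  quad-J c z = begin-equality
    z ∙ (λ _ → sum (λ b → c * 1# * z b))   ≈⟨ ∙-cong {x = z} (λ _ → refl) (λ _ → sym (*-distribˡ-sum (c * 1#) z)) ⟩
    z ∙ (λ _ → c * 1# * sum z)             ≈⟨ *-distribʳ-sum (c * 1# * sum z) z ⟨
    sum z * (c * 1# * sum z)               ≈⟨ solve 2 (λ c s → s :* (c :* con (+ 1) :* s) := c :* (s :* s)) refl c (sum z) ⟩
    c * (sum z * sum z)                    ∎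

  cross : Vector Carrier n → Fin (#nonEdges G) → Carrier
  cross z e = z (source e) * z (target e) + z (target e) * z (source e)

  quad-A : ∀ z → z ∙ A · z ≈ (λ e → - pₑ e) ∙ cross z + p₀ * (sum z * sum z) + z ∙ z
  quad-A z = begin-equality
    z ∙ A · z
      ≈⟨ quad-+ _ 𝟙 z ⟩
    z ∙ (λ a b → (λ e → - pₑ e) ∙ (λ e → Yₑ e a b) + p₀ * 1#) · z + z ∙ 𝟙 · z
      ≈⟨ +-cong (quad-+ _ _ z) (∙-cong (λ _ → refl) (λ i → 𝟙-∙ i z)) ⟩
    z ∙ (λ a b → (λ e → - pₑ e) ∙ (λ e → Yₑ e a b)) · z + z ∙ (λ _ _ → p₀ * 1#) · z + z ∙ z
      ≈⟨ +-congʳ (+-cong (trans (quad-∑ (λ e → - pₑ e) Yₑ z) (∙-cong (λ _ → refl) (λ e → quad-Y e z))) (quad-J p₀ z)) ⟩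
    (λ e → - pₑ e) ∙ cross z + p₀ * (sum z * sum z) + z ∙ z ∎

  A-sym : Sym A
  A-sym a b = +-cong (+-congʳ (sum-cong-≋ (λ e → *-congˡ (Yₑ-sym e)))) (reflexive (𝟙-sym a b))
    where
    Yₑ-sym : ∀ e → Yₑ e a b ≈ Yₑ e b a
    Yₑ-sym e = trans (Yₑ-entry e a b) (trans (trans (+-comm _ _) (+-cong (*-comm _ _) (*-comm _ _))) (sym (Yₑ-entry e b a)))

  A-diagonal : ∀ a → A a a ≈ p₀ + 1#
  A-diagonal a = +-cong (trans (+-cong (sum-zero off) (*-identityʳ p₀)) (+-identityˡ p₀)) (reflexive (𝟙-diagonal a))
    where
    disjoint : ∀ i j → i ≢ j → unit i a * unit j a ≈ 0#
    disjoint i j i≢j with a Fin.≟ i | a Fin.≟ j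
    ... | yes a≡i | yes a≡j = contradiction (≡.trans (≡.sym a≡i) a≡j) i≢j
    ... | yes _   | no _    = zeroʳ _
    ... | no _    | _       = zeroˡ _
    off : ∀ e → - pₑ e * Yₑ e a a ≈ 0#
    off e = trans (*-congˡ (trans (Yₑ-entry e a a)
      (trans (+-cong (disjoint _ _ (source≢target e)) (disjoint _ _ (source≢target e ∘ ≡.sym))) (+-identityˡ 0#)))) (zeroʳ _)

  module _ (0≤p : ∀ i → 0# ≤ p i) (∑p≈1 : sum p ≈ 1#) where

    A-PSD : PSD A
    A-PSD z = begin
      0#
        ≲⟨ +-nonNeg (sum-nonNeg (λ e → *-nonNeg (0≤p (suc e)) (0≤y-x (cross≤ e))))
                    (*-nonNeg (0≤p zero) (+-nonNeg (∙-square-nonNeg z) (square-nonNeg (sum z)))) ⟩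
      -- The contribution `Q` of the identity matrix is shared out according to `p`: the share of
      -- each nonedge pays for its cross term, and the share of `p₀` is left over.
      pₑ ∙ (λ e → Q - cross z e) + p₀ * (Q + sum z * sum z)
        ≈⟨ +-congʳ (trans (sum-cong-≋ (λ e → solve 3 (λ p q c → p :* (q :- c) := p :* q :+ :- p :* c) refl (pₑ e) Q (cross z e))) (∑-distrib-+ (λ e → pₑ e * Q) (λ e → - pₑ e * cross z e))) ⟩
      sum (λ e → pₑ e * Q) + X + p₀ * (Q + sum z * sum z)
        ≈⟨ +-congʳ (+-congʳ (sym (*-distribʳ-sum Q pₑ))) ⟩
      sum pₑ * Q + X + p₀ * (Q + sum z * sum z)
        ≈⟨ solve 5 (λ s q x p t → s :* q :+ x :+ p :* (q :+ t) := x :+ p :* t :+ (p :+ s) :* q) refl (sum pₑ) Q X p₀ (sum z * sum z) ⟩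
      X + p₀ * (sum z * sum z) + sum p * Q
        ≈⟨ +-congˡ (trans (*-congʳ ∑p≈1) (*-identityˡ Q)) ⟩
      X + p₀ * (sum z * sum z) + Q
        ≈⟨ quad-A z ⟨
      z ∙ A · z ∎
      where
      Q = z ∙ z
      X = (λ e → - pₑ e) ∙ cross z
      cross≤ : ∀ e → cross z e ≤ Q
      cross≤ e = ≤-trans
        (≤-offset (square-nonNeg (z (source e) - z (target e)))
          (solve 2 (λ s t → s :* t :+ t :* s :+ (s :- t) :* (s :- t) := s :* s :+ t :* t) refl (z (source e)) (z (target e))))
        (two-terms≤sum (λ i → square-nonNeg (z i)) _ _ (source≢target e))

    open SymmetricPowers A A-sym

    1≤matrixPower-diagonal : ∀ t i → 1# ≤ matrixPower A t i i
    1≤matrixPower-diagonal t i = begin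
      1#                           ≲⟨ 1≤x⇒1≤x^n t ≤-refl ⟩
      1# ^ t                       ≈⟨ trans (*-congˡ (moment₀ i)) (*-identityʳ _) ⟨
      1# ^ t * moment 0 (unit i)   ≲⟨ moment-lower A-PSD (unit i) 0≤1 base t ⟩
      moment t (unit i)            ≈⟨ unit-∙ i _ ⟩
      matrixPower A t i i          ∎
      where
      moment₀ : ∀ i → moment 0 (unit i) ≈ 1#
      moment₀ i = trans (unit-∙ i (unit i)) (reflexive (𝟙-diagonal i))
      base : 1# * moment 0 (unit i) ≤ moment 1 (unit i)
      base = begin
        1# * moment 0 (unit i)   ≈⟨ trans (*-identityˡ _) (moment₀ i) ⟩
        1#                       ≲⟨ ≤-offset (0≤p zero) (+-comm 1# p₀) ⟩
        p₀ + 1#                  ≈⟨ A-diagonal i ⟨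
        A i i                    ≈⟨ ·-unit A i i ⟨
        (A · unit i) i           ≈⟨ unit-∙ i _ ⟨
        unit i ∙ A · unit i      ∎

-- Cliques and colourings

-- Row `i` of the product loses at least the pair `(i , i)`. This crude count, which ignores that
-- each pair is listed once, is the one that occurs in the bound on `ε`.
#nonEdges≤ : ∀ {n} (G : Graph n) → #nonEdges G ℕ.≤ n ℕ.* (n ℕ.∸ 1)
#nonEdges≤ {n} G = ≡.subst (λ m → #nonEdges G ℕ.≤ m ℕ.* (n ℕ.∸ 1)) (length-tabulate {n = n} id) (rows (allFin n))
  where
  open Graph G
  P? : Decidable (λ (i , j) → i Fin.< j × ¬ i ~ j)
  P? (i , j) = (i Fin.<? j) ×-dec ¬? (i ~? j)
  row : ∀ i → List.length (filter P? (List.map (i ,_) (allFin n))) ℕ.≤ n ℕ.∸ 1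
  row i = ℕ.≤-pred (ℕ.≤-trans
    (filter-notAll P? (List.map (i ,_) (allFin n))
      (Any.map (λ { ≡.refl (i<i , _) → Fin.<-irrefl ≡.refl i<i }) (List.∈-map⁺ (i ,_) (List.∈-allFin i))))
    (ℕ.≤-trans (ℕ.≤-reflexive (≡.trans (length-map (i ,_) (allFin n)) (length-tabulate id))) (ℕ.m≤n+m∸n n 1)))
  rows : ∀ is → List.length (filter P? (List.cartesianProduct is (allFin n))) ℕ.≤ List.length is ℕ.* (n ℕ.∸ 1)
  rows []       = ℕ.z≤n
  rows (i ∷ is) = begin
    List.length (filter P? (List.map (i ,_) (allFin n) List.++ rest))
      ≡⟨ ≡.cong List.length (filter-++ P? (List.map (i ,_) (allFin n)) rest) ⟩
    List.length (filter P? (List.map (i ,_) (allFin n)) List.++ filter P? rest)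
      ≡⟨ length-++ (filter P? (List.map (i ,_) (allFin n))) ⟩
    List.length (filter P? (List.map (i ,_) (allFin n))) ℕ.+ List.length (filter P? rest)
      ≤⟨ ℕ.+-mono-≤ (row i) (rows is) ⟩
    n ℕ.∸ 1 ℕ.+ List.length is ℕ.* (n ℕ.∸ 1) ∎
    where
    open ℕ.≤-Reasoning
    rest = List.cartesianProduct is (allFin n)

count : ∀ {m} → (Fin m → Bool) → ℕ
count {zero}  b = 0
count {suc m} b = (if b zero then 1 else 0) ℕ.+ count (b ∘ suc)

count≤ : ∀ {m} (b : Fin m → Bool) → count b ℕ.≤ m
count≤ {zero}  b = ℕ.z≤n
count≤ {suc m} b with b zero
... | true  = ℕ.s≤s (count≤ (b ∘ suc))
... | false = ℕ.m≤n⇒m≤1+n (count≤ (b ∘ suc))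

-- Bernoulli estimates in place of the exponential

module Naturals (O : OrderedCommutativeRing) where
  open OrderedCommutativeRing O
  open OrderedRingProperties O
  open IntegerSolver commutativeRing
  open import Algebra.Properties.Semiring.Exp semiring using (^-assocʳ; ^-congˡ; ^-congʳ)
  open import Algebra.Properties.CommutativeSemiring.Exp commutativeSemiring using (^-distrib-*)
  open ≤-Reasoning

  ι-mono-≤ : ∀ {m n} → m ℕ.≤ n → ι m ≤ ι n
  ι-mono-≤ {n = n} ℕ.z≤n = ι-nonNeg n
  ι-mono-≤ (ℕ.s≤s m≤n) = +-mono-≤ ≤-refl (ι-mono-≤ m≤n)

  bernoulli : ∀ {v} → 0# ≤ v → ∀ t → 1# + ι t * v ≤ (1# + v) ^ t
  bernoulli {v} 0≤v zero    = ≤-reflexive (solve 1 (λ v → con (+ 1) :+ con (+ 0) :* v := con (+ 1)) refl v)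
  bernoulli {v} 0≤v (suc t) = begin
    1# + (1# + ι t) * v        ≲⟨ ≤-offset (*-nonNeg (ι-nonNeg t) (square-nonNeg v))
                                      (solve 2 (λ s v → con (+ 1) :+ (con (+ 1) :+ s) :* v :+ s :* (v :* v)
                                        := (con (+ 1) :+ v) :* (con (+ 1) :+ s :* v)) refl (ι t) v) ⟩
    (1# + v) * (1# + ι t * v)   ≲⟨ *-monoˡ-≤ (+-nonNeg 0≤1 0≤v) (bernoulli 0≤v t) ⟩
    (1# + v) * (1# + v) ^ t     ∎

  -- Since (1 - (m+1) v) (1 + v) = 1 - m v - (m+1) v², each step of the induction drops only a
  -- nonnegative multiple of a square.
  [1-mv][1+v]^m≤1 : ∀ {v} → 0# ≤ v → ∀ m → (1# - ι m * v) * (1# + v) ^ m ≤ 1#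
  [1-mv][1+v]^m≤1 {v} 0≤v zero    = ≤-reflexive (solve 1 (λ v → (con (+ 1) :- con (+ 0) :* v) :* con (+ 1) := con (+ 1)) refl v)
  [1-mv][1+v]^m≤1 {v} 0≤v (suc m) = begin
    (1# - (1# + M) * v) * ((1# + v) * (1# + v) ^ m)
      ≲⟨ ≤-offset (*-nonNeg (*-nonNeg (ι-nonNeg (suc m)) (square-nonNeg v)) (^-nonNeg m (+-nonNeg 0≤1 0≤v)))
           (solve 3 (λ M v x → (con (+ 1) :- (con (+ 1) :+ M) :* v) :* ((con (+ 1) :+ v) :* x) :+ ((con (+ 1) :+ M) :* (v :* v)) :* x
             := (con (+ 1) :- M :* v) :* x) refl M v ((1# + v) ^ m)) ⟩
    (1# - M * v) * (1# + v) ^ m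
      ≲⟨ [1-mv][1+v]^m≤1 0≤v m ⟩
    1# ∎
    where M = ι m

  -- A division-free form of (1 - mv)ᵗ ≤ (1 + tv)⁻ᵐ: both sides approximate exp(-tmv).
  [1-mv]^t[1+tv]^m≤1 : ∀ {v} → 0# ≤ v → ∀ m t → 0# ≤ 1# - ι m * v →
    (1# - ι m * v) ^ t * (1# + ι t * v) ^ m ≤ 1#
  [1-mv]^t[1+tv]^m≤1 {v} 0≤v m t 0≤a = begin
    a ^ t * (1# + ι t * v) ^ m   ≲⟨ *-monoˡ-≤ (^-nonNeg t 0≤a) (^-mono-≤ m (+-nonNeg 0≤1 (*-nonNeg (ι-nonNeg t) 0≤v)) (bernoulli 0≤v t)) ⟩
    -- After the exponents are exchanged, the product is the `t`-th power of a number between 0 and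
    -- 1.
    a ^ t * ((1# + v) ^ t) ^ m   ≈⟨ *-congˡ (trans (^-assocʳ (1# + v) t m) (trans (^-congʳ (1# + v) (ℕ.*-comm t m)) (sym (^-assocʳ (1# + v) m t)))) ⟩
    a ^ t * ((1# + v) ^ m) ^ t   ≈⟨ ^-distrib-* a ((1# + v) ^ m) t ⟨
    (a * (1# + v) ^ m) ^ t       ≲⟨ x≤1⇒x^n≤1 t (*-nonNeg 0≤a (^-nonNeg m (+-nonNeg 0≤1 0≤v))) ([1-mv][1+v]^m≤1 0≤v m) ⟩
    1#                           ∎
    where a = 1# - ι m * v

-- Growth forced by a clique

module CliqueBound (O : OrderedCommutativeRing) {n} (G : Graph n)
  (p : Vector (OrderedCommutativeRing.Carrier O) (suc (#nonEdges G))) where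
  open OrderedCommutativeRing O
  open OrderedRingProperties O
  open IntegerSolver commutativeRing
  open LinearAlgebra O
  open Naturals O
  open WeightedGraph O G p
  open SymmetricPowers A A-sym
  open Graph G
  open import Algebra.Properties.Semiring.Exp semiring using (^-homo-*)
  open import Algebra.Properties.CommutativeSemiring.Exp commutativeSemiring using (^-distrib-*)
  open ≤-Reasoning

  indicator : ∀ {n} → Subset n → Vector Carrier n
  indicator U i = if lookup U i then 1# else 0#

  indicator-idem : ∀ {n} (U : Subset n) i → indicator U i * indicator U i ≈ indicator U i
  indicator-idem U i with lookup U i
  ... | true  = *-identityˡ 1#
  ... | false = zeroˡ 0#

  sum-indicator : ∀ {n} (U : Subset n) → sum (indicator U) ≈ ι ∣ U ∣
  sum-indicator []            = refl
  sum-indicator (inside  ∷ U) = +-congˡ (sum-indicator U)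
  sum-indicator (outside ∷ U) = trans (+-identityˡ _) (sum-indicator U)

  indicator-disjoint : ∀ {n} (U : Subset n) i j → ¬ (i ∈ U × j ∈ U) → indicator U i * indicator U j ≈ 0#
  indicator-disjoint U i j h with lookup U i in eqᵢ | lookup U j in eqⱼ
  ... | true  | true  = contradiction (lookup⇒[]= i U eqᵢ , lookup⇒[]= j U eqⱼ) h
  ... | true  | false = zeroʳ _
  ... | false | _     = zeroˡ _

  module _ (U : Subset n) (clique : IsClique G U) where
    private
      x = indicator U
      k = ι ∣ U ∣

    x∙x≈k : x ∙ x ≈ k
    x∙x≈k = trans (sum-cong-≋ (indicator-idem U)) (sum-indicator U)

    -- No nonedge has both ends in a clique, so all cross terms vanish, whatever the weights: the
    -- indicator has Rayleigh quotient `p₀ * k + 1#`.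
    quad-indicator : x ∙ A · x ≈ (p₀ * k + 1#) * k
    quad-indicator = begin-equality
      x ∙ A · x
        ≈⟨ quad-A x ⟩
      (λ e → - pₑ e) ∙ cross x + p₀ * (sum x * sum x) + x ∙ x
        ≈⟨ +-cong (+-cong (sum-zero vanish) (*-congˡ (*-cong (sum-indicator U) (sum-indicator U)))) x∙x≈k ⟩
      0# + p₀ * (k * k) + k
        ≈⟨ solve 2 (λ p k → con (+ 0) :+ p :* (k :* k) :+ k := (p :* k :+ con (+ 1)) :* k) refl p₀ k ⟩
      (p₀ * k + 1#) * k ∎
      where
      vanish : ∀ e → - pₑ e * cross x e ≈ 0#
      vanish e = trans (*-congˡ (trans
        (+-cong (indicator-disjoint U _ _ not-both) (indicator-disjoint U _ _ (not-both ∘ Product.swap))) (+-identityˡ 0#))) (zeroʳ _)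
        where
        not-both : ¬ (source e ∈ U × target e ∈ U)
        not-both (s∈U , t∈U) = proj₂ (nonEdge-spec e) (clique s∈U t∈U (source≢target e))

    module _ (0≤p : ∀ i → 0# ≤ p i) (∑p≈1 : sum p ≈ 1#) where

      -- Two growth rates collide: the clique forces rate `Λ`, while the ratios at the vertices
      -- allow only `a * Λ`. The passage from vertices to the clique costs a factor `n`, which the
      -- power of `a` more than absorbs.
      clique-obstruction : 1 ℕ.≤ ∣ U ∣ → ∀ T {a ν⁻¹} → 0# ≤ a → a ≤ 1# → ι (suc n) * a ^ T ≤ 1# →
        0# ≤ ν⁻¹ → ν⁻¹ * (a * (p₀ * k + 1#)) ≈ 1# →
        (∀ i → matrixPower A (suc (T ℕ.+ T)) i i ≤ a * (p₀ * k + 1#) * matrixPower A (T ℕ.+ T) i i) →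
        1# ≤ 0#
      clique-obstruction 1≤k T {a} {ν⁻¹} 0≤a a≤1 small 0≤ν⁻¹ inverse h = begin
        1#            ≲⟨ 1≤W ⟩
        W             ≲⟨ W≤NθW ⟩
        N * (θ * W)   ≲⟨ *-monoˡ-≤ (ι-nonNeg n) θW≤0 ⟩
        N * 0#        ≈⟨ zeroʳ N ⟩
        0#            ∎
        where
        Λ = p₀ * k + 1#
        ν = a * Λ
        s = suc (T ℕ.+ T)
        N = ι n
        θ = a ^ T
        W = Λ ^ s * k
        0≤k : 0# ≤ k
        0≤k = ι-nonNeg ∣ U ∣
        1≤Λ : 1# ≤ Λ
        1≤Λ = ≤-offset (*-nonNeg (0≤p zero) 0≤k) (+-comm _ _)
        0≤Λ : 0# ≤ Λ
        0≤Λ = ≤-trans 0≤1 1≤Λ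
        0≤ν = *-nonNeg 0≤a 0≤Λ
        0≤θ = ^-nonNeg T 0≤a
        0≤W = *-nonNeg (^-nonNeg s 0≤Λ) 0≤k
        1≤W : 1# ≤ W
        1≤W = begin
          1#        ≈⟨ *-identityˡ 1# ⟨
          1# * 1#   ≲⟨ *-mono-≤ (^-nonNeg s 0≤Λ) 0≤1 (1≤x⇒1≤x^n s 1≤Λ) (≤-trans (≤-reflexive (sym (+-identityʳ 1#))) (ι-mono-≤ 1≤k)) ⟩
          W         ∎
        -- The available exponent is 2T + 1, but the decay hypothesis speaks of `T`; the surplus
        -- factors are at most 1 and are discarded.
        a^s≤θ : a ^ s ≤ θ
        a^s≤θ = begin
          a * a ^ (T ℕ.+ T)     ≈⟨ *-congˡ (^-homo-* a T T) ⟩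
          a * (a ^ T * a ^ T)   ≲⟨ *-mono-≤ 0≤1 (*-nonNeg 0≤θ 0≤θ) a≤1 (*-monoˡ-≤ 0≤θ (x≤1⇒x^n≤1 T 0≤a a≤1)) ⟩
          1# * (a ^ T * 1#)     ≈⟨ trans (*-identityˡ _) (*-identityʳ _) ⟩
          a ^ T                 ∎
        moment₀ : ∀ i → moment 0 (unit i) ≈ 1#
        moment₀ i = trans (unit-∙ i (unit i)) (reflexive (𝟙-diagonal i))
        diagonal : ∀ i → matrixPower A s i i ≤ ν ^ s
        diagonal i = begin
          matrixPower A s i i         ≈⟨ unit-∙ i _ ⟨
          moment s (unit i)           ≲⟨ moment-upper (A-PSD 0≤p ∑p≈1) (unit i) 0≤ν 0≤ν⁻¹ inverse (T ℕ.+ T) ratio ⟩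
          ν ^ s * moment 0 (unit i)   ≈⟨ trans (*-congˡ (moment₀ i)) (*-identityʳ _) ⟩
          ν ^ s                       ∎
          where
          ratio : moment s (unit i) ≤ ν * moment (T ℕ.+ T) (unit i)
          ratio = begin
            moment s (unit i)                 ≈⟨ unit-∙ i _ ⟩
            matrixPower A s i i               ≲⟨ h i ⟩
            ν * matrixPower A (T ℕ.+ T) i i   ≈⟨ *-congˡ (unit-∙ i _) ⟨
            ν * moment (T ℕ.+ T) (unit i)     ∎
        W≤NθW : W ≤ N * (θ * W)
        W≤NθW = begin
          Λ ^ s * k                 ≈⟨ *-congˡ x∙x≈k ⟨
          Λ ^ s * moment 0 x        ≲⟨ moment-lower (A-PSD 0≤p ∑p≈1) x 0≤Λ (≤-reflexive (trans (*-congˡ x∙x≈k) (sym quad-indicator))) s ⟩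
          moment s x                ≲⟨ moment≤diagonal (A-PSD 0≤p ∑p≈1) s diagonal x ⟩
          N * (ν ^ s * (x ∙ x))     ≈⟨ *-congˡ (*-cong (^-distrib-* a Λ s) x∙x≈k) ⟩
          N * (a ^ s * Λ ^ s * k)   ≈⟨ *-congˡ (*-assoc _ _ _) ⟩
          N * (a ^ s * W)           ≲⟨ *-monoˡ-≤ (ι-nonNeg n) (*-monoʳ-≤ 0≤W a^s≤θ) ⟩
          N * (θ * W)               ∎
        -- From (1 + N) θ ≤ 1 comes θ W ≤ W - N θ W, and the right side is at most zero by `W≤NθW`.
        θW≤0 : θ * W ≤ 0#
        θW≤0 = ≤-offset (+-nonNeg (*-nonNeg (0≤y-x small) 0≤W) (0≤y-x W≤NθW))
          (solve 3 (λ N θ W → θ :* W :+ ((con (+ 1) :- (con (+ 1) :+ N) :* θ) :* W :+ (N :* (θ :* W) :- W)) := con (+ 0)) refl N θ W)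

-- Growth permitted by a colouring

module ColourWeights (O : OrderedCommutativeRing) {n w} (G : Graph n) (f : Fin n → Fin w)
  (f-proper : ∀ {i j} → Graph._~_ G i j → f i ≢ f j)
  (P κ : OrderedCommutativeRing.Carrier O) where
  open OrderedCommutativeRing O
  open OrderedRingProperties O
  open IntegerSolver commutativeRing
  open LinearAlgebra O
  open Sums O
  open Graph G
  open ≤-Reasoning

  mono : Fin (#nonEdges G) → Bool
  mono e = does (f (proj₁ (nonEdge G e)) Fin.≟ f (proj₂ (nonEdge G e)))

  N : ℕ
  N = count mono

  -- Up to the factor `P` and the identity, the matrix becomes all-ones minus `κ` times the
  -- adjacency of monochromatic nonedges. With at most `κ` colours its largest eigenvalue is at most
  -- `κ`, as in the classical bound of theta by the chromatic number. `P` stays free until the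
  -- weights are normalised.
  p : Vector Carrier (suc (#nonEdges G))
  p zero    = P
  p (suc e) = κ * P * (if mono e then 1# else 0#)

  open WeightedGraph O G p hiding (p₀; pₑ)

  sum-count : ∀ {m} (b : Fin m → Bool) → sum (λ e → if b e then 1# else 0#) ≈ ι (count b)
  sum-count {zero}  b = refl
  sum-count {suc m} b with b zero
  ... | true  = +-congˡ (sum-count (b ∘ suc))
  ... | false = trans (+-identityˡ _) (sum-count (b ∘ suc))

  sum-p : sum p ≈ P * (1# + κ * ι N)
  sum-p = begin-equality
    P + sum (λ e → κ * P * (if mono e then 1# else 0#))   ≈⟨ +-congˡ (*-distribˡ-sum (κ * P) (λ e → if mono e then 1# else 0#)) ⟨
    P + κ * P * sum (λ e → if mono e then 1# else 0#)     ≈⟨ +-congˡ (*-congˡ (sum-count mono)) ⟩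
    P + κ * P * ι N                                       ≈⟨ solve 3 (λ P κ N → P :+ κ :* P :* N := P :* (con (+ 1) :+ κ :* N)) refl P κ (ι N) ⟩
    P * (1# + κ * ι N)                                    ∎

  p-nonNeg : 0# ≤ P → 0# ≤ κ → ∀ i → 0# ≤ p i
  p-nonNeg 0≤P 0≤κ zero    = 0≤P
  p-nonNeg 0≤P 0≤κ (suc e) = *-nonNeg (*-nonNeg 0≤κ 0≤P) (bit (mono e))
    where
    bit : ∀ b → 0# ≤ (if b then 1# else 0#)
    bit true  = 0≤1
    bit false = ≤-refl

  sum-nonEdges : ∀ (g : Fin n → Fin n → Carrier) →
    sum (λ e → g (source e) (target e)) ≈
    sum (λ i → sum (λ j → when (does ((i Fin.<? j) ×-dec ¬? (i ~? j))) (g i j)))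
  sum-nonEdges g = begin-equality
    sum (λ e → g (source e) (target e))
      ≈⟨ listSum-lookup (λ (i , j) → g i j) (nonEdges G) ⟩
    listSum (λ (i , j) → g i j) (nonEdges G)
      ≈⟨ listSum-filter (λ (i , j) → (i Fin.<? j) ×-dec ¬? (i ~? j)) (λ (i , j) → g i j) (List.cartesianProduct (allFin n) (allFin n)) ⟩
    listSum h (List.cartesianProduct (allFin n) (allFin n))
      ≈⟨ listSum-cartesianProductWith h _,_ (allFin n) (allFin n) ⟩
    listSum (λ i → listSum (λ j → h (i , j)) (allFin n)) (allFin n)
      ≈⟨ listSum-tabulate (λ i → listSum (λ j → h (i , j)) (allFin n)) id ⟩
    sum (λ i → listSum (λ j → h (i , j)) (allFin n))
      ≈⟨ sum-cong-≋ (λ i → listSum-tabulate (λ j → h (i , j)) id) ⟩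
    sum (λ i → sum (λ j → h (i , j))) ∎
    where
    h : Fin n × Fin n → Carrier
    h (i , j) = when (does ((i Fin.<? j) ×-dec ¬? (i ~? j))) (g i j)

  -- Folds the lower triangle onto the upper one, to match the listing of each nonedge with its
  -- smaller end first.
  sum-triangle : ∀ (g : Fin n → Fin n → Carrier) →
    sum (λ i → sum (λ j → when (does (i Fin.<? j)) (g i j + g j i))) + sum (λ i → g i i) ≈
    sum (λ i → sum (g i))
  sum-triangle g = begin-equality
    sum (λ i → sum (λ j → when (does (i Fin.<? j)) (g i j + g j i))) + sum (λ i → g i i)
      ≈⟨ +-cong
           (trans (sum-cong-≋ (λ i → trans (sum-cong-≋ (λ j → when-+ (does (i Fin.<? j)) (g i j) (g j i))) (∑-distrib-+ (L i) (U′ i))))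
             (∑-distrib-+ (λ i → sum (L i)) (λ i → sum (U′ i))))
           (sum-cong-≋ (λ i → sym (sum-𝟙 i (g i)))) ⟩
    sum (λ i → sum (L i)) + sum (λ i → sum (U′ i)) + sum (λ i → sum (D i))
      ≈⟨ +-congʳ (+-congˡ (∑-comm U′)) ⟩
    sum (λ i → sum (L i)) + sum (λ i → sum (U i)) + sum (λ i → sum (D i))
      ≈⟨ +-congʳ (∑-distrib-+ (λ i → sum (L i)) (λ i → sum (U i))) ⟨
    sum (λ i → sum (L i) + sum (U i)) + sum (λ i → sum (D i))
      ≈⟨ ∑-distrib-+ (λ i → sum (L i) + sum (U i)) (λ i → sum (D i)) ⟨
    sum (λ i → sum (L i) + sum (U i) + sum (D i))
      ≈⟨ sum-cong-≋ (λ i → trans (+-congʳ (sym (∑-distrib-+ (L i) (U i)))) (sym (∑-distrib-+ (λ j → L i j + U i j) (D i)))) ⟩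
    sum (λ i → sum (λ j → L i j + U i j + D i j))
      ≈⟨ sum-cong-≋ (λ i → sum-cong-≋ (λ j → split i j)) ⟩
    sum (λ i → sum (g i)) ∎
    where
    L U U′ D : Fin n → Fin n → Carrier
    L  i j = when (does (i Fin.<? j)) (g i j)
    U  i j = when (does (j Fin.<? i)) (g i j)
    U′ i j = when (does (i Fin.<? j)) (g j i)
    D  i j = when (does (j Fin.≟ i)) (g i j)
    when-+ : ∀ b x y → when b (x + y) ≈ when b x + when b y
    when-+ true  x y = refl
    when-+ false x y = sym (+-identityˡ 0#)
    split : ∀ i j → L i j + U i j + D i j ≈ g i j
    split i j with Fin.<-cmp i j
    ... | tri< i<j i≢j j≮i
      rewrite dec-true (i Fin.<? j) i<j | dec-false (j Fin.<? i) j≮i | dec-false (j Fin.≟ i) (i≢j ∘ ≡.sym)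
      = trans (+-identityʳ _) (+-identityʳ _)
    ... | tri≈ i≮j i≡j j≮i
      rewrite dec-false (i Fin.<? j) i≮j | dec-false (j Fin.<? i) j≮i | dec-true (j Fin.≟ i) (≡.sym i≡j)
      = trans (+-congʳ (+-identityˡ 0#)) (+-identityˡ _)
    ... | tri> i≮j i≢j j<i
      rewrite dec-false (i Fin.<? j) i≮j | dec-true (j Fin.<? i) j<i | dec-false (j Fin.≟ i) (i≢j ∘ ≡.sym)
      = trans (+-identityʳ _) (+-identityˡ _)

  module _ (z : Vector Carrier n) where

    g : Fin n → Fin n → Carrier
    g i j = z i * (𝟙 (f i) (f j) * z j)

    -- The form of the block matrix with ones inside every colour class; equivalently, the sum of
    -- the squares of the class sums `s`.
    B : Carrier
    B = sum (λ i → sum (g i))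

    private
      s : Vector Carrier w
      s c = z ∙ (λ i → 𝟙 (f i) c)

    ∑s≈∑z : sum s ≈ sum z
    ∑s≈∑z = trans (∑-comm (λ c i → z i * 𝟙 (f i) c))
      (sum-cong-≋ (λ i → trans (sum-cong-≋ (λ c → *-comm (z i) (𝟙 (f i) c))) (𝟙-∙ (f i) (λ _ → z i))))

    s∙s≈B : s ∙ s ≈ B
    s∙s≈B = begin-equality
      s ∙ s                          ≈⟨ ∑-∑-distribˡ z (λ i c → 𝟙 (f i) c) s ⟩
      z ∙ (λ i → 𝟙 (f i) ∙ s)        ≈⟨ ∙-cong {x = z} (λ _ → refl) (λ i → 𝟙-∙ (f i) s) ⟩
      z ∙ (λ i → s (f i))            ≈⟨ sum-cong-≋ (λ i → *-congˡ (sum-cong-≋ (λ j → trans (*-comm _ _) (*-congʳ (reflexive (𝟙-sym (f j) (f i))))))) ⟩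
      z ∙ (λ i → sum (λ j → 𝟙 (f i) (f j) * z j))
                                     ≈⟨ sum-cong-≋ (λ i → *-distribˡ-sum (z i) (λ j → 𝟙 (f i) (f j) * z j)) ⟩
      B                              ∎

    -- Cauchy-Schwarz between the vector of class sums and the all-ones vector, obtained from
    -- `sum-pairs≤` and hence without division.
    [∑z]²≤wB : sum z * sum z ≤ ι w * B
    [∑z]²≤wB = begin
      sum z * sum z                         ≈⟨ *-cong ∑s≈∑z ∑s≈∑z ⟨
      sum s * sum s                         ≈⟨ trans (*-distribʳ-sum (sum s) s) (sum-cong-≋ (λ c → *-distribˡ-sum (s c) s)) ⟩
      sum (λ c → sum (λ d → s c * s d))     ≲⟨ sum-pairs≤ (λ c d → s c * s d) (λ c d → ≤-offset (square-nonNeg (s c - s d))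
                                                  (solve 2 (λ a b → a :* b :+ b :* a :+ (a :- b) :* (a :- b) := a :* a :+ b :* b) refl (s c) (s d))) ⟩
      ι w * (s ∙ s)   ≈⟨ *-congˡ s∙s≈B ⟩
      ι w * B         ∎

    -- In a proper colouring any two distinct vertices of the same colour form a nonedge, so the
    -- monochromatic nonedges account for all of `B` off the diagonal.
    sum-cross : sum (λ e → (if mono e then 1# else 0#) * cross z e) + z ∙ z ≈ B
    sum-cross = begin-equality
      sum (λ e → (if mono e then 1# else 0#) * cross z e) + z ∙ z
        ≈⟨ +-congʳ (sum-cong-≋ (λ e → scaled-cross (source e) (target e))) ⟩
      sum (λ e → g (source e) (target e) + g (target e) (source e)) + z ∙ z
        ≈⟨ +-cong (trans (sum-nonEdges (λ i j → g i j + g j i)) (sum-cong-≋ (λ i → sum-cong-≋ (λ j → drop i j))))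
                  (sum-cong-≋ (λ i → *-congˡ (trans (sym (*-identityˡ _)) (*-congʳ (reflexive (≡.sym (𝟙-diagonal (f i)))))))) ⟩
      sum (λ i → sum (λ j → when (does (i Fin.<? j)) (g i j + g j i))) + sum (λ i → g i i)
        ≈⟨ sum-triangle g ⟩
      B ∎
      where
      scaled-cross : ∀ i j → 𝟙 (f i) (f j) * (z i * z j + z j * z i) ≈ g i j + g j i
      scaled-cross i j = trans
        (solve 3 (λ d a b → d :* (a :* b :+ b :* a) := a :* (d :* b) :+ b :* (d :* a)) refl (𝟙 (f i) (f j)) (z i) (z j))
        (+-congˡ (*-congˡ (*-congʳ (reflexive (𝟙-sym (f i) (f j))))))
      drop : ∀ i j → when (does ((i Fin.<? j) ×-dec ¬? (i ~? j))) (g i j + g j i) ≈ when (does (i Fin.<? j)) (g i j + g j i)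
      drop i j with does (i Fin.<? j) | i ~? j
      ... | false | _       = refl
      ... | true  | no _    = refl
      ... | true  | yes i~j = sym (trans (sym (scaled-cross i j)) (trans (*-congʳ (reflexive off)) (zeroˡ _)))
        where
        off : 𝟙 (f i) (f j) ≡ 0#
        off rewrite dec-false (f i Fin.≟ f j) (f-proper i~j) = ≡.refl

    -- With B = X + Q, the all-ones part is at most κ P (X + Q). The nonedge weights contribute - κ
    -- P X, which cancels all but κ P Q.
    quad-upper : 0# ≤ P → ι w ≤ κ → z ∙ A · z ≤ (1# + κ * P) * (z ∙ z)
    quad-upper 0≤P w≤κ = begin
      z ∙ A · z
        ≈⟨ quad-A z ⟩
      (λ e → - (κ * P * (if mono e then 1# else 0#))) ∙ cross z + P * S + Q
        ≈⟨ +-congʳ (+-congʳ (trans (sum-cong-≋ (λ e → solve 3 (λ q b c → (:- (q :* b)) :* c := :- q :* (b :* c)) refl (κ * P) (if mono e then 1# else 0#) (cross z e)))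
             (sym (*-distribˡ-sum (- (κ * P)) (λ e → (if mono e then 1# else 0#) * cross z e))))) ⟩
      - (κ * P) * X + P * S + Q
        ≲⟨ ≤-offset (*-nonNeg 0≤P (+-nonNeg (0≤y-x S≤W[X+Q]) (*-nonNeg (0≤y-x w≤κ) 0≤X+Q)))
             (solve 6 (λ κ P X S Q W → (:- (κ :* P) :* X :+ P :* S :+ Q) :+ P :* ((W :* (X :+ Q) :- S) :+ (κ :- W) :* (X :+ Q))
               := (con (+ 1) :+ κ :* P) :* Q) refl κ P X S Q (ι w)) ⟩
      (1# + κ * P) * Q ∎
      where
      S = sum z * sum z
      Q = z ∙ z
      X = sum (λ e → (if mono e then 1# else 0#) * cross z e)
      0≤X+Q : 0# ≤ X + Q
      0≤X+Q = ≤-trans (∙-square-nonNeg s) (≤-reflexive (trans s∙s≈B (sym sum-cross)))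
      S≤W[X+Q] : S ≤ ι w * (X + Q)
      S≤W[X+Q] = ≤-trans [∑z]²≤wB (≤-reflexive (*-congˡ (sym sum-cross)))

subset-of-size : ∀ {n} (U : Subset n) k → k ℕ.≤ ∣ U ∣ → ∃[ V ] V ⊆ U × ∣ V ∣ ≡ k
subset-of-size []            zero    k≤ = [] , id , ≡.refl
subset-of-size (outside ∷ U) k       k≤ with subset-of-size U k k≤
... | V , V⊆U , eq = outside ∷ V , out⊆ V⊆U , eq
subset-of-size (inside  ∷ U) zero    k≤ with subset-of-size U zero ℕ.z≤n
... | V , V⊆U , eq = outside ∷ V , out⊆ V⊆U , eq
subset-of-size (inside  ∷ U) (suc k) (ℕ.s≤s k≤) with subset-of-size U k k≤
... | V , V⊆U , eq = inside ∷ V , s⊆s V⊆U , ≡.cong suc eq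

HasClique-downward : ∀ {n} (G : Graph n) {k w} → k ℕ.≤ w → HasClique G w → HasClique G k
HasClique-downward G {k} k≤w (U , ≡.refl , clique) with subset-of-size U k k≤w
... | V , V⊆U , eq = V , eq , λ i∈V j∈V → clique (V⊆U i∈V) (V⊆U j∈V)

-- Division-free estimates with reciprocals, `ε` and the logarithm

module Estimates (O : OrderedCommutativeRing) where
  open OrderedCommutativeRing O
  open OrderedRingProperties O
  open IntegerSolver commutativeRing
  open Naturals O
  open import Algebra.Properties.Semiring.Exp semiring using (^-congˡ)
  open ≤-Reasoning

  -- The reciprocal of a real is built from a proof of its positivity; this identifies the results
  -- of different proofs.
  inverse-unique : ∀ {x y z} → y * x ≈ 1# → z * x ≈ 1# → y ≈ z
  inverse-unique {x} {y} {z} yx≈1 zx≈1 = begin-equality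
    y             ≈⟨ trans (*-congˡ zx≈1) (*-identityʳ y) ⟨
    y * (z * x)   ≈⟨ solve 3 (λ x y z → y :* (z :* x) := z :* (y :* x)) refl x y z ⟩
    z * (y * x)   ≈⟨ trans (*-congˡ yx≈1) (*-identityʳ z) ⟩
    z             ∎

  ratio≤⇒≤ : ∀ {x y y⁻¹ c} → y⁻¹ * y ≈ 1# → 0# ≤ y → x * y⁻¹ ≤ c → x ≤ c * y
  ratio≤⇒≤ {x} {y} {y⁻¹} {c} inverse 0≤y h = begin
    x               ≈⟨ trans (*-congˡ inverse) (*-identityʳ x) ⟨
    x * (y⁻¹ * y)   ≈⟨ *-assoc x y⁻¹ y ⟨
    x * y⁻¹ * y     ≲⟨ *-monoʳ-≤ 0≤y h ⟩
    c * y           ∎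

  ≤⇒ratio≤ : ∀ {x y y⁻¹ c} → y⁻¹ * y ≈ 1# → 0# ≤ y⁻¹ → x ≤ c * y → x * y⁻¹ ≤ c
  ≤⇒ratio≤ {x} {y} {y⁻¹} {c} inverse 0≤y⁻¹ h = begin
    x * y⁻¹         ≲⟨ *-monoʳ-≤ 0≤y⁻¹ h ⟩
    c * y * y⁻¹     ≈⟨ solve 3 (λ c y y⁻¹ → c :* y :* y⁻¹ := c :* (y⁻¹ :* y)) refl c y y⁻¹ ⟩
    c * (y⁻¹ * y)   ≈⟨ trans (*-congˡ inverse) (*-identityʳ c) ⟩
    c               ∎

  -- P and E play p₀ and the upper bound on ε; the slack E P makes the final
  -- inequality strict.
  colouring-gap : ∀ {P E κ M N ε} → 0# ≤ P → 0# ≤ E → 0# ≤ κ → N ≤ M → ε ≤ E →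
    P * (1# + κ * N) ≈ 1# → E * ((1# + (1# + κ)) * (1# + (1# + κ * M))) ≈ 1# →
    (1# + κ * P) + E * P ≤ (1# - ε) * (P * (1# + κ) + 1#)
  colouring-gap {P} {E} {κ} {M} {N} {ε} 0≤P 0≤E 0≤κ N≤M ε≤E hP hE =
    ≤-offset
      (+-nonNeg (*-nonNeg (0≤y-x ε≤E) (+-nonNeg (*-nonNeg 0≤P 0≤k) 0≤1))
        (+-nonNeg (*-nonNeg 0≤E 0≤k) (*-nonNeg (*-nonNeg 0≤E (+-nonNeg 0≤1 0≤k)) (*-nonNeg (*-nonNeg 0≤P 0≤κ) (0≤y-x N≤M)))))
      (begin-equality
        -- The equations `hP` and `hE` enter as two added terms equal to zero, after which only a
        -- polynomial identity remains.
        L + d                              ≈⟨ solve 1 (λ x → x := x :+ con (+ 0) :+ con (+ 0)) refl (L + d) ⟩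
        L + d + 0# + 0#                    ≈⟨ +-cong (+-congˡ zero₁) zero₂ ⟨
        L + d + E * (1# + k) * (P * (1# + κ * N) - 1#) + P * (1# - E * ((1# + k) * (1# + (1# + κ * M))))
          ≈⟨ solve 6 (λ P E κ M N ε → let one = con (+ 1); k = one :+ κ in
               ((one :+ κ :* P) :+ E :* P)
               :+ ((E :- ε) :* (P :* k :+ one) :+ (E :* k :+ (E :* (one :+ k)) :* ((P :* κ) :* (M :- N))))
               :+ E :* (one :+ k) :* (P :* (one :+ κ :* N) :- one)
               :+ P :* (one :- E :* ((one :+ k) :* (one :+ (one :+ κ :* M))))
               := (one :- ε) :* (P :* k :+ one)) refl P E κ M N ε ⟩
        (1# - ε) * (P * k + 1#) ∎)
    where
    k = 1# + κ
    0≤k = +-nonNeg 0≤1 0≤κ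
    L = (1# + κ * P) + E * P
    d = (E - ε) * (P * k + 1#) + (E * k + (E * (1# + k)) * ((P * κ) * (M - N)))
    zero₁ : E * (1# + k) * (P * (1# + κ * N) - 1#) ≈ 0#
    zero₁ = trans (*-congˡ (trans (+-congʳ hP) (-‿inverseʳ 1#))) (zeroʳ _)
    zero₂ : P * (1# - E * ((1# + k) * (1# + (1# + κ * M)))) ≈ 0#
    zero₂ = trans (*-congˡ (trans (+-congˡ (-‿cong hE)) (-‿inverseʳ 1#))) (zeroʳ P)

  -- With `u` = 1/m, the number `s` is one approximant of the exponential of `ℓ`, and an error of 1
  -- is affordable: 2n/ε ≥ 2n ≥ n + 2 leaves s ≥ n + 1. As ℓ ≤ T ε, the base of `s` is at most 1 + T
  -- ε/m, and the Bernoulli estimate bounds the product with `(1# - ε) ^ T`.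
  exponential-decay : ∀ {u ε ε⁻¹ ℓ} m T n → 0# ≤ u → ι m * u ≈ 1# → 0# ≤ ε → ε ≤ 1# →
    0# ≤ ε⁻¹ → ε⁻¹ * ε ≈ 1# → ε⁻¹ * ℓ ≤ ι T → 0# ≤ ι m + ℓ → 2 ℕ.≤ n →
    ι (2 ℕ.* n) * ε⁻¹ ≤ (1# + ℓ * u) ^ m + 1# →
    ι (suc n) * (1# - ε) ^ T ≤ 1#
  exponential-decay {u} {ε} {ε⁻¹} {ℓ} m T n 0≤u mu≈1 0≤ε ε≤1 0≤ε⁻¹ inverse T-large m-large 2≤n R≤ = begin
    ι (suc n) * a ^ T                         ≲⟨ *-monoʳ-≤ (^-nonNeg T 0≤a) 1+n≤s ⟩
    s * a ^ T                                 ≈⟨ *-comm s (a ^ T) ⟩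
    a ^ T * s                                 ≲⟨ *-monoˡ-≤ (^-nonNeg T 0≤a) (^-mono-≤ m 0≤base base≤) ⟩
    a ^ T * (1# + ι T * v) ^ m                ≈⟨ *-congʳ (^-congˡ T a≈) ⟩
    (1# - ι m * v) ^ T * (1# + ι T * v) ^ m   ≲⟨ [1-mv]^t[1+tv]^m≤1 (*-nonNeg 0≤ε 0≤u) m T (≤-trans 0≤a (≤-reflexive a≈)) ⟩
    1#                                        ∎
    where
    a = 1# - ε
    v = ε * u
    s = (1# + ℓ * u) ^ m
    0≤a = 0≤y-x ε≤1
    a≈ : a ≈ 1# - ι m * v
    a≈ = +-congˡ (-‿cong (begin-equality
      ε               ≈⟨ trans (*-congˡ mu≈1) (*-identityʳ ε) ⟨
      ε * (ι m * u)   ≈⟨ solve 3 (λ ε m u → ε :* (m :* u) := m :* (ε :* u)) refl ε (ι m) u ⟩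
      ι m * (ε * u)   ∎))
    -- Raising to the power `m` is monotone only from a nonnegative base, and the sign of `ℓ` is not
    -- known here; hence the hypothesis that `m` dominates -ℓ.
    0≤base : 0# ≤ 1# + ℓ * u
    0≤base = ≤-trans (*-nonNeg m-large 0≤u) (≤-reflexive (trans (distribʳ u (ι m) ℓ) (+-congʳ mu≈1)))
    base≤ : 1# + ℓ * u ≤ 1# + ι T * v
    base≤ = +-mono-≤ ≤-refl (begin
      ℓ * u               ≈⟨ *-congʳ (trans (*-congʳ inverse) (*-identityˡ ℓ)) ⟨
      ε⁻¹ * ε * ℓ * u     ≈⟨ solve 4 (λ i ε l u → i :* ε :* l :* u := i :* l :* (ε :* u)) refl ε⁻¹ ε ℓ u ⟩
      ε⁻¹ * ℓ * (ε * u)   ≲⟨ *-monoʳ-≤ (*-nonNeg 0≤ε 0≤u) T-large ⟩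
      ι T * v             ∎)
    1≤ε⁻¹ : 1# ≤ ε⁻¹
    1≤ε⁻¹ = ≤-trans (≤-reflexive (sym inverse)) (≤-trans (*-monoˡ-≤ 0≤ε⁻¹ ε≤1) (≤-reflexive (*-identityʳ ε⁻¹)))
    2+n≤2n : 2 ℕ.+ n ℕ.≤ 2 ℕ.* n
    2+n≤2n = ℕ.≤-trans (ℕ.+-monoˡ-≤ n 2≤n) (ℕ.≤-reflexive (≡.cong (n ℕ.+_) (≡.sym (ℕ.+-identityʳ n))))
    2+n≤s+1 : ι (2 ℕ.+ n) ≤ s + 1#
    2+n≤s+1 = begin
      ι (2 ℕ.+ n)         ≲⟨ ι-mono-≤ 2+n≤2n ⟩
      ι (2 ℕ.* n)         ≈⟨ *-identityʳ _ ⟨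
      ι (2 ℕ.* n) * 1#    ≲⟨ *-monoˡ-≤ (ι-nonNeg (2 ℕ.* n)) 1≤ε⁻¹ ⟩
      ι (2 ℕ.* n) * ε⁻¹   ≲⟨ R≤ ⟩
      s + 1#              ∎
    1+n≤s : ι (suc n) ≤ s
    1+n≤s = ≤-offset (0≤y-x 2+n≤s+1)
      (solve 2 (λ x s → x :+ (s :+ con (+ 1) :- (con (+ 1) :+ x)) := s) refl (ι (suc n)) s)

-- Closure of subrings under matrix powers

module _ (O : OrderedCommutativeRing) where
  open OrderedCommutativeRing O

  -- Meant for the rational elements: rational weights give rational walk sums, which can be
  -- compared.
  module Subring (Q : Carrier → Set)
    (0∈ : Q 0#) (1∈ : Q 1#) (+∈ : ∀ {x y} → Q x → Q y → Q (x + y))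
    (*∈ : ∀ {x y} → Q x → Q y → Q (x * y)) (-∈ : ∀ {x} → Q x → Q (- x)) where
    open OrderedRingProperties O
    open LinearAlgebra O

    ι∈ : ∀ n → Q (ι n)
    ι∈ zero    = 0∈
    ι∈ (suc n) = +∈ 1∈ (ι∈ n)

    bit∈ : ∀ b → Q (if b then 1# else 0#)
    bit∈ true  = 1∈
    bit∈ false = 0∈

    sum∈ : ∀ {n} {x : Vector Carrier n} → (∀ i → Q (x i)) → Q (sum x)
    sum∈ {zero}  h = 0∈
    sum∈ {suc n} h = +∈ (h zero) (sum∈ (h ∘ suc))

    power∈ : ∀ {n} {A : Matrix n} → (∀ i j → Q (A i j)) → ∀ t {x} → (∀ i → Q (x i)) → ∀ i → Q (power A t x i)
    power∈ A∈ zero    x∈ i = x∈ i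
    power∈ A∈ (suc t) x∈ i = sum∈ (λ j → *∈ (A∈ i j) (power∈ A∈ t x∈ j))

    matrixPower∈ : ∀ {n} {A : Matrix n} → (∀ i j → Q (A i j)) → ∀ t i j → Q (matrixPower A t i j)
    matrixPower∈ A∈ t i j = power∈ A∈ t (λ l → bit∈ _) i

    module _ {n} (G : Graph n) {p : Vector Carrier (suc (#nonEdges G))} (p∈ : ∀ e → Q (p e)) where
      open WeightedGraph O G p

      A∈ : ∀ a b → Q (A a b)
      A∈ a b = +∈ (+∈ (sum∈ (λ e → *∈ (-∈ (p∈ (suc e))) (bit∈ _))) (*∈ (p∈ zero) 1∈)) (bit∈ _)

-- The reals

module RealOrder where
  open import Defs
  open CauchyClosure
  open ℚ-Solver.+-*-Solver using (solve; _:+_; _:*_; _:-_; :-_; _:=_; con)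
  open import Relation.Binary.PropositionalEquality.Core using (refl; sym; trans)

  Eventually : (ℕ → Set) → Set
  Eventually P = ∃[ N ] ∀ n → N ℕ.≤ n → P n

  eventually : ∀ {P} → (∀ n → P n) → Eventually P
  eventually p = 0 , λ n _ → p n

  eventually-zipWith : ∀ {P Q R : ℕ → Set} → (∀ n → P n → Q n → R n) → Eventually P → Eventually Q → Eventually R
  eventually-zipWith f (M , p) (N , q) = M ℕ.⊔ N , λ n h → f n (p n (ℕ.m⊔n≤o⇒m≤o M N h)) (q n (ℕ.m⊔n≤o⇒n≤o M N h))

  eventually-map : ∀ {P Q : ℕ → Set} → (∀ n → P n → Q n) → Eventually P → Eventually Q
  eventually-map f (N , p) = N , λ n h → f n (p n h)

  ℚ-offset : ∀ {p q d} → 0ℚ ℚ.≤ d → p ℚ.+ d ≡ q → p ℚ.≤ q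
  ℚ-offset {p} {q} {d} 0≤d p+d≡q = subst₂ ℚ._≤_ (ℚ.+-identityʳ p) p+d≡q (ℚ.+-monoʳ-≤ p 0≤d)

  ℚ-0≤q-p : ∀ {p q} → p ℚ.≤ q → 0ℚ ℚ.≤ q ℚ.- p
  ℚ-0≤q-p {p} {q} p≤q = subst (ℚ._≤ q ℚ.- p) (ℚ.+-inverseʳ p) (ℚ.+-monoˡ-≤ (ℚ.- p) p≤q)

  ℚ-+-nonNeg : ∀ {p q} → 0ℚ ℚ.≤ p → 0ℚ ℚ.≤ q → 0ℚ ℚ.≤ p ℚ.+ q
  ℚ-+-nonNeg 0≤p 0≤q = ℚ.+-mono-≤ 0≤p 0≤q

  ℚ-*-nonNeg : ∀ {p q} → 0ℚ ℚ.≤ p → 0ℚ ℚ.≤ q → 0ℚ ℚ.≤ p ℚ.* q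
  ℚ-*-nonNeg {p} {q} 0≤p 0≤q =
    subst (ℚ._≤ p ℚ.* q) (ℚ.*-zeroˡ q) (ℚ.*-monoʳ-≤-nonNeg q {{ℚ.nonNegative 0≤q}} 0≤p)

  ℚ-p≤∣p∣ : ∀ p → p ℚ.≤ ℚ.∣ p ∣
  ℚ-p≤∣p∣ p with ℚ.≤-total 0ℚ p
  ... | inj₁ 0≤p = ℚ.≤-reflexive (sym (ℚ.0≤p⇒∣p∣≡p 0≤p))
  ... | inj₂ p≤0 = ℚ.≤-trans p≤0 (ℚ.0≤∣p∣ p)

  ℚ-square-nonNeg : ∀ p → 0ℚ ℚ.≤ p ℚ.* p
  ℚ-square-nonNeg p with ℚ.≤-total 0ℚ p
  ... | inj₁ 0≤p = ℚ-*-nonNeg 0≤p 0≤p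
  ... | inj₂ p≤0 = subst (0ℚ ℚ.≤_) (solve 1 (λ p → (:- p) :* (:- p) := p :* p) refl p)
                     (ℚ-*-nonNeg (ℚ.neg-antimono-≤ p≤0) (ℚ.neg-antimono-≤ p≤0))

  ℚ-∣p-q∣-sym : ∀ p q → ℚ.∣ p ℚ.- q ∣ ≡ ℚ.∣ q ℚ.- p ∣
  ℚ-∣p-q∣-sym p q = trans (sym (ℚ.∣-p∣≡∣p∣ (p ℚ.- q))) (cong ℚ.∣_∣ (solve 2 (λ p q → :- (p :- q) := q :- p) refl p q))

  pointwise : ∀ {x y} → (∀ n → seq x n ≡ seq y n) → x ≈ y
  pointwise {x} {y} h ε ε>0 = eventually (λ n → subst (ℚ._< ε)
    (cong ℚ.∣_∣ (sym (trans (cong (ℚ._- seq y n) (h n)) (ℚ.+-inverseʳ (seq y n))))) ε>0)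

  ≈-refl : ∀ {x} → x ≈ x
  ≈-refl {x} = pointwise {x} {x} (λ _ → refl)

  ≈-sym : ∀ {x y} → x ≈ y → y ≈ x
  ≈-sym {x} {y} h ε ε>0 = eventually-map (λ n → subst (ℚ._< ε) (ℚ-∣p-q∣-sym (seq x n) (seq y n))) (h ε ε>0)

  ≈-trans : ∀ {x y z} → x ≈ y → y ≈ z → x ≈ z
  ≈-trans {x} {y} {z} x≈y y≈z ε ε>0 = eventually-zipWith step (x≈y _ (half-pos ε ε>0)) (y≈z _ (half-pos ε ε>0))
    where
    step : ∀ n → ℚ.∣ seq x n ℚ.- seq y n ∣ ℚ.< ε ℚ.* ½ → ℚ.∣ seq y n ℚ.- seq z n ∣ ℚ.< ε ℚ.* ½ →
           ℚ.∣ seq x n ℚ.- seq z n ∣ ℚ.< ε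
    step n p q = begin-strict
      ℚ.∣ a ℚ.- c ∣                     ≡⟨ cong ℚ.∣_∣ (solve 3 (λ a b c → a :- c := (a :- b) :+ (b :- c)) refl a b c) ⟩
      ℚ.∣ (a ℚ.- b) ℚ.+ (b ℚ.- c) ∣     ≤⟨ ℚ.∣p+q∣≤∣p∣+∣q∣ (a ℚ.- b) (b ℚ.- c) ⟩
      ℚ.∣ a ℚ.- b ∣ ℚ.+ ℚ.∣ b ℚ.- c ∣   <⟨ ℚ.+-mono-< p q ⟩
      ε ℚ.* ½ ℚ.+ ε ℚ.* ½               ≡⟨ halves ε ⟩
      ε                                 ∎
      where
      open ℚ.≤-Reasoning
      a = seq x n
      b = seq y n
      c = seq z n

  +-cong : ∀ {x y u v} → x ≈ y → u ≈ v → x + u ≈ y + v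
  +-cong {x} {y} {u} {v} x≈y u≈v ε ε>0 = eventually-zipWith step (x≈y _ (half-pos ε ε>0)) (u≈v _ (half-pos ε ε>0))
    where
    step : ∀ n → ℚ.∣ seq x n ℚ.- seq y n ∣ ℚ.< ε ℚ.* ½ → ℚ.∣ seq u n ℚ.- seq v n ∣ ℚ.< ε ℚ.* ½ →
           ℚ.∣ (seq x n ℚ.+ seq u n) ℚ.- (seq y n ℚ.+ seq v n) ∣ ℚ.< ε
    step n p q = begin-strict
      ℚ.∣ (a ℚ.+ c) ℚ.- (b ℚ.+ d) ∣     ≡⟨ cong ℚ.∣_∣ ([a+c]-[b+d] a b c d) ⟩
      ℚ.∣ (a ℚ.- b) ℚ.+ (c ℚ.- d) ∣     ≤⟨ ℚ.∣p+q∣≤∣p∣+∣q∣ (a ℚ.- b) (c ℚ.- d) ⟩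
      ℚ.∣ a ℚ.- b ∣ ℚ.+ ℚ.∣ c ℚ.- d ∣   <⟨ ℚ.+-mono-< p q ⟩
      ε ℚ.* ½ ℚ.+ ε ℚ.* ½               ≡⟨ halves ε ⟩
      ε                                 ∎
      where
      open ℚ.≤-Reasoning
      a = seq x n
      b = seq y n
      c = seq u n
      d = seq v n

  -‿cong : ∀ {x y} → x ≈ y → - x ≈ - y
  -‿cong {x} {y} h ε ε>0 = eventually-map (λ n → subst (ℚ._< ε)
    (trans (sym (ℚ.∣-p∣≡∣p∣ (seq x n ℚ.- seq y n))) (cong ℚ.∣_∣ (-[a-b] (seq x n) (seq y n))))) (h ε ε>0)

  *-cong : ∀ {x y u v} → x ≈ y → u ≈ v → x * u ≈ y * v
  *-cong {x} {y} {u} {v} x≈y u≈v ε ε>0 =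
    eventually-zipWith (λ n (p , q) (r , s) → subst (ℚ.∣ seq x n ℚ.* seq u n ℚ.- seq y n ℚ.* seq v n ∣ ℚ.<_) (halves ε)
           (product-close δ (seq x n) (seq y n) (seq u n) (seq v n) B C B>0 C>0 p r q s))
      (eventually-zipWith (λ _ → _,_) (x≈y _ (*-pos δ>0 (recip-pos C C>0))) (proj₁ (bounded u) , proj₂ (proj₂ (proj₂ (bounded u)))))
      (eventually-zipWith (λ _ → _,_) (u≈v _ (*-pos δ>0 (recip-pos B B>0))) (proj₁ (bounded y) , proj₂ (proj₂ (proj₂ (bounded y)))))
    where
    δ = ε ℚ.* ½
    δ>0 = half-pos ε ε>0
    B = proj₁ (proj₂ (bounded y))
    B>0 = proj₁ (proj₂ (proj₂ (bounded y)))
    C = proj₁ (proj₂ (bounded u))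
    C>0 = proj₁ (proj₂ (proj₂ (bounded u)))

  ≤-reflexive : ∀ {x y} → x ≈ y → x ≤ y
  ≤-reflexive {x} {y} h ε ε>0 = eventually-map step (h ε ε>0)
    where
    step : ∀ n → ℚ.∣ seq x n ℚ.- seq y n ∣ ℚ.< ε → seq x n ℚ.≤ seq y n ℚ.+ ε
    step n p = ℚ-offset (ℚ-0≤q-p (ℚ.≤-trans (ℚ-p≤∣p∣ (seq x n ℚ.- seq y n)) (ℚ.<⇒≤ p)))
      (solve 3 (λ a b e → a :+ (e :- (a :- b)) := b :+ e) refl (seq x n) (seq y n) ε)

  ≤-trans : ∀ {x y z} → x ≤ y → y ≤ z → x ≤ z
  ≤-trans {x} {y} {z} x≤y y≤z ε ε>0 = eventually-zipWith step (x≤y _ (half-pos ε ε>0)) (y≤z _ (half-pos ε ε>0))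
    where
    step : ∀ n → seq x n ℚ.≤ seq y n ℚ.+ ε ℚ.* ½ → seq y n ℚ.≤ seq z n ℚ.+ ε ℚ.* ½ → seq x n ℚ.≤ seq z n ℚ.+ ε
    step n p q = ℚ.≤-trans p (ℚ.≤-trans (ℚ.+-monoˡ-≤ (ε ℚ.* ½) q)
      (ℚ.≤-reflexive (trans (ℚ.+-assoc (seq z n) _ _) (cong (seq z n ℚ.+_) (halves ε)))))

  +-mono-≤ : ∀ {x y u v} → x ≤ y → u ≤ v → x + u ≤ y + v
  +-mono-≤ {x} {y} {u} {v} x≤y u≤v ε ε>0 = eventually-zipWith step (x≤y _ (half-pos ε ε>0)) (u≤v _ (half-pos ε ε>0))
    where
    step : ∀ n → seq x n ℚ.≤ seq y n ℚ.+ ε ℚ.* ½ → seq u n ℚ.≤ seq v n ℚ.+ ε ℚ.* ½ →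
           seq x n ℚ.+ seq u n ℚ.≤ seq y n ℚ.+ seq v n ℚ.+ ε
    step n p q = ℚ.≤-trans (ℚ.+-mono-≤ p q) (ℚ.≤-reflexive (trans
      (solve 3 (λ a b h → (a :+ h) :+ (b :+ h) := (a :+ b) :+ (h :+ h)) refl (seq y n) (seq v n) (ε ℚ.* ½))
      (cong (seq y n ℚ.+ seq v n ℚ.+_) (halves ε))))

  ⊓-pos : ∀ {p q} → 0ℚ ℚ.< p → 0ℚ ℚ.< q → 0ℚ ℚ.< p ℚ.⊓ q
  ⊓-pos {p} {q} p>0 q>0 =
    [ (λ eq → subst (0ℚ ℚ.<_) (sym eq) p>0) , (λ eq → subst (0ℚ ℚ.<_) (sym eq) q>0) ]′ (ℚ.⊓-sel p q)

  scale : ∀ {D ε} → 0ℚ ℚ.< D → 0ℚ ℚ.< ε → ∃[ δ ] 0ℚ ℚ.< δ × δ ℚ.≤ 1ℚ × δ ℚ.* D ℚ.≤ ε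
  scale {D} {ε} D>0 ε>0 = 1ℚ ℚ.⊓ η , ⊓-pos (ℚ.positive⁻¹ 1ℚ) (*-pos ε>0 (recip-pos D D>0)) , ℚ.p⊓q≤p 1ℚ η ,
    ℚ.≤-trans (ℚ.*-monoʳ-≤-nonNeg D {{ℚ.nonNegative (ℚ.<⇒≤ D>0)}} (ℚ.p⊓q≤q 1ℚ η))
      (ℚ.≤-reflexive (trans (ℚ.*-assoc ε _ D) (trans (cong (ε ℚ.*_) (recip-inverse D D>0)) (ℚ.*-identityʳ ε))))
    where η = ε ℚ.* recip D D>0

  -- The terms may be slightly negative, so the shifted terms are multiplied: (a + δ)(b + δ) ≥ 0
  -- gives ab ≥ -δ (a + b + δ), and with bounds B, C and δ ≤ 1 this is at least -δ (B + C + 1).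
  *-nonNeg : ∀ {x y} → 0ℝ ≤ x → 0ℝ ≤ y → 0ℝ ≤ x * y
  *-nonNeg {x} {y} 0≤x 0≤y ε ε>0 =
    eventually-zipWith (λ n (p , q) (r , s) → step (seq x n) (seq y n) p q r s)
      (eventually-zipWith (λ _ → _,_) (0≤x δ δ>0) (proj₁ (bounded x) , proj₂ (proj₂ (proj₂ (bounded x)))))
      (eventually-zipWith (λ _ → _,_) (0≤y δ δ>0) (proj₁ (bounded y) , proj₂ (proj₂ (proj₂ (bounded y)))))
    where
    B = proj₁ (proj₂ (bounded x))
    B>0 = proj₁ (proj₂ (proj₂ (bounded x)))
    C = proj₁ (proj₂ (bounded y))
    C>0 = proj₁ (proj₂ (proj₂ (bounded y)))
    D = B ℚ.+ C ℚ.+ 1ℚ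
    D>0 : 0ℚ ℚ.< D
    D>0 = ℚ.+-mono-< (ℚ.+-mono-< B>0 C>0) (ℚ.positive⁻¹ 1ℚ)
    δ = proj₁ (scale D>0 ε>0)
    δ>0 = proj₁ (proj₂ (scale D>0 ε>0))
    δ≤1 = proj₁ (proj₂ (proj₂ (scale D>0 ε>0)))
    δD≤ε = proj₂ (proj₂ (proj₂ (scale D>0 ε>0)))
    step : ∀ a b → 0ℚ ℚ.≤ a ℚ.+ δ → ℚ.∣ a ∣ ℚ.≤ B → 0ℚ ℚ.≤ b ℚ.+ δ → ℚ.∣ b ∣ ℚ.≤ C → 0ℚ ℚ.≤ a ℚ.* b ℚ.+ ε
    step a b 0≤a+δ a≤B 0≤b+δ b≤C = ℚ-offset
      (ℚ-+-nonNeg (ℚ-*-nonNeg 0≤a+δ 0≤b+δ) (ℚ-+-nonNeg (ℚ-0≤q-p δD≤ε) (ℚ-*-nonNeg (ℚ.<⇒≤ δ>0)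
        (ℚ-+-nonNeg (ℚ-0≤q-p (ℚ.≤-trans (ℚ-p≤∣p∣ a) a≤B)) (ℚ-+-nonNeg (ℚ-0≤q-p (ℚ.≤-trans (ℚ-p≤∣p∣ b) b≤C)) (ℚ-0≤q-p δ≤1))))))
      (solve 6 (λ a b B C d e → con 0ℚ :+ ((a :+ d) :* (b :+ d) :+ ((e :- d :* (B :+ C :+ con 1ℚ)) :+ d :* ((B :- a) :+ ((C :- b) :+ (con 1ℚ :- d)))))
        := a :* b :+ e) refl a b B C δ ε)

  square-nonNeg : ∀ x → 0ℝ ≤ x * x
  square-nonNeg x ε ε>0 = eventually (λ n → ℚ-+-nonNeg (ℚ-square-nonNeg (seq x n)) (ℚ.<⇒≤ ε>0))

  <⇒≤ : ∀ {x y} → x < y → x ≤ y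
  <⇒≤ {x} {y} (δ , δ>0 , h) ε ε>0 = eventually-map step h
    where
    step : ∀ n → seq x n ℚ.+ δ ℚ.≤ seq y n → seq x n ℚ.≤ seq y n ℚ.+ ε
    step n p = ℚ-offset (ℚ-+-nonNeg (ℚ-0≤q-p p) (ℚ-+-nonNeg (ℚ.<⇒≤ δ>0) (ℚ.<⇒≤ ε>0)))
      (solve 4 (λ a b d e → a :+ ((b :- (a :+ d)) :+ (d :+ e)) := b :+ e) refl (seq x n) (seq y n) δ ε)

  ≤-<-trans : ∀ {x y z} → x ≤ y → y < z → x < z
  ≤-<-trans {x} {y} {z} x≤y (δ , δ>0 , h) = δ ℚ.* ½ , half-pos δ δ>0 , eventually-zipWith step (x≤y _ (half-pos δ δ>0)) h
    where
    step : ∀ n → seq x n ℚ.≤ seq y n ℚ.+ δ ℚ.* ½ → seq y n ℚ.+ δ ℚ.≤ seq z n → seq x n ℚ.+ δ ℚ.* ½ ℚ.≤ seq z n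
    step n p q = ℚ.≤-trans (ℚ.+-monoˡ-≤ (δ ℚ.* ½) p) (ℚ.≤-trans
      (ℚ.≤-reflexive (trans (ℚ.+-assoc (seq y n) _ _) (cong (seq y n ℚ.+_) (halves δ)))) q)

  <-≤-trans : ∀ {x y z} → x < y → y ≤ z → x < z
  <-≤-trans {x} {y} {z} (δ , δ>0 , h) y≤z = δ ℚ.* ½ , half-pos δ δ>0 , eventually-zipWith step h (y≤z _ (half-pos δ δ>0))
    where
    step : ∀ n → seq x n ℚ.+ δ ℚ.≤ seq y n → seq y n ℚ.≤ seq z n ℚ.+ δ ℚ.* ½ → seq x n ℚ.+ δ ℚ.* ½ ℚ.≤ seq z n
    step n p q = ℚ-offset (ℚ-0≤q-p (ℚ.≤-trans p q)) (trans
      (cong (λ δ → seq x n ℚ.+ h′ ℚ.+ (seq z n ℚ.+ h′ ℚ.- (seq x n ℚ.+ δ))) (sym (halves δ)))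
      (solve 3 (λ a b h → a :+ h :+ (b :+ h :- (a :+ (h :+ h))) := b) refl (seq x n) (seq z n) h′))
      where h′ = δ ℚ.* ½

  -- The way back from the non-strict algebra to a strict inequality of reals; half of the gap
  -- absorbs the tolerance hidden in `_≤_`.
  gap⇒< : ∀ {x y g} → 0ℚ ℚ.< g → x + fromℚ g ≤ y → x < y
  gap⇒< {x} {y} {g} g>0 h = g ℚ.* ½ , half-pos g g>0 , eventually-map step (h _ (half-pos g g>0))
    where
    step : ∀ n → seq x n ℚ.+ g ℚ.≤ seq y n ℚ.+ g ℚ.* ½ → seq x n ℚ.+ g ℚ.* ½ ℚ.≤ seq y n
    step n p = ℚ-offset (ℚ-0≤q-p p) (trans
      (cong (λ g → seq x n ℚ.+ h′ ℚ.+ (seq y n ℚ.+ h′ ℚ.- (seq x n ℚ.+ g))) (sym (halves g)))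
      (solve 3 (λ a b h → a :+ h :+ (b :+ h :- (a :+ (h :+ h))) := b) refl (seq x n) (seq y n) h′))
      where h′ = g ℚ.* ½

  1≰0 : ¬ 1ℝ ≤ 0ℝ
  1≰0 h with h ½ (ℚ.positive⁻¹ ½)
  ... | N , p with p N ℕ.≤-refl
  -- The instance says 1 ≤ ½, which is 2 ≤ 1 after cross multiplication.
  ... | ℚ.*≤* (ℤ.+≤+ (ℕ.s≤s ()))

  fromℚ-mono-≤ : ∀ {p q} → p ℚ.≤ q → fromℚ p ≤ fromℚ q
  fromℚ-mono-≤ {p} {q} p≤q ε ε>0 = eventually (λ _ → ℚ.≤-trans p≤q (ℚ-offset (ℚ.<⇒≤ ε>0) refl))

  fromℚ-cancel-< : ∀ {q} → 0ℝ < fromℚ q → 0ℚ ℚ.< q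
  fromℚ-cancel-< {q} (δ , δ>0 , N , p) = ℚ.<-≤-trans δ>0 (subst (ℚ._≤ q) (ℚ.+-identityˡ δ) (p N ℕ.≤-refl))

  module _ (x : ℝ) (x>0 : 0ℝ < x) where
    private module R = Reciprocal x x>0

    ⁻¹-nonNeg : 0ℝ ≤ x ⁻¹[ x>0 ]
    ⁻¹-nonNeg ε ε>0 = eventually (λ n → ℚ.<⇒≤ (ℚ.+-mono-< (recip-pos (R.tail n) (R.tail>0 n)) ε>0))

    ⁻¹-inverse : x ⁻¹[ x>0 ] * x ≈ 1ℝ
    ⁻¹-inverse = ≈-trans {x ⁻¹[ x>0 ] * x} {x ⁻¹[ x>0 ] * shifted} {1ℝ}
      (*-cong {x ⁻¹[ x>0 ]} {x ⁻¹[ x>0 ]} {x} {shifted} (≈-refl {x ⁻¹[ x>0 ]}) x≈shifted)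
      (pointwise {x ⁻¹[ x>0 ] * shifted} {1ℝ} (λ n → recip-inverse (R.tail n) (R.tail>0 n)))
      where
      -- The reciprocal inverts the terms from a later index on, so the product is termwise 1 only
      -- against the equally shifted copy of `x`.
      shifted : ℝ
      shifted = mkℝ R.tail (λ ε ε>0 → let N , h = cauchy x ε ε>0 in
        N , λ m n N≤m N≤n → h (R.N ℕ.+ m) (R.N ℕ.+ n) (ℕ.≤-trans N≤m (ℕ.m≤n+m m R.N)) (ℕ.≤-trans N≤n (ℕ.m≤n+m n R.N)))
      x≈shifted : x ≈ shifted
      x≈shifted ε ε>0 = let N , h = cauchy x ε ε>0 in
        N , λ n N≤n → h n (R.N ℕ.+ n) N≤n (ℕ.≤-trans N≤n (ℕ.m≤n+m n R.N))

private
  module R = RealOrder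

-- Records, so that Agda can infer x and y: x ℝ.≈ y and x ℝ.≤ y themselves unfold
-- to statements about sequences.
infix 4 _≃_ _≼_

record _≃_ (x y : ℝ) : Set where
  constructor ⟪_⟫
  field ≃⇒≈ : x ℝ.≈ y

record _≼_ (x y : ℝ) : Set where
  constructor ⟪_⟫
  field ≼⇒≤ : x ℝ.≤ y

open _≃_ public
open _≼_ public

ℝ-isCommutativeRing : IsCommutativeRing _≃_ ℝ._+_ ℝ._*_ ℝ.-_ 0ℝ 1ℝ
ℝ-isCommutativeRing = record
  { isRing = record
    { +-isAbelianGroup = record
      { isGroup = record
        { isMonoid = record
          { isSemigroup = record
            { isMagma = record
              { isEquivalence = record
                { refl  = λ {x} → ⟪ R.≈-refl {x} ⟫
                ; sym   = λ {x} {y} p → ⟪ R.≈-sym {x} {y} (≃⇒≈ p) ⟫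
                ; trans = λ {x} {y} {z} p q → ⟪ R.≈-trans {x} {y} {z} (≃⇒≈ p) (≃⇒≈ q) ⟫
                }
              ; ∙-cong = λ {x} {y} {u} {v} p q → ⟪ R.+-cong {x} {y} {u} {v} (≃⇒≈ p) (≃⇒≈ q) ⟫
              }
            ; assoc = λ x y z → pw (λ n → ℚ.+-assoc (seq x n) (seq y n) (seq z n))
            }
          ; identity = (λ x → pw (λ n → ℚ.+-identityˡ (seq x n))) , (λ x → pw (λ n → ℚ.+-identityʳ (seq x n)))
          }
        ; inverse = (λ x → pw (λ n → ℚ.+-inverseˡ (seq x n))) , (λ x → pw (λ n → ℚ.+-inverseʳ (seq x n)))
        ; ⁻¹-cong = λ {x} {y} p → ⟪ R.-‿cong {x} {y} (≃⇒≈ p) ⟫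
        }
      ; comm = λ x y → pw (λ n → ℚ.+-comm (seq x n) (seq y n))
      }
    ; *-cong     = λ {x} {y} {u} {v} p q → ⟪ R.*-cong {x} {y} {u} {v} (≃⇒≈ p) (≃⇒≈ q) ⟫
    ; *-assoc    = λ x y z → pw (λ n → ℚ.*-assoc (seq x n) (seq y n) (seq z n))
    ; *-identity = (λ x → pw (λ n → ℚ.*-identityˡ (seq x n))) , (λ x → pw (λ n → ℚ.*-identityʳ (seq x n)))
    ; distrib    = (λ x y z → pw (λ n → ℚ.*-distribˡ-+ (seq x n) (seq y n) (seq z n)))
                 , (λ x y z → pw (λ n → ℚ.*-distribʳ-+ (seq x n) (seq y n) (seq z n)))
    }
  ; *-comm = λ x y → pw (λ n → ℚ.*-comm (seq x n) (seq y n))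
  }
  where
  pw : ∀ {x y} → (∀ n → seq x n ≡ seq y n) → x ≃ y
  pw {x} {y} h = ⟪ R.pointwise {x} {y} h ⟫

ℝ-ordered : OrderedCommutativeRing
ℝ-ordered = record
  { commutativeRing = record { isCommutativeRing = ℝ-isCommutativeRing }
  ; _≤_             = _≼_
  ; ≤-isPreorder    = record
    { isEquivalence = IsCommutativeRing.isEquivalence ℝ-isCommutativeRing
    ; reflexive     = λ {x} {y} p → ⟪ R.≤-reflexive {x} {y} (≃⇒≈ p) ⟫
    ; trans         = λ {x} {y} {z} p q → ⟪ R.≤-trans {x} {y} {z} (≼⇒≤ p) (≼⇒≤ q) ⟫
    }
  ; +-mono-≤        = λ {x} {y} {u} {v} p q → ⟪ R.+-mono-≤ {x} {y} {u} {v} (≼⇒≤ p) (≼⇒≤ q) ⟫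
  ; *-nonNeg        = λ {x} {y} p q → ⟪ R.*-nonNeg {x} {y} (≼⇒≤ p) (≼⇒≤ q) ⟫
  ; square-nonNeg   = λ x → ⟪ R.square-nonNeg x ⟫
  }

-- Naturals and rationals inside the reals

suc/1 : ∀ n → + suc n ℚ./ 1 ≡ 1ℚ ℚ.+ + n ℚ./ 1
suc/1 n = ℚ.toℚᵘ-injective (begin
  ℚ.toℚᵘ (+ suc n ℚ./ 1)           ≈⟨ ℚ.toℚᵘ-fromℚᵘ (mkℚᵘ (+ suc n) 0) ⟩
  mkℚᵘ (+ suc n) 0                 ≈⟨ *≡* (cong (ℤ._* + 1) (cong ℤ.suc (≡.sym (ℤ.*-identityʳ (+ n))))) ⟩
  ℚᵘ.1ℚᵘ ℚᵘ.+ mkℚᵘ (+ n) 0         ≈⟨ ℚᵘ.+-congʳ ℚᵘ.1ℚᵘ (ℚ.toℚᵘ-fromℚᵘ (mkℚᵘ (+ n) 0)) ⟨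
  ℚᵘ.1ℚᵘ ℚᵘ.+ ℚ.toℚᵘ (+ n ℚ./ 1)   ≈⟨ ℚ.toℚᵘ-homo-+ 1ℚ (+ n ℚ./ 1) ⟨
  ℚ.toℚᵘ (1ℚ ℚ.+ + n ℚ./ 1)        ∎)
  where open ℚᵘ.≃-Reasoning

1/d*d : ∀ d .{{_ : ℕ.NonZero d}} → (+ 1 ℚ./ d) ℚ.* (+ d ℚ./ 1) ≡ 1ℚ
1/d*d (suc d) = ℚ.toℚᵘ-injective (begin
  ℚ.toℚᵘ ((+ 1 ℚ./ suc d) ℚ.* (+ suc d ℚ./ 1))   ≈⟨ ℚ.toℚᵘ-homo-* (+ 1 ℚ./ suc d) (+ suc d ℚ./ 1) ⟩
  ℚ.toℚᵘ (+ 1 ℚ./ suc d) ℚᵘ.* ℚ.toℚᵘ (+ suc d ℚ./ 1)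
    ≈⟨ ℚᵘ.*-cong (ℚ.toℚᵘ-fromℚᵘ (mkℚᵘ (+ 1) d)) (ℚ.toℚᵘ-fromℚᵘ (mkℚᵘ (+ suc d) 0)) ⟩
  mkℚᵘ (+ 1) d ℚᵘ.* mkℚᵘ (+ suc d) 0
    ≈⟨ *≡* (≡.trans (ℤ.*-identityʳ _) (cong (λ m → + 1 ℤ.* + m) (≡.sym (ℕ.*-identityʳ (suc d))))) ⟩
  ℚᵘ.1ℚᵘ                                          ∎)
  where open ℚᵘ.≃-Reasoning

1/d-pos : ∀ d .{{_ : ℕ.NonZero d}} → 0ℚ ℚ.< + 1 ℚ./ d
1/d-pos d = ℚ.positive⁻¹ (+ 1 ℚ./ d) {{ℚ.normalize-pos 1 d}}

ℚ-archimedean : ∀ q → ∃[ m ] q ℚ.≤ + m ℚ./ 1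
ℚ-archimedean (ℚ.mkℚ i d _) = ℤ.∣ i ∣ , ℚ.toℚᵘ-cancel-≤ (ℚᵘ.≤-trans (bound (mkℚᵘ i d))
  (ℚᵘ.≤-reflexive (ℚᵘ.≃-sym (ℚ.toℚᵘ-fromℚᵘ (mkℚᵘ (+ ℤ.∣ i ∣) 0)))))
  where
  bound : ∀ u → u ℚᵘ.≤ mkℚᵘ (+ ℤ.∣ ℚᵘ.↥ u ∣) 0
  bound (mkℚᵘ (+ n) d)    = ℚᵘ.*≤* (subst₂ ℤ._≤_ (≡.sym (ℤ.*-identityʳ (+ n))) (ℤ.pos-* n (suc d)) (ℤ.+≤+ (ℕ.m≤m*n n (suc d))))
  bound (mkℚᵘ -[1+ n ] d) = ℚᵘ.*≤* (subst (ℤ._≤ + suc n ℤ.* + suc d) (≡.sym (ℤ.*-identityʳ -[1+ n ])) ℤ.-≤+)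

archimedean : ∀ x → ∃[ m ] 0ℝ ℝ.≤ fromℕ m ℝ.+ x
archimedean x =
  let N , B , _ , ∣x∣≤B = bounded x
      m , B≤m = ℚ-archimedean B
  in m , λ ε ε>0 → N , λ n N≤n → step m (seq x n) ε (ℚ.≤-trans (∣x∣≤B n N≤n) B≤m) ε>0
  where
  open ℚ-Solver.+-*-Solver using (solve; _:+_; _:-_; :-_; _:=_)
  step : ∀ m a ε → ℚ.∣ a ∣ ℚ.≤ + m ℚ./ 1 → 0ℚ ℚ.< ε → 0ℚ ℚ.≤ + m ℚ./ 1 ℚ.+ a ℚ.+ ε
  step m a ε ∣a∣≤m ε>0 = R.ℚ-+-nonNeg (subst (0ℚ ℚ.≤_) (solve 2 (λ p q → p :- (:- q) := p :+ q) ≡.refl (+ m ℚ./ 1) a)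
    (R.ℚ-0≤q-p (ℚ.≤-trans (R.ℚ-p≤∣p∣ (ℚ.- a)) (ℚ.≤-trans (ℚ.≤-reflexive (ℚ.∣-p∣≡∣p∣ a)) ∣a∣≤m))))
    (ℚ.<⇒≤ ε>0)

-- Passage between the reals and an abstract ordered ring

module _ (O : OrderedCommutativeRing) where
  open OrderedCommutativeRing O

  -- The reals are used only through an embedding into an abstract ordered ring:
  -- Agda compares such terms without unfolding Cauchy sequences.
  module Transfer
    (⟦_⟧        : ℝ → Carrier)
    (+-homo     : ∀ x y → ⟦ x ℝ.+ y ⟧ ≈ ⟦ x ⟧ + ⟦ y ⟧)
    (*-homo     : ∀ x y → ⟦ x ℝ.* y ⟧ ≈ ⟦ x ⟧ * ⟦ y ⟧)
    (-‿homo     : ∀ x → ⟦ ℝ.- x ⟧ ≈ - ⟦ x ⟧)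
    (0-homo     : ⟦ 0ℝ ⟧ ≈ 0#)
    (1-homo     : ⟦ 1ℝ ⟧ ≈ 1#)
    (≈-homo     : ∀ x y → x ℝ.≈ y → ⟦ x ⟧ ≈ ⟦ y ⟧)
    (≈-reflects : ∀ x y → ⟦ x ⟧ ≈ ⟦ y ⟧ → x ℝ.≈ y)
    (≤-homo     : ∀ x y → x ℝ.≤ y → ⟦ x ⟧ ≤ ⟦ y ⟧)
    (≤-reflects : ∀ x y → ⟦ x ⟧ ≤ ⟦ y ⟧ → x ℝ.≤ y)
    where
    open OrderedRingProperties O
    open LinearAlgebra O
    open Naturals O
    open Estimates O
    open Walks O
    open Sums O using (listSum)
    open import Algebra.Definitions.RawMonoid *-rawMonoid using () renaming (sum to product)
    open import Algebra.Properties.Semiring.Mult semiring using (×1-homo-*)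
    open import Algebra.Properties.Semiring.Exp semiring using (^-congˡ)
    open ≤-Reasoning

    private
      foldr-homo : (_∙ʳ_ : ℝ → ℝ → ℝ) (_∙ᶜ_ : Carrier → Carrier → Carrier) →
        (∀ x y → ⟦ x ∙ʳ y ⟧ ≈ (⟦ x ⟧ ∙ᶜ ⟦ y ⟧)) → (∀ {x y u v} → x ≈ y → u ≈ v → (x ∙ᶜ u) ≈ (y ∙ᶜ v)) →
        ∀ {z c} → ⟦ z ⟧ ≈ c → ∀ {n} (v : Vector ℝ n) {w : Vector Carrier n} → (∀ i → ⟦ v i ⟧ ≈ w i) →
        ⟦ Vector.foldr _∙ʳ_ z v ⟧ ≈ Vector.foldr _∙ᶜ_ c w
      foldr-homo _∙ʳ_ _∙ᶜ_ homo ∙-cong z≈c {zero}  v v≈w = z≈c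
      foldr-homo _∙ʳ_ _∙ᶜ_ homo ∙-cong z≈c {suc n} v v≈w =
        trans (homo _ _) (∙-cong (v≈w zero) (foldr-homo _∙ʳ_ _∙ᶜ_ homo ∙-cong z≈c (v ∘ suc) (v≈w ∘ suc)))

      list-foldr-homo : (_+ʳ_ : ℝ → ℝ → ℝ) → (∀ x y → ⟦ x +ʳ y ⟧ ≈ ⟦ x ⟧ + ⟦ y ⟧) → ∀ {z} → ⟦ z ⟧ ≈ 0# →
        ∀ {X : Set} (f : X → ℝ) {g : X → Carrier} → (∀ x → ⟦ f x ⟧ ≈ g x) → ∀ xs →
        ⟦ List.foldr _+ʳ_ z (List.map f xs) ⟧ ≈ listSum g xs
      list-foldr-homo _+ʳ_ homo z≈0 f f≈g []       = z≈0
      list-foldr-homo _+ʳ_ homo z≈0 f f≈g (x ∷ xs) =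
        trans (homo _ _) (+-cong (f≈g x) (list-foldr-homo _+ʳ_ homo z≈0 f f≈g xs))

      ×-homo : (M : RawMonoid 0ℓ 0ℓ) (⟦_⟧′ : RawMonoid.Carrier M → Carrier) →
        (∀ x y → ⟦ RawMonoid._∙_ M x y ⟧′ ≈ ⟦ x ⟧′ * ⟦ y ⟧′) → ⟦ RawMonoid.ε M ⟧′ ≈ 1# →
        ∀ x n → ⟦ RawMonoidOps._×_ M n x ⟧′ ≈ ⟦ x ⟧′ ^ n
      ×-homo M ⟦_⟧′ homo ε-homo x zero    = ε-homo
      ×-homo M ⟦_⟧′ homo ε-homo x (suc n) = trans (homo x _) (*-congˡ (×-homo M ⟦_⟧′ homo ε-homo x n))

      bit-homo : ∀ {x y} → ⟦ x ⟧ ≈ 1# → ⟦ y ⟧ ≈ 0# → ∀ b → ⟦ if b then x else y ⟧ ≈ (if b then 1# else 0#)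
      bit-homo x≈1 y≈0 true  = x≈1
      bit-homo x≈1 y≈0 false = y≈0

    sum-homo : ∀ {n} (v : Vector ℝ n) {w : Vector Carrier n} → (∀ i → ⟦ v i ⟧ ≈ w i) → ⟦ ℝ.sum v ⟧ ≈ sum w
    sum-homo v v≈w = foldr-homo ℝ._+_ _+_ +-homo +-cong {0ℝ} 0-homo v v≈w

    ^-homo : ∀ x n → ⟦ x ℝ.^ n ⟧ ≈ ⟦ x ⟧ ^ n
    ^-homo = ×-homo (RawRing.*-rawMonoid ℝ.ℝ-rawRing) ⟦_⟧ *-homo 1-homo

    seq-homo : ∀ x y → (∀ n → seq x n ≡ seq y n) → ⟦ x ⟧ ≈ ⟦ y ⟧
    seq-homo x y h = ≈-homo x y (R.pointwise {x} {y} h)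

    minus-homo : ∀ x y → ⟦ x ℝ.- y ⟧ ≈ ⟦ x ⟧ - ⟦ y ⟧
    minus-homo x y = trans (+-homo x (ℝ.- y)) (+-congˡ (-‿homo y))

    weight-homo : ∀ {n} {M : ℝ.Matrix n} {M′ : Matrix n} → (∀ a b → ⟦ M a b ⟧ ≈ M′ a b) →
                  ∀ {t} (v : Vec (Fin n) (suc t)) → ⟦ ℝ.weight M v ⟧ ≈ weight M′ v
    weight-homo h v = foldr-homo ℝ._*_ _*_ *-homo *-cong {1ℝ} 1-homo
      _ (λ m → h (lookup v (inject₁ m)) (lookup v (suc m)))

    ψᵈ-homo : ∀ {n} {M : ℝ.Matrix n} {M′ : Matrix n} → (∀ a b → ⟦ M a b ⟧ ≈ M′ a b) →
              ∀ t i → ⟦ ψᵈ t M i ⟧ ≈ matrixPower M′ t i i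
    ψᵈ-homo {M = M} {M′} h t i = trans
      (list-foldr-homo ℝ._+_ +-homo {0ℝ} 0-homo (ℝ.weight M) (weight-homo h) (walks t i i))
      (ψ≈matrixPower t M′ i i)

    module _ {n} (G : Graph n) (p : Vector ℝ (suc (#nonEdges G))) {p′ : Vector Carrier (suc (#nonEdges G))}
      (p≈p′ : ∀ e → ⟦ p e ⟧ ≈ p′ e) where
      open WeightedGraph O G p′ using (A; Yₑ)

      A-homo : ∀ a b → ⟦ A[ G , p ] a b ⟧ ≈ A a b
      A-homo a b = begin-equality
        ⟦ A[ G , p ] a b ⟧      ≈⟨ seq-homo (A[ G , p ] a b) (S ℝ.+ P ℝ.+ I) (λ _ → ≡.refl) ⟩
        ⟦ S ℝ.+ P ℝ.+ I ⟧       ≈⟨ +-homo (S ℝ.+ P) I ⟩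
        ⟦ S ℝ.+ P ⟧ + ⟦ I ⟧     ≈⟨ +-cong (+-homo S P) (bit-homo 1-homo 0-homo _) ⟩
        ⟦ S ⟧ + ⟦ P ⟧ + 𝟙 a b   ≈⟨ +-congʳ (+-cong (sum-homo v summand) (trans (*-homo (p zero) 1ℝ) (*-cong (p≈p′ zero) 1-homo))) ⟩
        A a b                   ∎
        where
        v : Vector ℝ (#nonEdges G)
        v e = (ℝ.- p (suc e)) ℝ.* ℝ.Y (nonEdge G e) a b
        S P I : ℝ
        S = ℝ.sum v
        P = p zero ℝ.* 1ℝ
        I = ℝ.I a b
        summand : ∀ e → ⟦ v e ⟧ ≈ - p′ (suc e) * Yₑ e a b
        summand e = trans (*-homo (ℝ.- p (suc e)) (ℝ.Y (nonEdge G e) a b))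
          (*-cong (trans (-‿homo (p (suc e))) (-‿cong (p≈p′ (suc e)))) (bit-homo 1-homo 0-homo _))

    fromℕ-homo : ∀ n → ⟦ fromℕ n ⟧ ≈ ι n
    fromℕ-homo zero    = trans (seq-homo (fromℕ 0) 0ℝ (λ _ → ≡.refl)) 0-homo
    fromℕ-homo (suc n) = trans (seq-homo (fromℕ (suc n)) (1ℝ ℝ.+ fromℕ n) (λ _ → suc/1 n))
      (trans (+-homo 1ℝ (fromℕ n)) (+-cong 1-homo (fromℕ-homo n)))

    fromℚ-* : ∀ p q → ⟦ fromℚ p ⟧ * ⟦ fromℚ q ⟧ ≈ ⟦ fromℚ (p ℚ.* q) ⟧
    fromℚ-* p q = trans (sym (*-homo (fromℚ p) (fromℚ q))) (seq-homo (fromℚ p ℝ.* fromℚ q) (fromℚ (p ℚ.* q)) (λ _ → ≡.refl))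

    1/d-homo : ∀ d .{{_ : ℕ.NonZero d}} → ⟦ fromℚ (+ 1 ℚ./ d) ⟧ * ι d ≈ 1#
    1/d-homo d = trans (*-congˡ (sym (fromℕ-homo d)))
      (trans (fromℚ-* (+ 1 ℚ./ d) (+ d ℚ./ 1)) (trans (reflexive (cong (λ r → ⟦ fromℚ r ⟧) (1/d*d d))) 1-homo))

    nonNeg-homo : ∀ x → 0ℝ ℝ.≤ x → 0# ≤ ⟦ x ⟧
    nonNeg-homo x 0≤x = ≤-trans (≤-reflexive (sym 0-homo)) (≤-homo 0ℝ x 0≤x)

    fromℚ-nonNeg : ∀ q → 0ℚ ℚ.< q → 0# ≤ ⟦ fromℚ q ⟧
    fromℚ-nonNeg q q>0 = nonNeg-homo (fromℚ q) (R.fromℚ-mono-≤ {0ℚ} {q} (ℚ.<⇒≤ q>0))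

    ⁻¹-homo : ∀ x (x>0 : 0ℝ ℝ.< x) → ⟦ x ⁻¹[ x>0 ] ⟧ * ⟦ x ⟧ ≈ 1#
    ⁻¹-homo x x>0 = trans (sym (*-homo (x ⁻¹[ x>0 ]) x))
      (trans (≈-homo (x ⁻¹[ x>0 ] ℝ.* x) 1ℝ (R.⁻¹-inverse x x>0)) 1-homo)

    ⁻¹-nonNeg : ∀ x (x>0 : 0ℝ ℝ.< x) → 0# ≤ ⟦ x ⁻¹[ x>0 ] ⟧
    ⁻¹-nonNeg x x>0 = nonNeg-homo (x ⁻¹[ x>0 ]) (R.⁻¹-nonNeg x x>0)

    1≤⇒0< : ∀ x → 1# ≤ ⟦ x ⟧ → 0ℝ ℝ.< x
    1≤⇒0< x 1≤x = R.gap⇒< {0ℝ} {x} {1ℚ} (ℚ.positive⁻¹ 1ℚ) (≤-reflects 1ℝ x (≤-trans (≤-reflexive 1-homo) 1≤x))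

    -- Membership up to `_≈_`: a Cauchy sequence need not be constant to represent a rational, and
    -- the order is total on such elements.
    Rational : Carrier → Set
    Rational c = ∃[ q ] c ≈ ⟦ fromℚ q ⟧

    Rational-resp : ∀ {x y} → x ≈ y → Rational y → Rational x
    Rational-resp x≈y (q , y≈q) = q , trans x≈y y≈q

    Rational-0 : Rational 0#
    Rational-0 = 0ℚ , sym 0-homo

    Rational-1 : Rational 1#
    Rational-1 = 1ℚ , sym 1-homo

    Rational-+ : ∀ {x y} → Rational x → Rational y → Rational (x + y)
    Rational-+ (p , x≈p) (q , y≈q) = p ℚ.+ q , trans (+-cong x≈p y≈q)
      (trans (sym (+-homo (fromℚ p) (fromℚ q))) (seq-homo (fromℚ p ℝ.+ fromℚ q) (fromℚ (p ℚ.+ q)) (λ _ → ≡.refl)))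

    Rational-* : ∀ {x y} → Rational x → Rational y → Rational (x * y)
    Rational-* (p , x≈p) (q , y≈q) = p ℚ.* q , trans (*-cong x≈p y≈q) (fromℚ-* p q)

    Rational-neg : ∀ {x} → Rational x → Rational (- x)
    Rational-neg (p , x≈p) = ℚ.- p , trans (-‿cong x≈p)
      (trans (sym (-‿homo (fromℚ p))) (seq-homo (ℝ.- fromℚ p) (fromℚ (ℚ.- p)) (λ _ → ≡.refl)))

    Rational-⁻¹ : ∀ x (x>0 : 0ℝ ℝ.< x) → Rational ⟦ x ⟧ → Rational ⟦ x ⁻¹[ x>0 ] ⟧
    Rational-⁻¹ x x>0 (q , x≈q) = recip q q>0 , inverse-unique (⁻¹-homo x x>0) (begin-equality
      ⟦ fromℚ (recip q q>0) ⟧ * ⟦ x ⟧         ≈⟨ *-congˡ x≈q ⟩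
      ⟦ fromℚ (recip q q>0) ⟧ * ⟦ fromℚ q ⟧   ≈⟨ fromℚ-* (recip q q>0) q ⟩
      ⟦ fromℚ (recip q q>0 ℚ.* q) ⟧           ≡⟨ cong (λ r → ⟦ fromℚ r ⟧) (recip-inverse q q>0) ⟩
      ⟦ 1ℝ ⟧                                  ≈⟨ 1-homo ⟩
      1#                                      ∎)
      where
      q>0 : 0ℚ ℚ.< q
      q>0 = R.fromℚ-cancel-< {q} (R.<-≤-trans {0ℝ} {x} {fromℚ q} x>0 (≤-reflects x (fromℚ q) (≤-reflexive x≈q)))

    Rational-total : ∀ {x y} → Rational x → Rational y → x ≤ y ⊎ y ≤ x
    Rational-total (p , x≈p) (q , y≈q) = Sum.map (transport x≈p y≈q) (transport y≈q x≈p) (ℚ.≤-total p q)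
      where
      transport : ∀ {x y p q} → x ≈ ⟦ fromℚ p ⟧ → y ≈ ⟦ fromℚ q ⟧ → p ℚ.≤ q → x ≤ y
      transport {p = p} {q} x≈p y≈q p≤q = ≤-trans (≤-reflexive x≈p)
        (≤-trans (≤-homo (fromℚ p) (fromℚ q) (R.fromℚ-mono-≤ {p} {q} p≤q)) (≤-reflexive (sym y≈q)))

    -- Selecting an index means deciding between two values, which rationality permits.
    argmax : ∀ {n} → 1 ℕ.≤ n → (r : Fin n → Carrier) → (∀ i → Rational (r i)) → ∃[ i ] ∀ j → r j ≤ r i
    argmax {suc zero}    _ r r∈ = zero , λ { zero → ≤-refl }
    argmax {suc (suc n)} _ r r∈ with argmax (ℕ.s≤s ℕ.z≤n) (r ∘ suc) (r∈ ∘ suc)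
    ... | i , h with Rational-total (r∈ zero) (r∈ (suc i))
    ...   | inj₁ r₀≤ = suc i , λ { zero → r₀≤ ; (suc j) → h j }
    ...   | inj₂ ≤r₀ = zero  , λ { zero → ≤-refl ; (suc j) → ≤-trans (h j) ≤r₀ }

    open Subring O Rational Rational-0 Rational-1 Rational-+ Rational-* Rational-neg

    -- The two implications

    module Equivalence {n} (G : Graph n) (k : ℕ) (2≤k : 2 ℕ.≤ k) (k≤n : k ℕ.≤ n) (ε : ℝ) (ε>0 : 0ℝ ℝ.< ε)
      (ε≤ : ε ℝ.≤ fromℚ (+ 1 ℚ./ (suc k ℕ.* (2 ℕ.+ (k ℕ.∸ 1) ℕ.* n ℕ.* (n ℕ.∸ 1))))) (T : ℕ) where
      private
        D : ℕ
        D = suc k ℕ.* (2 ℕ.+ (k ℕ.∸ 1) ℕ.* n ℕ.* (n ℕ.∸ 1))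
        e : ℚ
        e = + 1 ℚ./ D
        E κ M : Carrier
        E = ⟦ fromℚ e ⟧
        κ = ι (k ℕ.∸ 1)
        M = ι (n ℕ.* (n ℕ.∸ 1))

        0≤κ : 0# ≤ κ
        0≤κ = ι-nonNeg (k ℕ.∸ 1)

        1≤k : 1 ℕ.≤ k
        1≤k = ℕ.≤-trans (ℕ.s≤s ℕ.z≤n) 2≤k

        ιk≈1+κ : ι k ≈ 1# + κ
        ιk≈1+κ = reflexive (cong ι (≡.sym (ℕ.m+[n∸m]≡n 1≤k)))

        E-inverse : E * ι D ≈ 1#
        E-inverse = 1/d-homo D

        D-expand : ι D ≈ (1# + (1# + κ)) * (1# + (1# + κ * M))
        D-expand = begin-equality
          ι D
            ≈⟨ ×1-homo-* (suc k) (2 ℕ.+ (k ℕ.∸ 1) ℕ.* n ℕ.* (n ℕ.∸ 1)) ⟩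
          ι (suc k) * ι (2 ℕ.+ (k ℕ.∸ 1) ℕ.* n ℕ.* (n ℕ.∸ 1))
            ≈⟨ *-cong (+-congˡ ιk≈1+κ) (+-congˡ (+-congˡ (trans (reflexive (cong ι (ℕ.*-assoc (k ℕ.∸ 1) n (n ℕ.∸ 1)))) (×1-homo-* (k ℕ.∸ 1) (n ℕ.* (n ℕ.∸ 1)))))) ⟩
          (1# + (1# + κ)) * (1# + (1# + κ * M)) ∎

        ε≤E : ⟦ ε ⟧ ≤ E
        ε≤E = ≤-homo ε (fromℚ e) ε≤

        0≤E : 0# ≤ E
        0≤E = fromℚ-nonNeg e (1/d-pos D)

        ε≤1 : ⟦ ε ⟧ ≤ 1#
        ε≤1 = begin
          ⟦ ε ⟧     ≲⟨ ε≤E ⟩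
          E         ≈⟨ trans (*-congˡ (+-identityʳ 1#)) (*-identityʳ E) ⟨
          E * ι 1   ≲⟨ *-monoˡ-≤ 0≤E (ι-mono-≤ {1} {D} (ℕ.s≤s ℕ.z≤n)) ⟩
          E * ι D   ≈⟨ E-inverse ⟩
          1#        ∎

        2T≡T+T : 2 ℕ.* T ≡ T ℕ.+ T
        2T≡T+T = cong (T ℕ.+_) (ℕ.+-identityʳ T)

        2T+1≡1+T+T : 2 ℕ.* T ℕ.+ 1 ≡ suc (T ℕ.+ T)
        2T+1≡1+T+T = ≡.trans (ℕ.+-comm (2 ℕ.* T) 1) (cong suc 2T≡T+T)

      threshold : Vector ℝ (suc (#nonEdges G)) → ℝ
      threshold p = (1ℝ ℝ.- ε) ℝ.* (p zero ℝ.* fromℕ k ℝ.+ 1ℝ)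

      ψ₀ ψ₁ : Vector ℝ (suc (#nonEdges G)) → Fin n → ℝ
      ψ₀ p = ψᵈ (2 ℕ.* T) A[ G , p ]
      ψ₁ p = ψᵈ (2 ℕ.* T ℕ.+ 1) A[ G , p ]

      ratio : ∀ p i → 0ℝ ℝ.< ψ₀ p i → ℝ
      ratio p i pos = ψ₁ p i ℝ.* ψ₀ p i ⁻¹[ pos ]

      ratio-homo : ∀ p i pos → ⟦ ratio p i pos ⟧ ≈ ⟦ ψ₁ p i ⟧ * ⟦ ψ₀ p i ⁻¹[ pos ] ⟧
      ratio-homo p i pos = *-homo (ψ₁ p i) (ψ₀ p i ⁻¹[ pos ])

      Certificate : Vector ℝ (suc (#nonEdges G)) → Set
      Certificate p = ∃[ μ ] IsMaximum (λ i → 0ℝ ℝ.< ψ₀ p i) (ratio p) μ × μ ℝ.< threshold p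

      private
        module _ (p : Vector ℝ (suc (#nonEdges G))) {p′ : Vector Carrier (suc (#nonEdges G))}
          (p≈p′ : ∀ e → ⟦ p e ⟧ ≈ p′ e) where
          open WeightedGraph O G p′ using (A; 1≤matrixPower-diagonal)

          ψ₀-homo : ∀ i → ⟦ ψ₀ p i ⟧ ≈ matrixPower A (T ℕ.+ T) i i
          ψ₀-homo i = trans (ψᵈ-homo (A-homo G p p≈p′) (2 ℕ.* T) i) (reflexive (cong (λ t → matrixPower A t i i) 2T≡T+T))

          ψ₁-homo : ∀ i → ⟦ ψ₁ p i ⟧ ≈ matrixPower A (suc (T ℕ.+ T)) i i
          ψ₁-homo i = trans (ψᵈ-homo (A-homo G p p≈p′) (2 ℕ.* T ℕ.+ 1) i) (reflexive (cong (λ t → matrixPower A t i i) 2T+1≡1+T+T))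

          threshold-homo : ⟦ threshold p ⟧ ≈ (1# - ⟦ ε ⟧) * (p′ zero * ι k + 1#)
          threshold-homo = trans (*-homo (1ℝ ℝ.- ε) (p zero ℝ.* fromℕ k ℝ.+ 1ℝ)) (*-cong
            (trans (minus-homo 1ℝ ε) (+-congʳ 1-homo))
            (trans (+-homo (p zero ℝ.* fromℕ k) 1ℝ) (+-cong
              (trans (*-homo (p zero) (fromℕ k)) (*-cong (p≈p′ zero) (fromℕ-homo k))) 1-homo)))

          module _ (0≤p′ : ∀ e → 0# ≤ p′ e) (∑p′≈1 : sum p′ ≈ 1#) where

            1≤ψ₀ : ∀ i → 1# ≤ ⟦ ψ₀ p i ⟧
            1≤ψ₀ i = ≤-trans (1≤matrixPower-diagonal 0≤p′ ∑p′≈1 (T ℕ.+ T) i) (≤-reflexive (sym (ψ₀-homo i)))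

            ψ₀>0 : ∀ i → 0ℝ ℝ.< ψ₀ p i
            ψ₀>0 i = 1≤⇒0< (ψ₀ p i) (1≤ψ₀ i)

      module _ (ℓ : ℝ) (isLn : IsLn (fromℕ (2 ℕ.* n) ℝ.* ε ⁻¹[ ε>0 ]) ℓ) (T-large : ε ⁻¹[ ε>0 ] ℝ.* ℓ ℝ.≤ fromℕ T) where

        private
          R≤s+1 : ∀ X m → X ℝ.- fromℚ 1ℚ ℝ.< (1ℝ ℝ.+ ℓ ℝ.* fromℚ (+ 1 ℚ./ suc m)) ℝ.^ suc m →
            ⟦ X ⟧ ≤ (1# + ⟦ ℓ ⟧ * ⟦ fromℚ (+ 1 ℚ./ suc m) ⟧) ^ suc m + 1#
          R≤s+1 X m X-1<s = ≤-offset (0≤y-x (begin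
            ⟦ X ⟧ - 1#                                         ≈⟨ trans (minus-homo X (fromℚ 1ℚ)) (+-congˡ (-‿cong 1-homo)) ⟨
            ⟦ X ℝ.- fromℚ 1ℚ ⟧                                 ≲⟨ ≤-homo (X ℝ.- fromℚ 1ℚ) (base ℝ.^ suc m) (R.<⇒≤ {X ℝ.- fromℚ 1ℚ} {base ℝ.^ suc m} X-1<s) ⟩
            ⟦ base ℝ.^ suc m ⟧                                 ≈⟨ ^-homo base (suc m) ⟩
            ⟦ base ⟧ ^ suc m                                   ≈⟨ ^-congˡ (suc m) (trans (+-homo 1ℝ (ℓ ℝ.* fromℚ (+ 1 ℚ./ suc m))) (+-cong 1-homo (*-homo ℓ (fromℚ (+ 1 ℚ./ suc m))))) ⟩
            (1# + ⟦ ℓ ⟧ * ⟦ fromℚ (+ 1 ℚ./ suc m) ⟧) ^ suc m   ∎))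
            (move ⟦ X ⟧ _)
            where
            base : ℝ
            base = 1ℝ ℝ.+ ℓ ℝ.* fromℚ (+ 1 ℚ./ suc m)
            open IntegerSolver commutativeRing
            move : ∀ x y → x + (y - (x - 1#)) ≈ y + 1#
            move = solve 2 (λ x y → x :+ (y :- (x :- con (+ 1))) := y :+ con (+ 1)) refl

        decay : ι (suc n) * (1# - ⟦ ε ⟧) ^ T ≤ 1#
        decay = exponential-decay (suc m) T n (fromℚ-nonNeg (+ 1 ℚ./ suc m) (1/d-pos (suc m)))
          (trans (*-comm _ _) (1/d-homo (suc m))) (nonNeg-homo ε (R.<⇒≤ {0ℝ} {ε} ε>0)) ε≤1
          (⁻¹-nonNeg ε ε>0) (⁻¹-homo ε ε>0)
          (≤-trans (≤-reflexive (sym (*-homo (ε ⁻¹[ ε>0 ]) ℓ))) (≤-trans (≤-homo (ε ⁻¹[ ε>0 ] ℝ.* ℓ) (fromℕ T) T-large) (≤-reflexive (fromℕ-homo T))))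
          (begin
            0#                   ≲⟨ nonNeg-homo (fromℕ M₀ ℝ.+ ℓ) (proj₂ (archimedean ℓ)) ⟩
            ⟦ fromℕ M₀ ℝ.+ ℓ ⟧   ≈⟨ trans (+-homo (fromℕ M₀) ℓ) (+-congʳ (fromℕ-homo M₀)) ⟩
            ι M₀ + ⟦ ℓ ⟧         ≲⟨ +-mono-≤ (ι-mono-≤ (ℕ.m≤n⇒m≤1+n (ℕ.m≤n⊔m N₀ M₀))) ≤-refl ⟩
            ι (suc m) + ⟦ ℓ ⟧    ∎)
          (ℕ.≤-trans 2≤k k≤n)
          (≤-trans (≤-reflexive (sym (trans (*-homo (fromℕ (2 ℕ.* n)) (ε ⁻¹[ ε>0 ])) (*-congʳ (fromℕ-homo (2 ℕ.* n))))))
            (R≤s+1 (fromℕ (2 ℕ.* n) ℝ.* ε ⁻¹[ ε>0 ]) m (proj₁ (proj₂ (isLn 1ℚ (ℚ.positive⁻¹ 1ℚ)) m (ℕ.m≤m⊔n N₀ M₀)))))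
          where
          N₀ M₀ m : ℕ
          N₀ = proj₁ (isLn 1ℚ (ℚ.positive⁻¹ 1ℚ))
          M₀ = proj₁ (archimedean ℓ)
          -- `N₀` brings the approximant within 1 of 2n/ε, and `M₀` makes its base nonnegative.
          m  = N₀ ℕ.⊔ M₀

        no-clique : ∀ p → Δ (suc (#nonEdges G)) p → Certificate p → ¬ HasClique G k
        no-clique p (0≤p , ∑p≈1) (μ , (_ , f≤μ) , μ<threshold) (U , ∣U∣≡k , clique) =
          R.1≰0 (≤-reflects 1ℝ 0ℝ (≤-trans (≤-reflexive 1-homo) (≤-trans 1≤0 (≤-reflexive (sym 0-homo)))))
          where
          p′ : Vector Carrier (suc (#nonEdges G))
          p′ i = ⟦ p i ⟧
          p≈p′ : ∀ i → ⟦ p i ⟧ ≈ p′ i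
          p≈p′ i = refl
          open WeightedGraph O G p′ using (A)
          open CliqueBound O G p′ using (clique-obstruction)
          0≤p′ : ∀ i → 0# ≤ p′ i
          0≤p′ i = nonNeg-homo (p i) (0≤p i)
          ∑p′≈1 : sum p′ ≈ 1#
          ∑p′≈1 = trans (sym (sum-homo p p≈p′)) (trans (≈-homo (ℝ.sum p) 1ℝ ∑p≈1) 1-homo)
          a : Carrier
          a = 1# - ⟦ ε ⟧
          pos : ∀ i → 0ℝ ℝ.< ψ₀ p i
          pos = ψ₀>0 p p≈p′ 0≤p′ ∑p′≈1
          ratio≤μ : ∀ i → ⟦ ψ₁ p i ⟧ * ⟦ ψ₀ p i ⁻¹[ pos i ] ⟧ ≤ ⟦ μ ⟧
          ratio≤μ i = ≤-trans (≤-reflexive (sym (ratio-homo p i (pos i)))) (≤-homo (ratio p i (pos i)) μ (f≤μ i (pos i)))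
          -- Any vertex will do: its nonnegative ratio shows that `μ` is nonnegative.
          i₀ : Fin n
          i₀ = Fin.fromℕ< (ℕ.≤-trans 1≤k k≤n)
          0≤ψ₁ : ∀ i → 0# ≤ ⟦ ψ₁ p i ⟧
          0≤ψ₁ i = ≤-trans 0≤1 (≤-trans (WeightedGraph.1≤matrixPower-diagonal O G p′ 0≤p′ ∑p′≈1 (suc (T ℕ.+ T)) i) (≤-reflexive (sym (ψ₁-homo p p≈p′ i))))
          0≤μ : 0# ≤ ⟦ μ ⟧
          0≤μ = ≤-trans (*-nonNeg (0≤ψ₁ i₀) (⁻¹-nonNeg (ψ₀ p i₀) (pos i₀))) (ratio≤μ i₀)
          -- Cancelling in `moment-upper` calls for an inverse of the threshold. Its positivity is
          -- read off from 0 ≤ μ < threshold.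
          threshold>0 : 0ℝ ℝ.< threshold p
          threshold>0 = R.≤-<-trans {0ℝ} {μ} {threshold p} (≤-reflects 0ℝ μ (≤-trans (≤-reflexive 0-homo) 0≤μ)) μ<threshold
          ν : Carrier
          ν = a * (p′ zero * ι ∣ U ∣ + 1#)
          threshold≈ν : ⟦ threshold p ⟧ ≈ ν
          threshold≈ν = trans (threshold-homo p p≈p′) (*-congˡ (+-congʳ (*-congˡ (reflexive (cong ι (≡.sym ∣U∣≡k))))))
          ν⁻¹ : Carrier
          ν⁻¹ = ⟦ threshold p ⁻¹[ threshold>0 ] ⟧
          μ≤ν : ⟦ μ ⟧ ≤ ν
          μ≤ν = ≤-trans (≤-homo μ (threshold p) (R.<⇒≤ {μ} {threshold p} μ<threshold)) (≤-reflexive threshold≈ν)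
          step : ∀ i → matrixPower A (suc (T ℕ.+ T)) i i ≤ ν * matrixPower A (T ℕ.+ T) i i
          step i = begin
            matrixPower A (suc (T ℕ.+ T)) i i   ≈⟨ ψ₁-homo p p≈p′ i ⟨
            ⟦ ψ₁ p i ⟧                          ≲⟨ ratio≤⇒≤ (⁻¹-homo (ψ₀ p i) (pos i)) (≤-trans 0≤1 (1≤ψ₀ p p≈p′ 0≤p′ ∑p′≈1 i)) (≤-trans (ratio≤μ i) μ≤ν) ⟩
            ν * ⟦ ψ₀ p i ⟧                      ≈⟨ *-congˡ (ψ₀-homo p p≈p′ i) ⟩
            ν * matrixPower A (T ℕ.+ T) i i     ∎
          1≤0 : 1# ≤ 0#
          1≤0 = clique-obstruction U clique 0≤p′ ∑p′≈1 (subst (1 ℕ.≤_) (≡.sym ∣U∣≡k) 1≤k) T (0≤y-x ε≤1)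
            (≤-offset (nonNeg-homo ε (R.<⇒≤ {0ℝ} {ε} ε>0)) (1-x+x ⟦ ε ⟧)) decay
            (⁻¹-nonNeg (threshold p) threshold>0)
            (trans (*-congˡ (sym threshold≈ν)) (⁻¹-homo (threshold p) threshold>0)) step
            where
            open IntegerSolver commutativeRing
            1-x+x : ∀ x → 1# - x + x ≈ 1#
            1-x+x = solve 1 (λ x → con (+ 1) :- x :+ x := con (+ 1)) refl

      module _ {w} (f : Fin n → Fin w) (f-proper : ∀ {i j} → Graph._~_ G i j → f i ≢ f j) (w≤k-1 : w ℕ.≤ k ℕ.∸ 1) where
        private
          N : ℕ
          N = count (λ i → does (f (proj₁ (nonEdge G i)) Fin.≟ f (proj₂ (nonEdge G i))))
          -- The number of equal shares of the total weight: one for the all-ones matrix and `k` - 1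
          -- for each monochromatic nonedge. So `P` = 1/d normalises the weights.
          d : ℕ
          d = suc ((k ℕ.∸ 1) ℕ.* N)
          Pℝ : ℝ
          Pℝ = fromℚ (+ 1 ℚ./ d)
          P : Carrier
          P = ⟦ Pℝ ⟧
          open ColourWeights O G f f-proper P κ hiding (N; p)
          p′ : Vector Carrier (suc (#nonEdges G))
          p′ = ColourWeights.p O G f f-proper P κ
          open WeightedGraph O G p′ using (A; A-sym)

          p : Vector ℝ (suc (#nonEdges G))
          p zero    = Pℝ
          p (suc i) = fromℕ (k ℕ.∸ 1) ℝ.* Pℝ ℝ.* (if mono i then 1ℝ else 0ℝ)

          p≈p′ : ∀ i → ⟦ p i ⟧ ≈ p′ i
          p≈p′ zero    = refl
          p≈p′ (suc i) = trans (*-homo (fromℕ (k ℕ.∸ 1) ℝ.* Pℝ) (if mono i then 1ℝ else 0ℝ))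
            (*-cong (trans (*-homo (fromℕ (k ℕ.∸ 1)) Pℝ) (*-congʳ (fromℕ-homo (k ℕ.∸ 1)))) (bit-homo 1-homo 0-homo (mono i)))

          0≤P : 0# ≤ P
          0≤P = fromℚ-nonNeg (+ 1 ℚ./ d) (1/d-pos d)

          P-inverse : P * (1# + κ * ι N) ≈ 1#
          P-inverse = trans (*-congˡ (+-congˡ (sym (×1-homo-* (k ℕ.∸ 1) N)))) (1/d-homo d)

          0≤p′ : ∀ i → 0# ≤ p′ i
          0≤p′ = p-nonNeg 0≤P 0≤κ

          ∑p′≈1 : sum p′ ≈ 1#
          ∑p′≈1 = trans sum-p P-inverse

          p∈Δ : Δ (suc (#nonEdges G)) p
          p∈Δ = (λ i → ≤-reflects 0ℝ (p i) (≤-trans (≤-reflexive 0-homo) (≤-trans (0≤p′ i) (≤-reflexive (sym (p≈p′ i))))))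
              , ≈-reflects (ℝ.sum p) 1ℝ (trans (sum-homo p p≈p′) (trans ∑p′≈1 (sym 1-homo)))

          pos : ∀ i → 0ℝ ℝ.< ψ₀ p i
          pos = ψ₀>0 p p≈p′ 0≤p′ ∑p′≈1

          p′∈ℚ : ∀ i → Rational (p′ i)
          p′∈ℚ zero    = + 1 ℚ./ d , refl
          p′∈ℚ (suc i) = Rational-* (Rational-* (ι∈ (k ℕ.∸ 1)) (+ 1 ℚ./ d , refl)) (bit∈ (mono i))

          ψ∈ℚ : ∀ t i → Rational (matrixPower A t i i)
          ψ∈ℚ t i = matrixPower∈ (A∈ G p′∈ℚ) t i i

          ratio∈ℚ : ∀ i → Rational ⟦ ratio p i (pos i) ⟧
          ratio∈ℚ i = Rational-resp (ratio-homo p i (pos i)) (Rational-*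
            (Rational-resp (ψ₁-homo p p≈p′ i) (ψ∈ℚ (suc (T ℕ.+ T)) i))
            (Rational-⁻¹ (ψ₀ p i) (pos i) (Rational-resp (ψ₀-homo p p≈p′ i) (ψ∈ℚ (T ℕ.+ T) i))))

          ratio≤ : ∀ i → ⟦ ratio p i (pos i) ⟧ ≤ 1# + κ * P
          ratio≤ i = ≤-trans (≤-reflexive (ratio-homo p i (pos i)))
            (≤⇒ratio≤ (⁻¹-homo (ψ₀ p i) (pos i)) (⁻¹-nonNeg (ψ₀ p i) (pos i)) (begin
              ⟦ ψ₁ p i ⟧                                   ≈⟨ ψ₁-homo p p≈p′ i ⟩
              matrixPower A (suc (T ℕ.+ T)) i i            ≲⟨ SymmetricPowers.matrixPower-ratio A A-sym (λ z → quad-upper z 0≤P (ι-mono-≤ w≤k-1)) T i ⟩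
              (1# + κ * P) * matrixPower A (T ℕ.+ T) i i   ≈⟨ *-congˡ (ψ₀-homo p p≈p′ i) ⟨
              (1# + κ * P) * ⟦ ψ₀ p i ⟧                    ∎))

          -- The slack `E * P` of `colouring-gap`, kept as a rational so that `gap⇒<` applies.
          gap : ℚ
          gap = e ℚ.* (+ 1 ℚ./ d)

          module _ (i₀ : Fin n) (maximal : ∀ j → ⟦ ratio p j (pos j) ⟧ ≤ ⟦ ratio p i₀ (pos i₀) ⟧) where
            below-threshold : ratio p i₀ (pos i₀) ℝ.< threshold p
            below-threshold = R.gap⇒< {ratio p i₀ (pos i₀)} {threshold p} {gap} (*-pos (1/d-pos D) (1/d-pos d))
              (≤-reflects (ratio p i₀ (pos i₀) ℝ.+ fromℚ gap) (threshold p) (begin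
                ⟦ ratio p i₀ (pos i₀) ℝ.+ fromℚ gap ⟧               ≈⟨ +-homo (ratio p i₀ (pos i₀)) (fromℚ gap) ⟩
                ⟦ ratio p i₀ (pos i₀) ⟧ + ⟦ fromℚ gap ⟧             ≲⟨ +-mono-≤ (ratio≤ i₀) (≤-reflexive (sym (fromℚ-* e (+ 1 ℚ./ d)))) ⟩
                (1# + κ * P) + E * P                     ≲⟨ colouring-gap 0≤P 0≤E 0≤κ (ι-mono-≤ (ℕ.≤-trans (count≤ mono) (#nonEdges≤ G))) ε≤E P-inverse
                                                              (trans (*-congˡ (sym D-expand)) E-inverse) ⟩
                (1# - ⟦ ε ⟧) * (P * (1# + κ) + 1#)   ≈⟨ *-congˡ (+-congʳ (*-congˡ (sym ιk≈1+κ))) ⟩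
                (1# - ⟦ ε ⟧) * (P * ι k + 1#)        ≈⟨ threshold-homo p p≈p′ ⟨
                ⟦ threshold p ⟧                      ∎))

            bounded-by-maximum : ∀ i (s : 0ℝ ℝ.< ψ₀ p i) → ratio p i s ℝ.≤ ratio p i₀ (pos i₀)
            bounded-by-maximum i s = ≤-reflects (ratio p i s) (ratio p i₀ (pos i₀)) (begin
              ⟦ ratio p i s ⟧                       ≈⟨ ratio-homo p i s ⟩
              -- The maximum ranges over arbitrary positivity proofs `s`, while the maximal index
              -- was found with the fixed family `pos`.
              ⟦ ψ₁ p i ⟧ * ⟦ ψ₀ p i ⁻¹[ s ] ⟧       ≈⟨ *-congˡ (inverse-unique (⁻¹-homo (ψ₀ p i) s) (⁻¹-homo (ψ₀ p i) (pos i))) ⟩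
              ⟦ ψ₁ p i ⟧ * ⟦ ψ₀ p i ⁻¹[ pos i ] ⟧   ≈⟨ ratio-homo p i (pos i) ⟨
              ⟦ ratio p i (pos i) ⟧                 ≲⟨ maximal i ⟩
              ⟦ ratio p i₀ (pos i₀) ⟧               ∎)

            maximum-certificate : Certificate p
            maximum-certificate = ratio p i₀ (pos i₀) , ((i₀ , pos i₀ , R.≈-refl {ratio p i₀ (pos i₀)}) , bounded-by-maximum) , below-threshold

        colouring-certificate : ∃ λ p → Δ (suc (#nonEdges G)) p × Certificate p
        colouring-certificate =
          let i₀ , maximal = argmax (ℕ.≤-trans 1≤k k≤n) (λ i → ⟦ ratio p i (pos i) ⟧) ratio∈ℚ
          in p , p∈Δ , maximum-certificate i₀ maximal

      certificate : Perfect G → ¬ HasClique G k → ∃ λ p → Δ (suc (#nonEdges G)) p × Certificate p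
      certificate perfect ¬clique =
        -- The identity injection makes the induced subgraph `G` itself. If `k` ≤ `w`, the clique of
        -- size `w` would contain one of size `k`, so `w` ≤ `k` - 1.
        let w , ((f , f-proper) , _) , (clique , _) = perfect (↣-id (Fin n))
        in colouring-certificate f f-proper
             (ℕ.<⇒≤pred (ℕ.≰⇒> (λ k≤w → ¬clique (HasClique-downward G k≤w clique))))

open import Defs

-- The target ring is again the reals, so the embedding is the identity and its laws hold by
-- reflexivity and by wrapping the relations in the records.
module RealTransfer = Transfer ℝ-ordered id
  (λ x y → ⟪ RealOrder.≈-refl {x + y} ⟫) (λ x y → ⟪ RealOrder.≈-refl {x * y} ⟫) (λ x → ⟪ RealOrder.≈-refl { - x } ⟫)
  ⟪ RealOrder.≈-refl {0ℝ} ⟫ ⟪ RealOrder.≈-refl {1ℝ} ⟫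
  (λ _ _ → ⟪_⟫) (λ _ _ → ≃⇒≈) (λ _ _ → ⟪_⟫) (λ _ _ → ≼⇒≤)

theorem5 : ∀ {n} (G : Graph n) → Perfect G →
    ∀ (k : ℕ) → 2 ℕ.≤ k → k ℕ.≤ n →
    ∀ (ε : ℝ) (ε>0 : 0ℝ < ε) →
    ε ≤ fromℚ (+ 1 ℚ./ (suc k ℕ.* (2 ℕ.+ (k ℕ.∸ 1) ℕ.* n ℕ.* (n ℕ.∸ 1)))) →
    ∀ (T : ℕ) (ℓ : ℝ) → IsLn (fromℕ (2 ℕ.* n) * ε ⁻¹[ ε>0 ]) ℓ →
    ε ⁻¹[ ε>0 ] * ℓ ≤ fromℕ T →
    (¬ HasClique G k)
    ⇔
    (∃ λ (p : Vector ℝ (suc (#nonEdges G))) → Δ (suc (#nonEdges G)) p ×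
    (∃[ μ ]
    IsMaximum (λ i → 0ℝ < ψᵈ (2 ℕ.* T) A[ G , p ] i)
    (λ i pos → ψᵈ (2 ℕ.* T ℕ.+ 1) A[ G , p ] i * ψᵈ (2 ℕ.* T) A[ G , p ] i ⁻¹[ pos ])
    μ
    × μ < (1ℝ - ε) * (p zero * fromℕ k + 1ℝ)))
theorem5 {n} G perfect k 2≤k k≤n ε ε>0 ε≤ T ℓ isLn T-large = mk⇔
  (E.certificate perfect)
  (λ (p , p∈Δ , c) → E.no-clique ℓ isLn T-large p p∈Δ c)
  where
  module E = RealTransfer.Equivalence G k 2≤k k≤n ε ε>0 ε≤ T
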